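{- The class of rigid conjunctive conic idempotent residuated lattices has the strong amalgamation property.
   Context: A residuated lattice is an algebra $(A,\wedge,\vee,\cdot,\backslash,/,1)$ such that $(A,\wedge,\vee)$ is a lattice, $(A,\cdot,1)$ is a monoid, and $y\le x\backslash z \iff x\cdot y\le z\iff x\le z/y$ for all $x,y,z$. It is idempotent if $x\cdot x=x$ for all $x$, and conic if every $a\in A$ satisfies $a\le 1$ or $1\le a$. Define $x^r:=x\backslash 1$, $x^\ell:=1/x$, $x^\star:=x^\ell\wedge x^r$, $\gamma(x):=x^{\ell r}\wedge x^{r\ell}$ (superscripts are applied from left to right, e.g. $x^{\ell r}=(x^\ell)^r$). A (semi)conic idempotent residuated lattice is rigid if it satisfies $x^r=x^{r\star\star}$ and $x^\ell=x^{\ell\star\star}$, and conjunctive if it satisfies $\gamma(x\wedge y)=\gamma(x)\wedge\gamma(y)$. A class $\mathcal K$ of similar algebras has the strong amalgamation property if for all $\mathbf A,\mathbf B,\mathbf C\in\mathcal K$ and embeddings $f_B\colon\mathbf A\to\mathbf B$, $f_C\colon\mathbf A\to\mathbf C$ there are $\mathbf D\in\mathcal K$ and embeddings $g_B\colon\mathbf B\to\mathbf D$, $g_C\colon\mathbf C\to\mathbf D$ with $g_B\circ f_B=g_C\circ f_C$ and $(g_B\circ f_B)[A]=g_B[B]\cap g_C[C]$. -}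

module Defs where

open import Algebra.Bundles.Raw using (RawMonoid)
open import Algebra.Core using (Op₁; Op₂)
import Algebra.Definitions as AlgebraicDefinitions
open import Algebra.Lattice.Bundles.Raw using (RawLattice)
open import Algebra.Lattice.Morphism.Structures using (module LatticeMorphisms)
open import Algebra.Lattice.Structures using (IsLattice)
open import Algebra.Morphism.Definitions using (Homomorphic₂)
open import Algebra.Morphism.Structures using (module MonoidMorphisms)
open import Algebra.Structures using (IsMonoid)
open import Data.Product using (Σ-syntax; ∃; _×_)
open import Data.Sum using (_⊎_)
open import Function using (_∘_; _⇔_)
open import Level using (Level; _⊔_; suc)
open import Relation.Binary using (Rel)
import Relation.Binary.Construct.NaturalOrder.Left as NaturalOrder
open import Relation.Unary using (Pred; _∈_; _∩_; _≐_)

-- Algebras are setoid-based: elements are compared by _≈_, and every operation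
-- is required to respect it.

record ResiduatedLattice (c ℓ : Level) : Set (suc (c ⊔ ℓ)) where
  infixr 7 _∧_
  infixr 6 _∨_
  infixl 8 _∙_ _\\_ _//_
  infix  4 _≈_
  field
    Carrier : Set c
    _≈_     : Rel Carrier ℓ
    _∧_     : Op₂ Carrier
    _∨_     : Op₂ Carrier
    _∙_     : Op₂ Carrier
    _\\_    : Op₂ Carrier
    _//_    : Op₂ Carrier
    ε       : Carrier

  -- x ≤ y is x ≈ x ∧ y
  open NaturalOrder _≈_ _∧_ public using (_≤_)
  open AlgebraicDefinitions _≈_ using (Congruent₂)

  field
    isLattice : IsLattice _≈_ _∨_ _∧_
    isMonoid  : IsMonoid _≈_ _∙_ ε
    \\-cong   : Congruent₂ _\\_
    //-cong   : Congruent₂ _//_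
    \\-residual : ∀ x y z → y ≤ x \\ z ⇔ x ∙ y ≤ z
    //-residual : ∀ x y z → x ∙ y ≤ z ⇔ x ≤ z // y

  rawLattice : RawLattice c ℓ
  rawLattice = record { _≈_ = _≈_ ; _∧_ = _∧_ ; _∨_ = _∨_ }

  rawMonoid : RawMonoid c ℓ
  rawMonoid = record { _≈_ = _≈_ ; _∙_ = _∙_ ; ε = ε }

  infix 9 _ʳ _ˡ _⋆

  _ʳ : Op₁ Carrier
  x ʳ = x \\ ε

  _ˡ : Op₁ Carrier
  x ˡ = ε // x

  _⋆ : Op₁ Carrier
  x ⋆ = x ˡ ∧ x ʳ

  γ : Op₁ Carrier
  γ x = (x ˡ) ʳ ∧ (x ʳ) ˡ

module _ {c ℓ} (𝐀 : ResiduatedLattice c ℓ) where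
  open ResiduatedLattice 𝐀
  open AlgebraicDefinitions _≈_ using (Idempotent)

  IsIdempotent : Set (c ⊔ ℓ)
  IsIdempotent = Idempotent _∙_

  IsConic : Set (c ⊔ ℓ)
  IsConic = ∀ a → a ≤ ε ⊎ ε ≤ a

  IsRigid : Set (c ⊔ ℓ)
  IsRigid = (∀ x → x ʳ ≈ ((x ʳ) ⋆) ⋆) × (∀ x → x ˡ ≈ ((x ˡ) ⋆) ⋆)

  IsConjunctive : Set (c ⊔ ℓ)
  IsConjunctive = ∀ x y → γ (x ∧ y) ≈ γ x ∧ γ y

  record IsRigidConjunctiveConicIdempotent : Set (c ⊔ ℓ) where
    field
      idempotent  : IsIdempotent
      conic       : IsConic
      rigid       : IsRigid
      conjunctive : IsConjunctive

module _ {c₁ ℓ₁ c₂ ℓ₂}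
         (𝐀 : ResiduatedLattice c₁ ℓ₁) (𝐁 : ResiduatedLattice c₂ ℓ₂) where
  private
    module A = ResiduatedLattice 𝐀
    module B = ResiduatedLattice 𝐁
  open LatticeMorphisms A.rawLattice B.rawLattice using (IsLatticeMonomorphism)
  open MonoidMorphisms A.rawMonoid B.rawMonoid using (IsMonoidHomomorphism)

  -- Injectivity is part of IsLatticeMonomorphism.
  record IsEmbedding (f : A.Carrier → B.Carrier) : Set (c₁ ⊔ ℓ₁ ⊔ ℓ₂) where
    field
      isLatticeMonomorphism : IsLatticeMonomorphism f
      isMonoidHomomorphism  : IsMonoidHomomorphism f
      \\-homo : Homomorphic₂ A.Carrier B.Carrier B._≈_ f A._\\_ B._\\_
      //-homo : Homomorphic₂ A.Carrier B.Carrier B._≈_ f A._//_ B._//_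

-- The image of f in a setoid, closed under the setoid's equality.
Image : ∀ {a b ℓ} {A : Set a} {B : Set b} → Rel B ℓ → (A → B) → Pred B (a ⊔ ℓ)
Image _≈_ f y = ∃ λ x → f x ≈ y

StrongAmalgamationProperty : ∀ {c ℓ p} → Pred (ResiduatedLattice c ℓ) p →
                             Set (suc (c ⊔ ℓ) ⊔ p)
StrongAmalgamationProperty {c} {ℓ} 𝒦 =
  (𝐀 𝐁 𝐂 : ResiduatedLattice c ℓ) → 𝐀 ∈ 𝒦 → 𝐁 ∈ 𝒦 → 𝐂 ∈ 𝒦 →
  let module A = ResiduatedLattice 𝐀
      module B = ResiduatedLattice 𝐁
      module C = ResiduatedLattice 𝐂
  in
  (fB : A.Carrier → B.Carrier) (fC : A.Carrier → C.Carrier) →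
  IsEmbedding 𝐀 𝐁 fB → IsEmbedding 𝐀 𝐂 fC →
  Σ[ 𝐃 ∈ ResiduatedLattice c ℓ ] 𝐃 ∈ 𝒦 ×
  let module D = ResiduatedLattice 𝐃 in
  Σ[ gB ∈ (B.Carrier → D.Carrier) ] Σ[ gC ∈ (C.Carrier → D.Carrier) ]
    IsEmbedding 𝐁 𝐃 gB × IsEmbedding 𝐂 𝐃 gC ×
    (∀ a → gB (fB a) D.≈ gC (fC a)) ×
    Image D._≈_ (gB ∘ fB) ≐ (Image D._≈_ gB ∩ Image D._≈_ gC)

{-# OPTIONS --safe #-}
module Submission where

-- In an idempotent conic residuated lattice x ∙ y is x ∧ y or x ∨ y, according to
-- whether x ∙ y ≤ ε.  With rigidity and conjunctivity, this alternative depends only on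
-- the sides of ε where x and y lie and on their classes, where x and y are in the same
-- class if x ⋆ and x ⋆ ⋆ give the same element below ε as y ⋆ and y ⋆ ⋆.  The classes form a chain.  Over each
-- class lie a fibre of the Brouwerian algebra {x ≤ ε} and, in reverse order, a fibre of
-- the lattice {ε < x}.  The only further data are labels, which mark the classes where
-- left and right residuals into ε differ; a labelled class has an immediate
-- predecessor, each of the two determines the other, and the fibres on which this
-- bears are trivial.  Because of this an embedding contains a labelled class if and only
-- if it contains the predecessor.
--
-- To amalgamate B and C over A, merge the chains of classes, putting B before C in each
-- gap of A; no class falls between a labelled class and its predecessor.  Then
-- amalgamate the negative parts by ideals of the coproduct of B and C over A, as for
-- Brouwerian algebras, and the positive parts by pairs of ideals, as for lattices,
-- always requiring that an ideal of class t lies between the ideals of all elements of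
-- class below t and of class at most t.

open import Defs
open import Axiom.ExcludedMiddle using (ExcludedMiddle)
open import Algebra.Core using (Op₁; Op₂)
import Algebra.Construct.Flip.Op as Flip
import Algebra.Lattice.Bundles as Algebraic
open import Algebra.Lattice.Structures using (IsLattice)
import Algebra.Lattice.Morphism.LatticeMonomorphism as LatticeMonomorphism
open import Algebra.Lattice.Morphism.Structures using (module LatticeMorphisms)
import Algebra.Morphism.MonoidMonomorphism as MonoidMonomorphism
open import Algebra.Morphism.Structures using (module MonoidMorphisms)
import Algebra.Lattice.Properties.Lattice as AlgebraicLattice
open import Algebra.Structures using (IsMonoid)
open import Data.Empty using (⊥-elim)
open import Data.Product using (Σ-syntax; ∃; _×_; _,_; proj₁; proj₂; swap)
open import Data.Sum using (_⊎_; inj₁; inj₂; [_,_]′)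
import Data.Sum as Sum
open import Function using (_∘_; id; flip; Equivalence; mk⇔)
import Function.Properties.Equivalence as ⇔
open import Level using (Level; _⊔_; suc)
open import Relation.Binary using (Rel)
import Relation.Binary.Construct.Interior.Symmetric as Symmetric
open Symmetric using (SymInterior; _,_)
import Relation.Binary.Lattice as OrderTheoretic
import Relation.Binary.Lattice.Properties.Lattice as OrderTheoreticLattice
open import Relation.Nullary using (¬_; Dec; yes; no)
open import Relation.Nullary.Decidable using (True; toWitness; fromWitness)
open import Relation.Unary using (Pred)

open Equivalence using (to; from)

-- Everything rests on the closure operator `⋆ ⋆`. Each element `x ⋆` is comparable with all
-- elements, so the closed elements form a chain; this is where the chain of classes comes from.
-- Conjunctivity says that `⋆ ⋆` preserves meets, and with the De Morgan law for joins it follows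
-- that, on either side of ε, a meet or a join has the class of one of its operands. Rigidity makes
-- the residuals into ε closed, that is, greatest in their fibres, so that they can be read off from
-- the chain and the labels. The greatest elements of the fibres are values of terms. Hence, over a
-- class that B and C share, they come from A, and this is what allows elements of B and of C within
-- one class to be compared. All orders are preorders and equality is inequality both ways, so
-- neither classes nor ideals require quotients. Most statements about left residuals are obtained
-- from those about right residuals by taking mirror images.

record LatticeOrder a q : Set (suc (a ⊔ q)) where
  infix  4 _≤_
  infixr 7 _∧_
  infixr 6 _∨_
  field
    Carrier : Set a
    _≤_     : Rel Carrier q
    _∧_     : Op₂ Carrier
    _∨_     : Op₂ Carrier
    ≤-refl  : ∀ {x} → x ≤ x
    ≤-trans : ∀ {x y z} → x ≤ y → y ≤ z → x ≤ z
    x∧y≤x   : ∀ {x y} → x ∧ y ≤ x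
    x∧y≤y   : ∀ {x y} → x ∧ y ≤ y
    ∧-greatest : ∀ {x y z} → z ≤ x → z ≤ y → z ≤ x ∧ y
    x≤x∨y   : ∀ {x y} → x ≤ x ∨ y
    y≤x∨y   : ∀ {x y} → y ≤ x ∨ y
    ∨-least : ∀ {x y z} → x ≤ z → y ≤ z → x ∨ y ≤ z

  infixr 5 _⊙_
  _⊙_ : ∀ {x y z} → x ≤ y → y ≤ z → x ≤ z
  _⊙_ = ≤-trans

  ∧-mono : ∀ {x y x′ y′} → x ≤ x′ → y ≤ y′ → x ∧ y ≤ x′ ∧ y′
  ∧-mono p q = ∧-greatest (x∧y≤x ⊙ p) (x∧y≤y ⊙ q)

  ∨-mono : ∀ {x y x′ y′} → x ≤ x′ → y ≤ y′ → x ∨ y ≤ x′ ∨ y′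
  ∨-mono p q = ∨-least (p ⊙ x≤x∨y) (q ⊙ y≤x∨y)

-- A total preorder, because the classes of a frame are represented by its elements, compared
-- through a closed representative.
record Chain a q : Set (suc (a ⊔ q)) where
  infix 4 _≼_ _≺_ _∼_
  field
    Carrier : Set a
    _≼_     : Rel Carrier q
    ≼-refl  : ∀ {x} → x ≼ x
    ≼-trans : ∀ {x y z} → x ≼ y → y ≼ z → x ≼ z
    ≼-total : ∀ x y → x ≼ y ⊎ y ≼ x

  _≺_ _∼_ : Rel Carrier q
  x ≺ y = ¬ y ≼ x
  x ∼ y = x ≼ y × y ≼ x

  infixr 5 _⊙_
  _⊙_ : ∀ {x y z} → x ≼ y → y ≼ z → x ≼ z
  _⊙_ = ≼-trans

  ∼-sym : ∀ {x y} → x ∼ y → y ∼ x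
  ∼-sym = swap

  ∼-trans : ∀ {x y z} → x ∼ y → y ∼ z → x ∼ z
  ∼-trans (p , p′) (q , q′) = p ⊙ q , q′ ⊙ p′

  ≺⇒≼ : ∀ {x y} → x ≺ y → x ≼ y
  ≺⇒≼ {x} {y} x≺y with ≼-total x y
  ... | inj₁ p = p
  ... | inj₂ p = ⊥-elim (x≺y p)

  ≼-≺-trans : ∀ {x y z} → x ≼ y → y ≺ z → x ≺ z
  ≼-≺-trans p q r = q (r ⊙ p)

  ≺-≼-trans : ∀ {x y z} → x ≺ y → y ≼ z → x ≺ z
  ≺-≼-trans p q r = p (q ⊙ r)

-- The products of a conic idempotent residuated lattice are determined by the
-- lattice and the relation x R y = (x ∙ y ≤ ε): x ∙ y is x ∧ y if x R y, and
-- x ∨ y otherwise.  Taking ⋆ as primitive makes the left-right mirror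
-- image of a frame preserve it definitionally.
record Frame a q : Set (suc (a ⊔ q)) where
  infix 9 _ʳ _ˡ _⋆
  infix 4 _R_
  infixr 6 _⇒_
  field
    lattice : LatticeOrder a q
  open LatticeOrder lattice public
  field
    ε   : Carrier
    _R_ : Rel Carrier q
    _ʳ _ˡ _⋆ : Op₁ Carrier
    _⇒_ : Op₂ Carrier
    conic : ∀ x → x ≤ ε ⊎ ε ≤ x
    R⇒≤ʳ : ∀ {x y} → x R y → y ≤ x ʳ
    ≤ʳ⇒R : ∀ {x y} → y ≤ x ʳ → x R y
    R⇒≤ˡ : ∀ {x y} → x R y → x ≤ y ˡ
    ≤ˡ⇒R : ∀ {x y} → x ≤ y ˡ → x R y
    R⇒≤⋆ : ∀ {x y} → x R y → y R x → y ≤ x ⋆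
    ≤⋆⇒R : ∀ {x y} → y ≤ x ⋆ → x R y
    ≤⋆⇒R˘ : ∀ {x y} → y ≤ x ⋆ → y R x
    ≤ε⇒Rε : ∀ {x} → x ≤ ε → x R ε
    Rε⇒≤ε : ∀ {x} → x R ε → x ≤ ε
    ≤ε⇒εR : ∀ {x} → x ≤ ε → ε R x
    εR⇒≤ε : ∀ {x} → ε R x → x ≤ ε
    R-separates  : ∀ {x y z} → x R z → ¬ y R z → x ≤ y
    R˘-separates : ∀ {x y z} → z R x → ¬ z R y → x ≤ y
    R-¬R⇒≤ : ∀ {x y z} → x R y → ¬ y R z → x ≤ z
    ¬R-R⇒≥ : ∀ {x y z} → ¬ x R y → y R z → z ≤ x
    ʳ-closed : ∀ {x} → x ʳ ⋆ ⋆ ≤ x ʳ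
    ˡ-closed : ∀ {x} → x ˡ ⋆ ⋆ ≤ x ˡ
    ⋆⋆-∧ : ∀ {x y} → x ⋆ ⋆ ∧ y ⋆ ⋆ ≤ (x ∧ y) ⋆ ⋆
    ⇒-≤ε    : ∀ {x y} → x ⇒ y ≤ ε
    ⇒-intro : ∀ {x y z} → z ≤ ε → x ∧ z ≤ y → z ≤ x ⇒ y
    ⇒-elim  : ∀ {x y} → x ∧ (x ⇒ y) ≤ y

mirror : ∀ {a q} → Frame a q → Frame a q
mirror F = record
  { lattice = lattice ; ε = ε ; _R_ = flip _R_ ; _ʳ = _ˡ ; _ˡ = _ʳ ; _⋆ = _⋆ ; _⇒_ = _⇒_
  ; conic = conic
  ; R⇒≤ʳ = R⇒≤ˡ ; ≤ʳ⇒R = ≤ˡ⇒R ; R⇒≤ˡ = R⇒≤ʳ ; ≤ˡ⇒R = ≤ʳ⇒R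
  ; R⇒≤⋆ = flip R⇒≤⋆ ; ≤⋆⇒R = ≤⋆⇒R˘ ; ≤⋆⇒R˘ = ≤⋆⇒R
  ; ≤ε⇒Rε = ≤ε⇒εR ; Rε⇒≤ε = εR⇒≤ε ; ≤ε⇒εR = ≤ε⇒Rε ; εR⇒≤ε = Rε⇒≤ε
  ; R-separates = R˘-separates ; R˘-separates = R-separates
  ; R-¬R⇒≤ = λ p q → ¬R-R⇒≥ q p ; ¬R-R⇒≥ = λ p q → R-¬R⇒≤ q p
  ; ʳ-closed = ˡ-closed ; ˡ-closed = ʳ-closed ; ⋆⋆-∧ = ⋆⋆-∧
  ; ⇒-≤ε = ⇒-≤ε ; ⇒-intro = ⇒-intro ; ⇒-elim = ⇒-elim
  }
  where open Frame F

-- `pred` is total but constrained only at labelled elements. `IsPred` and `Q` quantify over the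
-- elements below instead of mentioning `pred`, so they depend on the order and on `Lab` alone.
record Labels {a q} (K : Chain a q) ℓ : Set (suc ℓ ⊔ a ⊔ q) where
  open Chain K
  field
    Lab : Pred Carrier ℓ
    pred : Op₁ Carrier
    Lab-resp : ∀ {x y} → x ∼ y → Lab x → Lab y
    pred≺ : ∀ {x} → Lab x → pred x ≺ x
    ≺⇒≼pred : ∀ {x y} → Lab x → y ≺ x → y ≼ pred x

  IsPred : Rel Carrier (a ⊔ q ⊔ ℓ)
  IsPred x y = Lab y × x ≺ y × (∀ z → z ≺ y → z ≼ x)

  -- For x ≤ ε ≤ y in a frame, this is x R y.
  Q : Rel Carrier (a ⊔ q ⊔ ℓ)
  Q x y = x ≼ y ⊎ Lab x × (∀ z → z ≺ x → z ≼ y)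

-- The labelled classes of a frame are those x where x ʳ is strictly larger than
-- x ⋆.  Such an x has an immediate predecessor, and can be recovered from it.
record Labelling {a q} (K : Chain a q) ℓ : Set (suc ℓ ⊔ a ⊔ q) where
  field
    labels : Labels K ℓ
  open Labels labels public
  open Chain K
  field
    succ : Op₁ Carrier
    pred-mono : ∀ {x y} → x ∼ y → pred x ≼ pred y
    succ-mono : ∀ {x y} → x ∼ y → succ x ≼ succ y
    succ-pred : ∀ {x} → Lab x → succ (pred x) ∼ x

module Classical (em : ∀ {a} → ExcludedMiddle a) where

  -- Classes, labels and residuals in a frame

  module FrameTheory {a q} (F : Frame a q) where
    open Frame F

    R-mono : ∀ {x y x′ y′} → x′ ≤ x → y′ ≤ y → x R y → x′ R y′
    R-mono p q r = ≤ˡ⇒R (p ⊙ R⇒≤ˡ (≤ʳ⇒R (q ⊙ R⇒≤ʳ r)))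

    x≤x⋆⋆ : ∀ {x} → x ≤ x ⋆ ⋆
    x≤x⋆⋆ = R⇒≤⋆ (≤⋆⇒R˘ ≤-refl) (≤⋆⇒R ≤-refl)

    ⋆-anti : ∀ {x y} → x ≤ y → y ⋆ ≤ x ⋆
    ⋆-anti p = R⇒≤⋆ (R-mono p ≤-refl (≤⋆⇒R ≤-refl)) (R-mono ≤-refl p (≤⋆⇒R˘ ≤-refl))

    ⋆-swap : ∀ {x y} → x ≤ y ⋆ → y ≤ x ⋆
    ⋆-swap p = x≤x⋆⋆ ⊙ ⋆-anti p

    ⋆⋆⋆ : ∀ {x} → x ⋆ ⋆ ⋆ ≤ x ⋆
    ⋆⋆⋆ = ⋆-anti x≤x⋆⋆

    -- Both `x R x ⋆` and `x ⋆ R x` hold. If y fails one of these relations to x, then x separates y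
    -- from `x ⋆`, which is therefore below y; if y fails neither, then it is below `x ⋆` by
    -- maximality.
    ⋆-conical : ∀ x y → y ≤ x ⋆ ⊎ x ⋆ ≤ y
    ⋆-conical x y with em {P = x R y} | em {P = y R x}
    ... | yes p | yes q = inj₁ (R⇒≤⋆ p q)
    ... | no ¬p | _     = inj₂ (R˘-separates (≤⋆⇒R ≤-refl) ¬p)
    ... | yes _ | no ¬q = inj₂ (R-separates (≤⋆⇒R˘ ≤-refl) ¬q)

    ⋆-∨ : ∀ {x y} → x ⋆ ∧ y ⋆ ≤ (x ∨ y) ⋆
    ⋆-∨ = R⇒≤⋆ (≤ˡ⇒R (∨-least (R⇒≤ˡ (≤⋆⇒R x∧y≤x)) (R⇒≤ˡ (≤⋆⇒R x∧y≤y))))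
               (≤ʳ⇒R (∨-least (R⇒≤ʳ (≤⋆⇒R˘ x∧y≤x)) (R⇒≤ʳ (≤⋆⇒R˘ x∧y≤y))))

    ≤ε⇒ε≤⋆ : ∀ {x} → x ≤ ε → ε ≤ x ⋆
    ≤ε⇒ε≤⋆ p = R⇒≤⋆ (≤ε⇒Rε p) (≤ε⇒εR p)

    ε≤⇒⋆≤ε : ∀ {x} → ε ≤ x → x ⋆ ≤ ε
    ε≤⇒⋆≤ε p = Rε⇒≤ε (R-mono ≤-refl p (≤⋆⇒R˘ ≤-refl))

    ≤ε⇒⋆⋆≤ε : ∀ {x} → x ≤ ε → x ⋆ ⋆ ≤ ε
    ≤ε⇒⋆⋆≤ε p = ε≤⇒⋆≤ε (≤ε⇒ε≤⋆ p)

    ≤ε⇒ε≤ʳ : ∀ {x} → x ≤ ε → ε ≤ x ʳ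
    ≤ε⇒ε≤ʳ p = R⇒≤ʳ (≤ε⇒Rε p)

    ≰ε⇒ε≤ : ∀ {x} → ¬ x ≤ ε → ε ≤ x
    ≰ε⇒ε≤ {x} p with conic x
    ... | inj₁ q = ⊥-elim (p q)
    ... | inj₂ q = q

    -- ν x is whichever of x ⋆ and x ⋆ ⋆ lies below ε.
    ν : Op₁ Carrier
    ν x = x ⋆ ∧ x ⋆ ⋆

    ν≤ε : ∀ {x} → ν x ≤ ε
    ν≤ε {x} with conic x
    ... | inj₁ p = x∧y≤y ⊙ ≤ε⇒⋆⋆≤ε p
    ... | inj₂ p = x∧y≤x ⊙ ε≤⇒⋆≤ε p

    ⋆⋆≤ν : ∀ {x} → x ≤ ε → x ⋆ ⋆ ≤ ν x
    ⋆⋆≤ν p = ∧-greatest (≤ε⇒⋆⋆≤ε p ⊙ ≤ε⇒ε≤⋆ p) ≤-refl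

    ⋆≤ν : ∀ {x} → ε ≤ x → x ⋆ ≤ ν x
    ⋆≤ν p = ∧-greatest ≤-refl (ε≤⇒⋆≤ε p ⊙ p ⊙ x≤x⋆⋆)

    ν-closed : ∀ {x} → ν x ⋆ ⋆ ≤ ν x
    ν-closed = ∧-greatest (⋆-anti (⋆-anti x∧y≤x) ⊙ ⋆⋆⋆) (⋆-anti (⋆-anti x∧y≤y) ⊙ ⋆⋆⋆)

    ν-conical : ∀ x y → y ≤ ν x ⊎ ν x ≤ y
    ν-conical x y with conic x
    ... | inj₁ p = Sum.map (_⊙ ⋆⋆≤ν p) (x∧y≤y ⊙_) (⋆-conical (x ⋆) y)
    ... | inj₂ p = Sum.map (_⊙ ⋆≤ν p) (x∧y≤x ⊙_) (⋆-conical x y)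

    ≤ν⇒ : ∀ {x} → x ≤ ε → x ≤ ν x
    ≤ν⇒ p = x≤x⋆⋆ ⊙ ⋆⋆≤ν p

    chain : Chain a q
    chain = record
      { Carrier = Carrier
      ; _≼_ = λ x y → ν x ≤ ν y
      ; ≼-refl = ≤-refl
      ; ≼-trans = ≤-trans
      ; ≼-total = λ x y → Sum.swap (ν-conical x (ν y))
      }
    open Chain chain using (_≼_; _≺_; _∼_; ≺⇒≼)

    ≼ε : ∀ {x} → x ≼ ε
    ≼ε = ν≤ε ⊙ ≤ν⇒ ≤-refl

    -- `ν x` and `ν x ⋆` are the greatest members of the class of x below and above ε. Both are
    -- terms in x, so embeddings preserve them.
    ν-∼ : ∀ {x} → ν x ∼ x
    ν-∼ = x∧y≤y ⊙ ν-closed , ≤ν⇒ ν≤ε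

    ν⋆-∼ : ∀ {x} → ν x ⋆ ∼ x
    ν⋆-∼ = x∧y≤x ⊙ ν-closed , x≤x⋆⋆ ⊙ ⋆≤ν (≤ε⇒ε≤⋆ ν≤ε)

    closed⇒ν : ∀ {x} → x ≤ ε → x ⋆ ⋆ ≤ x → ν x ≤ x
    closed⇒ν p c = x∧y≤y ⊙ c

    -- On {x ≤ ε} the index grows with the element, on {ε ≤ x} it decreases.
    ⋆⋆≤⇒≼ : ∀ {x y} → y ≤ ε → x ⋆ ⋆ ≤ y ⋆ ⋆ → x ≼ y
    ⋆⋆≤⇒≼ q r = x∧y≤y ⊙ r ⊙ ⋆⋆≤ν q

    ≤⇒≼ : ∀ {x y} → y ≤ ε → x ≤ y → x ≼ y
    ≤⇒≼ q r = ⋆⋆≤⇒≼ q (⋆-anti (⋆-anti r))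

    ⋆≤⇒≼ : ∀ {x y} → ε ≤ y → x ⋆ ≤ y ⋆ → x ≼ y
    ⋆≤⇒≼ q r = x∧y≤x ⊙ r ⊙ ⋆≤ν q

    ≥⇒≼ : ∀ {x y} → ε ≤ y → y ≤ x → x ≼ y
    ≥⇒≼ q r = ⋆≤⇒≼ q (⋆-anti r)

    ≼⇒≤⋆⋆ : ∀ {x y} → x ≤ ε → x ≼ y → x ≤ y ⋆ ⋆
    ≼⇒≤⋆⋆ p r = ≤ν⇒ p ⊙ r ⊙ x∧y≤y

    ≼⇒⋆⋆≥ : ∀ {x y} → ε ≤ x → x ≼ y → y ≤ x ⋆ ⋆
    ≼⇒⋆⋆≥ p r = x≤x⋆⋆ ⊙ ⋆-anti (⋆≤ν p ⊙ r ⊙ x∧y≤x)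

    -- By conicity of `⋆`, y is comparable with `x ⋆ ⋆`. Were it below, then `y ≼ x`; so it is above
    -- `x ⋆ ⋆` and hence above x.
    ≺⇒≤ : ∀ {x y} → x ≤ ε → x ≺ y → x ≤ y
    ≺⇒≤ {x} {y} p r with ⋆-conical (x ⋆) y
    ... | inj₁ s = ⊥-elim (r (⋆⋆≤⇒≼ p (⋆-anti (⋆-anti s) ⊙ ⋆⋆⋆)))
    ... | inj₂ s = x≤x⋆⋆ ⊙ s

    ≺⇒≥ : ∀ {x y} → ε ≤ x → x ≺ y → y ≤ x
    ≺⇒≥ {x} {y} p r with ⋆-conical (y ⋆) x
    ... | inj₁ s = ⊥-elim (r (⋆≤⇒≼ p (⋆-swap s)))
    ... | inj₂ s = x≤x⋆⋆ ⊙ s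

    -- `x ⋆ ⋆` and `y ⋆ ⋆` are comparable, so their meet is the smaller of them, and conjunctivity
    -- puts it below `(x ∧ y) ⋆ ⋆`.
    index-∧ : ∀ {x y} → x ≤ ε → y ≤ ε → x ≼ x ∧ y ⊎ y ≼ x ∧ y
    index-∧ {x} {y} p q with ⋆-conical (x ⋆) (y ⋆ ⋆)
    ... | inj₁ s = inj₂ (⋆⋆≤⇒≼ (x∧y≤x ⊙ p) (∧-greatest s ≤-refl ⊙ ⋆⋆-∧))
    ... | inj₂ s = inj₁ (⋆⋆≤⇒≼ (x∧y≤x ⊙ p) (∧-greatest ≤-refl s ⊙ ⋆⋆-∧))

    index-∨ : ∀ {x y} → x ≤ ε → y ≤ ε → x ∨ y ≼ x ⊎ x ∨ y ≼ y
    index-∨ {x} {y} p q with ⋆-conical x (y ⋆)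
    ... | inj₁ s = inj₂ (⋆⋆≤⇒≼ q (⋆-anti (∧-greatest s ≤-refl ⊙ ⋆-∨)))
    ... | inj₂ s = inj₁ (⋆⋆≤⇒≼ p (⋆-anti (∧-greatest ≤-refl s ⊙ ⋆-∨)))

    index-∧⁺ : ∀ {x y} → ε ≤ x → ε ≤ y → x ∧ y ≼ x ⊎ x ∧ y ≼ y
    index-∧⁺ {x} {y} p q with ⋆-conical (x ⋆) (y ⋆ ⋆)
    ... | inj₁ s = inj₂ (⋆≤⇒≼ q (⋆-swap (x≤x⋆⋆ ⊙ ∧-greatest s ≤-refl ⊙ ⋆⋆-∧)))
    ... | inj₂ s = inj₁ (⋆≤⇒≼ p (⋆-swap (x≤x⋆⋆ ⊙ ∧-greatest ≤-refl s ⊙ ⋆⋆-∧)))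

    index-∨⁺ : ∀ {x y} → ε ≤ x → ε ≤ y → x ≼ x ∨ y ⊎ y ≼ x ∨ y
    index-∨⁺ {x} {y} p q with ⋆-conical x (y ⋆)
    ... | inj₁ s = inj₂ (⋆≤⇒≼ (p ⊙ x≤x∨y) (∧-greatest s ≤-refl ⊙ ⋆-∨))
    ... | inj₂ s = inj₁ (⋆≤⇒≼ (p ⊙ x≤x∨y) (∧-greatest ≤-refl s ⊙ ⋆-∨))

    -- The smaller of `x ⋆ ⋆` and `y ⋆ ⋆` is below `(x ∧ y) ⋆ ⋆`, hence below ε. This makes the
    -- elements not below ε a sublattice.
    ∧-≤ε-prime : ∀ {x y} → x ∧ y ≤ ε → x ≤ ε ⊎ y ≤ ε
    ∧-≤ε-prime {x} {y} p with ⋆-conical (x ⋆) (y ⋆ ⋆)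
    ... | inj₁ s = inj₂ (x≤x⋆⋆ ⊙ ∧-greatest s ≤-refl ⊙ ⋆⋆-∧ ⊙ ≤ε⇒⋆⋆≤ε p)
    ... | inj₂ s = inj₁ (x≤x⋆⋆ ⊙ ∧-greatest ≤-refl s ⊙ ⋆⋆-∧ ⊙ ≤ε⇒⋆⋆≤ε p)

    -- So the class of ε has an empty positive fibre, and the positive part is indexed by the
    -- classes strictly below it.
    ≰ε⇒≺ε : ∀ {x} → ¬ x ≤ ε → x ≺ ε
    ≰ε⇒≺ε p q = p (⋆-swap (≤ν⇒ ≤-refl ⊙ q ⊙ x∧y≤x) ⊙ ε≤⇒⋆≤ε ≤-refl)

    ʳ-anti : ∀ {x y} → x ≤ y → y ʳ ≤ x ʳ
    ʳ-anti p = R⇒≤ʳ (R-mono p ≤-refl (≤ʳ⇒R ≤-refl))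

    ˡ-anti : ∀ {x y} → x ≤ y → y ˡ ≤ x ˡ
    ˡ-anti p = R⇒≤ˡ (R-mono ≤-refl p (≤ˡ⇒R ≤-refl))

    xRxʳ : ∀ {x} → x R x ʳ
    xRxʳ = ≤ʳ⇒R ≤-refl

    ⋆≤ʳ : ∀ {x} → x ⋆ ≤ x ʳ
    ⋆≤ʳ = R⇒≤ʳ (≤⋆⇒R ≤-refl)

    ε≤⇒ʳ≤ε : ∀ {x} → ε ≤ x → x ʳ ≤ ε
    ε≤⇒ʳ≤ε p = εR⇒≤ε (R-mono p ≤-refl xRxʳ)

    ε≤⇒ˡ≤ε : ∀ {x} → ε ≤ x → x ˡ ≤ ε
    ε≤⇒ˡ≤ε p = Rε⇒≤ε (R-mono ≤-refl p (≤ˡ⇒R ≤-refl))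

    Labʳ : Carrier → Set q
    Labʳ x = ¬ ν x ʳ ≤ ν x ⋆

    -- For a labelled class, `ν x ʳ` is an element above ε that belongs to the predecessor, and `⋆`
    -- moves it below ε. Since residuals are closed, `predʳ x ⋆` is `ν x ʳ` again, and its left
    -- residual returns to `ν x`.
    predʳ succʳ : Op₁ Carrier
    predʳ x = ν x ʳ ⋆
    succʳ x = ν x ⋆ ˡ

    pred≤ε : ∀ {x} → predʳ x ≤ ε
    pred≤ε = ε≤⇒⋆≤ε (≤ε⇒ε≤ʳ ν≤ε)

    succ≤ε : ∀ {x} → succʳ x ≤ ε
    succ≤ε = ε≤⇒ˡ≤ε (≤ε⇒ε≤⋆ ν≤ε)

    ν-pred : ∀ {x} → ν (predʳ x) ≤ predʳ x
    ν-pred = closed⇒ν pred≤ε ⋆⋆⋆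

    pred-ν : ∀ {x} → predʳ x ≤ ν (predʳ x)
    pred-ν = ≤ν⇒ pred≤ε

    pred⋆≤ : ∀ {x} → predʳ x ⋆ ≤ ν x ʳ
    pred⋆≤ = ʳ-closed

    ¬νʳRν : ∀ {x} → Labʳ x → ¬ ν x ʳ R ν x
    ¬νʳRν l r = l (R⇒≤⋆ xRxʳ r)

    pred-≺ : ∀ {x} → Labʳ x → predʳ x ≺ x
    pred-≺ l r = l (⋆-swap (r ⊙ ν-pred))

    -- Suppose `ν y ⋆ R ν x`. As `ν x ʳ R ν x` fails, separation puts `ν y ⋆` below `ν x ʳ`; so the
    -- relation holds in both orders and `ν x ≤ ν y ⋆ ⋆`, against `y ≺ x`. Hence it fails, and with
    -- `ν x R ν x ʳ` this puts `ν x ʳ` below `ν y ⋆`; then `⋆` reverses the inequality.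
    ≺⇒≼predʳ : ∀ {x y} → Labʳ x → y ≺ x → y ≼ predʳ x
    ≺⇒≼predʳ {x} {y} l r = ⋆-swap (¬R-R⇒≥ ¬νy⋆Rνx xRxʳ) ⊙ pred-ν
      where
      ¬νy⋆Rνx : ¬ ν y ⋆ R ν x
      ¬νy⋆Rνx s = r (⋆-swap (R⇒≤⋆ (≤ʳ⇒R (R-separates s (¬νʳRν l))) s) ⊙ ν-closed)

    succ-predʳ : ∀ {x} → Labʳ x → succʳ (predʳ x) ∼ x
    succ-predʳ l =
      closed⇒ν succ≤ε ˡ-closed ⊙ R-¬R⇒≤ (≤ˡ⇒R (ˡ-anti (x≤x⋆⋆ ⊙ ⋆-anti ν-pred))) (¬νʳRν l) ,
      R⇒≤ˡ (≤ʳ⇒R (⋆-anti pred-ν ⊙ pred⋆≤)) ⊙ ≤ν⇒ succ≤ε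

    labelling : Labelling chain q
    labelling = record
      { labels = record
        { Lab = Labʳ ; pred = predʳ
        ; Lab-resp = λ (p , p′) l r → l (ʳ-anti p′ ⊙ r ⊙ ⋆-anti p)
        ; pred≺ = pred-≺ ; ≺⇒≼pred = ≺⇒≼predʳ
        }
      ; succ = succʳ
      ; pred-mono = λ (p , _) → ν-pred ⊙ ⋆-anti (ʳ-anti p) ⊙ pred-ν
      ; succ-mono = λ (p , _) → closed⇒ν succ≤ε ˡ-closed ⊙ ˡ-anti (⋆-anti p) ⊙ ≤ν⇒ succ≤ε
      ; succ-pred = succ-predʳ
      }
    open Labelling labelling using (Q)

    ε-unlabelled : ∀ {x} → ε ≼ x → ¬ Labʳ x
    ε-unlabelled r l = l (ε≤⇒ʳ≤ε (≤ν⇒ ≤-refl ⊙ r) ⊙ ≤ε⇒ε≤⋆ ν≤ε)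

    -- If `ν x ʳ R y` held, then, y being below `ν x`, the relation would hold in both orders; this
    -- gives `ν x ʳ ≤ y ⋆ ≤ ν x ⋆` and removes the label. As it fails, `ν x R ν x ʳ` forces
    -- `ν x ≤ y`.
    labelled-trivial : ∀ {x y} → x ≤ ε → y ≤ ε → Labʳ x → x ∼ y → x ≤ y
    labelled-trivial {x} {y} p q l (r , r′) = ≤ν⇒ p ⊙ R-¬R⇒≤ xRxʳ ¬νxʳRy
      where
      ¬νxʳRy : ¬ ν x ʳ R y
      ¬νxʳRy s = l (R⇒≤⋆ (R-mono (≤ν⇒ q ⊙ r′) ≤-refl xRxʳ) s ⊙ ⋆-swap (r ⊙ x∧y≤y))

    -- All positive elements concerned lie below `ν z ʳ`. If `y R ν z`, the relation would hold in
    -- both orders and z would have at most the class of y, which is that of its predecessor. So it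
    -- fails, and `ν z R ν z ʳ` gives `ν z ʳ ≤ y`.
    pred-trivial : ∀ {x y z} → ε ≤ x → ε ≤ y → Labʳ z → predʳ z ≼ x → predʳ z ∼ y → x ≤ y
    pred-trivial {x} {y} {z} p q l r (s , s′) = below r ⊙ ¬R-R⇒≥ ¬yRνz xRxʳ
      where
      below : ∀ {w} → predʳ z ≼ w → w ≤ ν z ʳ
      below t = ⋆-swap (pred-ν ⊙ t ⊙ x∧y≤x) ⊙ pred⋆≤
      ¬yRνz : ¬ y R ν z
      ¬yRνz t = pred-≺ l (R⇒≤⋆ t (≤ʳ⇒R (below s)) ⊙ ⋆≤ν q ⊙ s′)

    -- Since `y ˡ` is closed, x may be replaced by `ν x`, so `y ≤ ν x ʳ`. Either y is even below
    -- `ν x ⋆`, which means `x ≼ y`, or `ν x ʳ` exceeds `ν x ⋆`: the class of x is labelled, and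
    -- that of y is at least its predecessor.
    R⇒Q : ∀ {x y} → x ≤ ε → ε ≤ y → x R y → Q x y
    R⇒Q {x} {y} p q r with em {P = x ≼ y}
    ... | yes s = inj₁ s
    ... | no ¬s = inj₂ ((λ t → ¬s (⋆-swap (y≤νʳ ⊙ t) ⊙ ⋆≤ν q)) ,
                        λ z t → ≺⇒≼predʳ lab t ⊙ ν-pred ⊙ ⋆-anti y≤νʳ ⊙ ⋆≤ν q)
      where
      y≤νʳ : y ≤ ν x ʳ
      y≤νʳ = R⇒≤ʳ (R-mono (x∧y≤y ⊙ ⋆-anti (⋆-anti (R⇒≤ˡ r)) ⊙ ˡ-closed) ≤-refl (≤ˡ⇒R ≤-refl))
      lab : Labʳ x
      lab t = ¬s (⋆-swap (y≤νʳ ⊙ t) ⊙ ⋆≤ν q)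

    Q⇒R : ∀ {x y} → x ≤ ε → Q x y → x R y
    Q⇒R p (inj₁ r) = ≤⋆⇒R˘ (≤ν⇒ p ⊙ r ⊙ x∧y≤x)
    Q⇒R p (inj₂ (l , f)) =
      R-mono (≤ν⇒ p) (⋆-swap (pred-ν ⊙ f _ (pred-≺ l) ⊙ x∧y≤x) ⊙ pred⋆≤) xRxʳ

    ʳ≼ : ∀ {x} → x ≤ ε → x ʳ ≼ x
    ʳ≼ p = x∧y≤x ⊙ ⋆-anti ⋆≤ʳ ⊙ ⋆⋆≤ν p

    ʳ≼pred : ∀ {x} → x ≤ ε → x ʳ ≼ predʳ x
    ʳ≼pred p = x∧y≤x ⊙ ⋆-anti (ʳ-anti (≤ν⇒ p)) ⊙ pred-ν

    ≼ʳ : ∀ {x} → ε ≤ x → x ≼ x ʳ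
    ≼ʳ p = x∧y≤x ⊙ ⋆≤ʳ ⊙ ≤ν⇒ (ε≤⇒ʳ≤ε p)

    ≤ε-R : ∀ {x y} → x ≤ ε → y ≤ ε → x R y
    ≤ε-R p q = R-mono ≤-refl q (≤ε⇒Rε p)

    ≰ε-¬R : ∀ {x y} → ¬ x ≤ ε → ¬ y ≤ ε → ¬ x R y
    ≰ε-¬R p q r = p (Rε⇒≤ε (R-mono ≤-refl (≰ε⇒ε≤ q) r))

  -- With both labels, `ν x R ν x ʳ` holds and `ν x R ν x ˡ` fails, so separation gives
  -- `ν x ʳ ≤ ν x ˡ`. This means `ν x ʳ R ν x`, which the right label forbids.
  exclusive : ∀ {a q} (F : Frame a q) {x : Frame.Carrier F} →
              FrameTheory.Labʳ F x → ¬ FrameTheory.Labʳ (mirror F) x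
  exclusive F l l′ =
    FrameTheory.¬νʳRν F l (≤ˡ⇒R (R˘-separates (≤ʳ⇒R ≤-refl) (FrameTheory.¬νʳRν (mirror F) l′)))
    where open Frame F

  -- Residuated lattices as frames

  module OfResiduatedLattice {c ℓ} (𝐗 : ResiduatedLattice c ℓ) where
    open ResiduatedLattice 𝐗
    open IsLattice isLattice using (sym; isEquivalence)
    open IsMonoid isMonoid using (assoc; identityˡ; identityʳ)
    private
      algebraicLattice : Algebraic.Lattice c ℓ
      algebraicLattice = record { isLattice = isLattice }

      module O = OrderTheoretic.Lattice (AlgebraicLattice.∨-∧-orderTheoreticLattice algebraicLattice)

    lattice : LatticeOrder c ℓ
    lattice = record
      { Carrier = Carrier ; _≤_ = _≤_ ; _∧_ = _∧_ ; _∨_ = _∨_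
      ; ≤-refl = O.refl ; ≤-trans = O.trans
      ; x∧y≤x = O.x∧y≤x _ _ ; x∧y≤y = O.x∧y≤y _ _ ; ∧-greatest = O.∧-greatest
      ; x≤x∨y = O.x≤x∨y _ _ ; y≤x∨y = O.y≤x∨y _ _ ; ∨-least = O.∨-least
      }
    open LatticeOrder lattice public hiding (Carrier; _≤_; _∧_; _∨_)

    ≈⇒≤ : ∀ {x y} → x ≈ y → x ≤ y
    ≈⇒≤ = O.reflexive

    ≤-antisym : ∀ {x y} → x ≤ y → y ≤ x → x ≈ y
    ≤-antisym = O.antisym

    ∙-monoʳ : ∀ {x y z} → y ≤ z → x ∙ y ≤ x ∙ z
    ∙-monoʳ {x} {y} {z} p =
      to (\\-residual x y (x ∙ z)) (p ⊙ from (\\-residual x z (x ∙ z)) ≤-refl)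

    ∙-monoˡ : ∀ {x y z} → y ≤ z → y ∙ x ≤ z ∙ x
    ∙-monoˡ {x} {y} {z} p =
      from (//-residual y x (z ∙ x)) (p ⊙ to (//-residual z x (z ∙ x)) ≤-refl)

    assocʳ : ∀ {x y z} → (x ∙ y) ∙ z ≤ x ∙ (y ∙ z)
    assocʳ = ≈⇒≤ (assoc _ _ _)

    assocˡ : ∀ {x y z} → x ∙ (y ∙ z) ≤ (x ∙ y) ∙ z
    assocˡ = ≈⇒≤ (sym (assoc _ _ _))

    x≤xε : ∀ {x} → x ≤ x ∙ ε
    x≤xε = ≈⇒≤ (sym (identityʳ _))

    xε≤x : ∀ {x} → x ∙ ε ≤ x
    xε≤x = ≈⇒≤ (identityʳ _)

    x≤εx : ∀ {x} → x ≤ ε ∙ x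
    x≤εx = ≈⇒≤ (sym (identityˡ _))

    εx≤x : ∀ {x} → ε ∙ x ≤ x
    εx≤x = ≈⇒≤ (identityˡ _)

    ∙ε≤ : ∀ {x y} → y ≤ ε → x ∙ y ≤ x
    ∙ε≤ p = ∙-monoʳ p ⊙ xε≤x

    ε∙≤ : ∀ {x y} → y ≤ ε → y ∙ x ≤ x
    ε∙≤ p = ∙-monoˡ p ⊙ εx≤x

    ≤∙ε : ∀ {x y} → ε ≤ y → x ≤ x ∙ y
    ≤∙ε p = x≤xε ⊙ ∙-monoʳ p

    ≤ε∙ : ∀ {x y} → ε ≤ y → x ≤ y ∙ x
    ≤ε∙ p = x≤εx ⊙ ∙-monoˡ p

    module Idempotent (idem : IsIdempotent 𝐗) where

      ∧≤∙ : ∀ {x y} → x ∧ y ≤ x ∙ y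
      ∧≤∙ = ≈⇒≤ (sym (idem _)) ⊙ ∙-monoˡ x∧y≤x ⊙ ∙-monoʳ x∧y≤y

      ∙≤∨ : ∀ {x y} → x ∙ y ≤ x ∨ y
      ∙≤∨ = ∙-monoˡ x≤x∨y ⊙ ∙-monoʳ y≤x∨y ⊙ ≈⇒≤ (idem _)

      -- By idempotence `x ∙ y` is `x ∙ (x ∙ y)`, whose second factor is below ε. This lemma and the
      -- three like it turn each product into a meet or a join, according to its side of ε.
      ∙≤ε⇒∙≤ˡ : ∀ {x y} → x ∙ y ≤ ε → x ∙ y ≤ x
      ∙≤ε⇒∙≤ˡ p = ∙-monoˡ (≈⇒≤ (sym (idem _))) ⊙ assocʳ ⊙ ∙ε≤ p

      ∙≤ε⇒∙≤ʳ : ∀ {x y} → x ∙ y ≤ ε → x ∙ y ≤ y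
      ∙≤ε⇒∙≤ʳ p = ∙-monoʳ (≈⇒≤ (sym (idem _))) ⊙ assocˡ ⊙ ε∙≤ p

      ε≤∙⇒ˡ≤∙ : ∀ {x y} → ε ≤ x ∙ y → x ≤ x ∙ y
      ε≤∙⇒ˡ≤∙ p = ≤∙ε p ⊙ assocˡ ⊙ ∙-monoˡ (≈⇒≤ (idem _))

      ε≤∙⇒ʳ≤∙ : ∀ {x y} → ε ≤ x ∙ y → y ≤ x ∙ y
      ε≤∙⇒ʳ≤∙ p = ≤ε∙ p ⊙ assocʳ ⊙ ∙-monoʳ (≈⇒≤ (idem _))

      -- If `z ≤ ε`, then `ε ≤ y`, and for x above ε one has `x ≤ y ∙ x ≤ y ∙ x ∙ z ≤ y ∙ z ≤ y`. If
      -- `ε ≤ z`, then `x ≤ ε`, and for y below ε one has `x ≤ x ∙ y ∙ z ≤ x ∙ y ≤ y`.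
      separates : IsConic 𝐗 → ∀ {x y z} → x ∙ z ≤ ε → ε ≤ y ∙ z → x ≤ y
      separates conic {x} {y} {z} p q with conic z
      ... | inj₁ z≤ε with conic x
      ...   | inj₁ x≤ε = x≤ε ⊙ q ⊙ ∙ε≤ z≤ε
      ...   | inj₂ ε≤x =
        ≤ε∙ (q ⊙ ∙ε≤ z≤ε) ⊙ ε≤∙⇒ˡ≤∙ (q ⊙ ∙-monoˡ (≤∙ε ε≤x)) ⊙ assocʳ ⊙ ∙-monoʳ (∙≤ε⇒∙≤ʳ p) ⊙ ∙ε≤ z≤ε
      separates conic {x} {y} {z} p q | inj₂ ε≤z with conic y
      ...   | inj₂ ε≤y = ≤∙ε ε≤z ⊙ p ⊙ ε≤y
      ...   | inj₁ y≤ε =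
        ≤∙ε q ⊙ assocˡ ⊙ ∙≤ε⇒∙≤ˡ (∙-monoˡ (∙ε≤ y≤ε) ⊙ p) ⊙ ε∙≤ (≤∙ε ε≤z ⊙ p)

  opposite : ∀ {c ℓ} → ResiduatedLattice c ℓ → ResiduatedLattice c ℓ
  opposite 𝐗 = record
    { _∧_ = _∧_ ; _∨_ = _∨_ ; _∙_ = flip _∙_ ; _\\_ = flip _//_ ; _//_ = flip _\\_ ; ε = ε
    ; isLattice = isLattice ; isMonoid = Flip.isMonoid isMonoid
    ; \\-cong = flip //-cong ; //-cong = flip \\-cong
    ; \\-residual = λ x y z → ⇔.sym (//-residual y x z)
    ; //-residual = λ x y z → ⇔.sym (\\-residual y x z)
    }
    where open ResiduatedLattice 𝐗

  module _ {c ℓ} (𝐗 : ResiduatedLattice c ℓ) (𝐗∈ : IsRigidConjunctiveConicIdempotent 𝐗) where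
    open ResiduatedLattice 𝐗
    open IsLattice isLattice using (sym)
    open IsRigidConjunctiveConicIdempotent 𝐗∈
    open OfResiduatedLattice 𝐗
    open Idempotent idempotent
    private
      R⇒≤ʳ : ∀ {x y} → x ∙ y ≤ ε → y ≤ x ʳ
      R⇒≤ʳ = from (\\-residual _ _ _)

      ≤ʳ⇒R : ∀ {x y} → y ≤ x ʳ → x ∙ y ≤ ε
      ≤ʳ⇒R = to (\\-residual _ _ _)

      R⇒≤ˡ : ∀ {x y} → x ∙ y ≤ ε → x ≤ y ˡ
      R⇒≤ˡ = to (//-residual _ _ _)

      ≤ˡ⇒R : ∀ {x y} → x ≤ y ˡ → x ∙ y ≤ ε
      ≤ˡ⇒R = from (//-residual _ _ _)

      ¬R⇒ : ∀ {x y} → ¬ x ∙ y ≤ ε → ε ≤ x ∙ y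
      ¬R⇒ {x} {y} p with conic (x ∙ y)
      ... | inj₁ q = ⊥-elim (p q)
      ... | inj₂ q = q

      ⋆-anti : ∀ {x y} → x ≤ y → y ⋆ ≤ x ⋆
      ⋆-anti p = ∧-greatest (R⇒≤ˡ (∙-monoʳ p ⊙ ≤ˡ⇒R x∧y≤x)) (R⇒≤ʳ (∙-monoˡ p ⊙ ≤ʳ⇒R x∧y≤y))

      -- `(x ˡ) ʳ` and `(x ʳ) ˡ` lie above x and are closed by rigidity. With the converse below, γ
      -- is `⋆ ⋆`, so conjunctivity becomes the frame axiom `⋆⋆-∧`.
      ⋆⋆≤γ : ∀ {x} → x ⋆ ⋆ ≤ γ x
      ⋆⋆≤γ = ∧-greatest
        (⋆-anti (⋆-anti (R⇒≤ʳ (≤ˡ⇒R ≤-refl))) ⊙ ≈⇒≤ (sym (proj₁ rigid _)))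
        (⋆-anti (⋆-anti (R⇒≤ˡ (≤ʳ⇒R ≤-refl))) ⊙ ≈⇒≤ (sym (proj₂ rigid _)))

      γ≤⋆⋆ : ∀ {x} → γ x ≤ x ⋆ ⋆
      γ≤⋆⋆ = ∧-greatest (R⇒≤ˡ (∙-monoʳ x∧y≤y ⊙ ≤ˡ⇒R x∧y≤y)) (R⇒≤ʳ (∙-monoˡ x∧y≤x ⊙ ≤ʳ⇒R x∧y≤x))

    toFrame : Frame c ℓ
    toFrame = record
      { lattice = lattice ; ε = ε ; _R_ = λ x y → x ∙ y ≤ ε ; _ʳ = _ʳ ; _ˡ = _ˡ ; _⋆ = _⋆
      -- Below ε products are meets, so the truncations by ε yield the greatest z below ε with
      -- `x ∧ z ≤ y`.
      ; _⇒_ = λ x y → ((x ∧ ε) \\ y) ∧ ε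
      ; conic = conic
      ; R⇒≤ʳ = R⇒≤ʳ ; ≤ʳ⇒R = ≤ʳ⇒R ; R⇒≤ˡ = R⇒≤ˡ ; ≤ˡ⇒R = ≤ˡ⇒R
      ; R⇒≤⋆ = λ p q → ∧-greatest (R⇒≤ˡ q) (R⇒≤ʳ p)
      ; ≤⋆⇒R = λ p → ≤ʳ⇒R (p ⊙ x∧y≤y) ; ≤⋆⇒R˘ = λ p → ≤ˡ⇒R (p ⊙ x∧y≤x)
      ; ≤ε⇒Rε = xε≤x ⊙_ ; Rε⇒≤ε = x≤xε ⊙_ ; ≤ε⇒εR = εx≤x ⊙_ ; εR⇒≤ε = x≤εx ⊙_
      ; R-separates = λ p q → separates conic p (¬R⇒ q)
      ; R˘-separates = λ p q → OfResiduatedLattice.Idempotent.separates (opposite 𝐗) idempotent conic p (¬R⇒ q)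
      -- `x ≤ x ∙ (y ∙ z) = (x ∙ y) ∙ z ≤ z`, because `ε ≤ y ∙ z` and `x ∙ y ≤ ε`; the next axiom is
      -- dual.
      ; R-¬R⇒≤ = λ p q → ≤∙ε (¬R⇒ q) ⊙ assocˡ ⊙ ε∙≤ p
      ; ¬R-R⇒≥ = λ p q → ≤ε∙ (¬R⇒ p) ⊙ assocʳ ⊙ ∙ε≤ q
      ; ʳ-closed = ≈⇒≤ (sym (proj₁ rigid _)) ; ˡ-closed = ≈⇒≤ (sym (proj₂ rigid _))
      ; ⋆⋆-∧ = ∧-mono ⋆⋆≤γ ⋆⋆≤γ ⊙ ≈⇒≤ (sym (conjunctive _ _)) ⊙ γ≤⋆⋆
      ; ⇒-≤ε = x∧y≤y
      ; ⇒-intro = λ p q → ∧-greatest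
          (from (\\-residual _ _ _) (∧-greatest (∙ε≤ p ⊙ x∧y≤x) (ε∙≤ x∧y≤y) ⊙ q)) p
      ; ⇒-elim = ∧-greatest (∧-mono ≤-refl x∧y≤y) (x∧y≤y ⊙ x∧y≤x) ⊙ ∧≤∙ ⊙ to (\\-residual _ _ _) ≤-refl
      }

  -- Lattices indexed by a chain

  -- As the index takes values in a chain, the two disjunctions together with `index-mono` say that
  -- meets go to minima and joins to maxima. By `≺⇒≤` the fibres are stacked: only elements within
  -- one fibre can be incomparable.
  record Indexing {t q r a o} (K : Chain t q) (Trivial : Pred (Chain.Carrier K) r)
                  (𝐋 : LatticeOrder a o) : Set (t ⊔ q ⊔ r ⊔ a ⊔ o) where
    open Chain K using (_≼_; _≺_; _∼_)
    open LatticeOrder 𝐋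
    field
      index : Carrier → Chain.Carrier K
      index-mono : ∀ {x y} → x ≤ y → index x ≼ index y
      ≺⇒≤ : ∀ {x y} → index x ≺ index y → x ≤ y
      index-∧ : ∀ x y → index x ≼ index (x ∧ y) ⊎ index y ≼ index (x ∧ y)
      index-∨ : ∀ x y → index (x ∨ y) ≼ index x ⊎ index (x ∨ y) ≼ index y
      trivial : ∀ {x y} → Trivial (index x) → index x ∼ index y → x ≤ y

  record IndexedLattice {t q r} (K : Chain t q) (Trivial : Pred (Chain.Carrier K) r) a o :
                        Set (t ⊔ q ⊔ r ⊔ suc (a ⊔ o)) where
    field
      lattice : LatticeOrder a o
      indexing : Indexing K Trivial lattice
    open LatticeOrder lattice public
    open Indexing indexing public

  -- ⊢ generates a closure system on Z in which every L t is closed.  An element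
  -- of the stack over t is a closed set between the L s, s ≺ t, and L t; it
  -- has to be L t itself when t is to carry a one-element fibre.
  module Stack {t a o r} (K : Chain t (a ⊔ o)) {Trivial : Pred (Chain.Carrier K) r}
               (Trivial-resp : ∀ {s t} → Chain._∼_ K s t → Trivial s → Trivial t)
               {Z : Set a} (_,_⊢_ : Z → Z → Z → Set (a ⊔ o)) (L : Chain.Carrier K → Pred Z (a ⊔ o))
               (L-mono : ∀ z {s t} → Chain._≼_ K s t → L s z → L t z)
               (L-closed : ∀ {t z₁ z₂ z} → z₁ , z₂ ⊢ z → L t z₁ → L t z₂ → L t z) where
    open Chain K

    Closed : Pred Z (a ⊔ o) → Set (a ⊔ o)
    Closed U = ∀ {z₁ z₂ z} → z₁ , z₂ ⊢ z → U z₁ → U z₂ → U z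

    data Closure (U : Pred Z (a ⊔ o)) : Pred Z (a ⊔ o) where
      base : ∀ {z} → U z → Closure U z
      step : ∀ {z₁ z₂ z} → z₁ , z₂ ⊢ z → Closure U z₁ → Closure U z₂ → Closure U z

    Closure-least : ∀ {U V : Pred Z (a ⊔ o)} → Closed V → (∀ {z} → U z → V z) → ∀ {z} → Closure U z → V z
    Closure-least c f (base u) = f u
    Closure-least c f (step s u v) = c s (Closure-least c f u) (Closure-least c f v)

    record Element : Set (t ⊔ suc (a ⊔ o) ⊔ r) where
      field
        index : Carrier
        member : Pred Z (a ⊔ o)
        closed : Closed member
        lower : ∀ {s z} → s ≺ index → L s z → member z
        upper : ∀ {z} → member z → L index z
        full : Trivial index → ∀ {z} → L index z → member z
    open Element public

    infix 4 _≤_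
    record _≤_ (x y : Element) : Set (a ⊔ o) where
      constructor _,_
      field
        index≼ : index x ≼ index y
        member⊆ : ∀ {z} → member x z → member y z
    open _≤_ public

    ≤-refl : ∀ {x} → x ≤ x
    ≤-refl = ≼-refl , id

    ≤-trans : ∀ {x y z} → x ≤ y → y ≤ z → x ≤ z
    ≤-trans (p , f) (q , g) = p ⊙ q , λ u → g (f u)

    ≺⇒≤ : ∀ {x y} → index x ≺ index y → x ≤ y
    ≺⇒≤ {x} {y} p = ≺⇒≼ p , λ u → lower y p (upper x u)

    min max : Op₂ Carrier
    min s t = [ (λ _ → s) , (λ _ → t) ]′ (≼-total s t)
    max s t = [ (λ _ → t) , (λ _ → s) ]′ (≼-total s t)

    min-sel : ∀ s t {P : Pred Carrier (a ⊔ o)} → P s → P t → P (min s t)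
    min-sel s t p q with ≼-total s t
    ... | inj₁ _ = p
    ... | inj₂ _ = q

    max-sel : ∀ s t {ℓ} {P : Pred Carrier ℓ} → P s → P t → P (max s t)
    max-sel s t p q with ≼-total s t
    ... | inj₁ _ = q
    ... | inj₂ _ = p

    min≼ : ∀ s t → min s t ≼ s × min s t ≼ t
    min≼ s t with ≼-total s t
    ... | inj₁ p = ≼-refl , p
    ... | inj₂ p = p , ≼-refl

    ≼max : ∀ s t → s ≼ max s t × t ≼ max s t
    ≼max s t with ≼-total s t
    ... | inj₁ p = p , ≼-refl
    ... | inj₂ p = ≼-refl , p

    full-below : ∀ {s} x → s ≼ index x → Trivial s → ∀ {z} → L s z → member x z
    full-below {s} x p τ l with em {P = index x ≼ s}
    ... | yes q = full x (Trivial-resp (p , q) τ) (L-mono _ p l)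
    ... | no q = lower x q l

    _∧_ _∨_ : Op₂ Element
    x ∧ y = record
      { index = min (index x) (index y)
      ; member = λ z → member x z × member y z
      ; closed = λ s (a , a′) (b , b′) → closed x s a b , closed y s a′ b′
      ; lower = λ p l → lower x (≺-≼-trans p m≼x) l , lower y (≺-≼-trans p m≼y) l
      ; upper = λ {z} (a , b) →
          min-sel (index x) (index y) {λ t → L t z} (upper x a) (upper y b)
      ; full = λ τ l → full-below x m≼x τ l , full-below y m≼y τ l
      }
      where
      m≼x = proj₁ (min≼ (index x) (index y))
      m≼y = proj₂ (min≼ (index x) (index y))
    x ∨ y = record
      { index = max (index x) (index y)
      ; member = Closure (λ z → member x z ⊎ member y z)
      ; closed = step
      ; lower = λ {s} {z} → max-sel (index x) (index y)
          {P = λ t → s ≺ t → L s z → Closure (λ z → member x z ⊎ member y z) z}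
          (λ p l → base (inj₁ (lower x p l))) (λ p l → base (inj₂ (lower y p l)))
      ; upper = Closure-least L-closed
          [ (λ u → L-mono _ (proj₁ (≼max (index x) (index y))) (upper x u))
          , (λ u → L-mono _ (proj₂ (≼max (index x) (index y))) (upper y u)) ]′
      ; full = max-sel (index x) (index y)
          {P = λ t → Trivial t → ∀ {z} → L t z → Closure (λ z → member x z ⊎ member y z) z}
          (λ τ l → base (inj₁ (full x τ l))) (λ τ l → base (inj₂ (full y τ l)))
      }

    top : Carrier → Element
    top t = record
      { index = t ; member = L t ; closed = L-closed
      ; lower = λ p l → L-mono _ (≺⇒≼ p) l ; upper = id ; full = λ _ → id }

    ≤top : ∀ {x t} → index x ≼ t → x ≤ top t
    ≤top {x} p = p , λ u → L-mono _ p (upper x u)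

    indexedLattice : IndexedLattice K Trivial (t ⊔ suc (a ⊔ o) ⊔ r) (a ⊔ o)
    indexedLattice = record
      { lattice = record
        { Carrier = Element ; _≤_ = _≤_ ; _∧_ = _∧_ ; _∨_ = _∨_
        ; ≤-refl = ≤-refl ; ≤-trans = ≤-trans
        ; x∧y≤x = λ {x} {y} → proj₁ (min≼ (index x) (index y)) , proj₁
        ; x∧y≤y = λ {x} {y} → proj₂ (min≼ (index x) (index y)) , proj₂
        ; ∧-greatest = λ {x} {y} {z} (p , f) (q , g) →
            min-sel (index x) (index y) {index z ≼_} p q , λ u → f u , g u
        ; x≤x∨y = λ {x} {y} → proj₁ (≼max (index x) (index y)) , λ u → base (inj₁ u)
        ; y≤x∨y = λ {x} {y} → proj₂ (≼max (index x) (index y)) , λ u → base (inj₂ u)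
        ; ∨-least = λ {x} {y} {z} (p , f) (q , g) →
            max-sel (index x) (index y) {P = _≼ index z} p q , Closure-least (closed z) [ f , g ]′
        }
      ; indexing = record
        { index = index
        ; index-mono = index≼
        ; ≺⇒≤ = ≺⇒≤
        ; index-∧ = λ x y → min-sel (index x) (index y)
            {λ m → index x ≼ m ⊎ index y ≼ m} (inj₁ ≼-refl) (inj₂ ≼-refl)
        ; index-∨ = λ x y → max-sel (index x) (index y)
            {P = λ m → m ≼ index x ⊎ m ≼ index y} (inj₁ ≼-refl) (inj₂ ≼-refl)
        ; trivial = λ {x} {y} τ (p , q) → p , λ u →
            full y (Trivial-resp (p , q) τ) (L-mono _ p (upper x u))
        }
      }

    module Implication (_⊓_ : Op₂ Z)
      (⊓-⊢ : ∀ {z₁ z₂ z} w → z₁ , z₂ ⊢ z → (z₁ ⊓ w) , (z₂ ⊓ w) ⊢ (z ⊓ w))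
      (⊢⊓ˡ : ∀ {z w} → z , z ⊢ (z ⊓ w)) (⊢⊓ʳ : ∀ {z w} → w , w ⊢ (z ⊓ w))
      (⊓-⊢-idem : ∀ {z} → (z ⊓ z) , (z ⊓ z) ⊢ z) where

      -- For x ≤ y the relative pseudocomplement is the greatest element instead.
      _⊃_ : Op₂ Element
      x ⊃ y = record
        { index = index y
        ; member = λ z → (∀ w → member x w → member y (z ⊓ w)) × L (index y) z
        ; closed = λ s (f , l) (g , m) →
            (λ w u → closed y (⊓-⊢ w s) (f w u) (g w u)) , L-closed s l m
        ; lower = λ p l → (λ w u → let v = lower y p l in closed y ⊢⊓ˡ v v) , L-mono _ (≺⇒≼ p) l
        ; upper = proj₂
        ; full = λ τ l → (λ w u → let v = full y τ l in closed y ⊢⊓ˡ v v) , l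
        }

      -- The point is that z has at most the class of y. Otherwise, if x has at most the class of y,
      -- then x is below z, so `x ∧ z` is x and `x ≤ y`; and if x also has a class above that of y,
      -- then so has `x ∧ z`.
      ⊃-intro : ∀ {x y z} → ¬ x ≤ y → x ∧ z ≤ y → z ≤ x ⊃ y
      ⊃-intro {x} {y} {z} x≰y xz≤y@(p , f) = z≼y , λ u →
          (λ w v → f (closed x ⊢⊓ʳ v v , closed z ⊢⊓ˡ u u)) , L-mono _ z≼y (upper z u)
        where
        z≼y : index z ≼ index y
        z≼y with em {P = index z ≼ index y}
        ... | yes q = q
        ... | no q with em {P = index x ≼ index y}
        ...   | yes q′ = ⊥-elim (x≰y (≤-trans {y = x ∧ z}
                (min-sel (index x) (index z) {index x ≼_} ≼-refl (≺⇒≼ x≺z) ,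
                 λ u → u , member⊆ (≺⇒≤ {x} {z} x≺z) u) xz≤y))
          where x≺z = ≼-≺-trans q′ q
        ...   | no q′ = ⊥-elim (min-sel (index x) (index z) {λ m → ¬ m ≼ index y} q′ q p)

      ⊃-elim : ∀ {x y} → x ∧ (x ⊃ y) ≤ y
      ⊃-elim {x} {y} = proj₂ (min≼ (index x) (index y)) ,
        λ (u , f , _) → let v = f _ u in closed y ⊓-⊢-idem v v

  -- Ordinal sums of a negative and a positive part

  module _ {t p} (K : Chain t p) where
    open Chain K

    -- The order is reversed because larger elements above ε have smaller classes. ⊤ itself is left
    -- out, its positive fibre being empty.
    below : Carrier → Chain (t ⊔ p) p
    below ⊤ = record
      { Carrier = Σ[ s ∈ Carrier ] s ≺ ⊤
      ; _≼_ = λ x y → proj₁ y ≼ proj₁ x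
      ; ≼-refl = ≼-refl
      ; ≼-trans = flip ≼-trans
      ; ≼-total = λ x y → ≼-total (proj₁ y) (proj₁ x)
      }

    Q-mono : ∀ {ℓ} (M : Labels K ℓ) {x y x′ y′} → x′ ≼ x → y ≼ y′ → Labels.Q M x y → Labels.Q M x′ y′
    Q-mono M p q (inj₁ r) = inj₁ (p ⊙ r ⊙ q)
    Q-mono M {x} {x′ = x′} p q (inj₂ (l , f)) with em {P = x ≼ x′}
    ... | yes p′ = inj₂ (Labels.Lab-resp M (p′ , p) l , λ z r → f z (≺-≼-trans r p) ⊙ q)
    ... | no p′ = inj₁ (f x′ p′ ⊙ q)

  -- `labels₁` governs R from the negative to the positive part and `labels₂` the opposite
  -- direction. A class labelled in either way has a trivial negative fibre, and its predecessor a
  -- trivial positive one. The elements `topᴺ` and `topᴾ` are the future values of the residuals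
  -- into ε.
  record SumData a t p : Set (suc (a ⊔ t ⊔ p)) where
    field
      K : Chain t p
    open Chain K public using (_≼_; _≺_; _∼_)
    field
      ⊤ : Chain.Carrier K
      ≼⊤ : ∀ {s} → s ≼ ⊤
      labels₁ labels₂ : Labels K p
    open Labels labels₁ public using () renaming (Lab to Lab₁; Q to Q₁; IsPred to IsPred₁)
    open Labels labels₂ public using () renaming (Lab to Lab₂; Q to Q₂; IsPred to IsPred₂)
    field
      exclusive-labels : ∀ {s} → Lab₁ s → ¬ Lab₂ s
      ⊤-unlabelled₁ : ∀ {s} → ⊤ ≼ s → ¬ Lab₁ s
      ⊤-unlabelled₂ : ∀ {s} → ⊤ ≼ s → ¬ Lab₂ s
      N : IndexedLattice K (λ s → Lab₁ s ⊎ Lab₂ s) (a ⊔ t) p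
      P : IndexedLattice (below K ⊤) (λ s → ∃ (IsPred₁ (proj₁ s)) ⊎ ∃ (IsPred₂ (proj₁ s))) (a ⊔ t) p
    module N = IndexedLattice N
    module P = IndexedLattice P
    indexᴾ : P.Carrier → Chain.Carrier K
    indexᴾ y = proj₁ (P.index y)
    field
      topᴺ : Chain.Carrier K → N.Carrier
      index-topᴺ : ∀ s → N.index (topᴺ s) ∼ s
      ≤topᴺ : ∀ {x s} → N.index x ≼ s → x N.≤ topᴺ s
      topᴾ : ∀ s → s ≺ ⊤ → P.Carrier
      index-topᴾ : ∀ s s≺⊤ → indexᴾ (topᴾ s s≺⊤) ∼ s
      ≤topᴾ : ∀ {x s s≺⊤} → s ≼ indexᴾ x → x P.≤ topᴾ s s≺⊤
      _⊃_ : Op₂ N.Carrier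
      ⊃-intro : ∀ {x y z} → ¬ x N.≤ y → x N.∧ z N.≤ y → z N.≤ x ⊃ y
      ⊃-elim : ∀ {x y} → x N.∧ (x ⊃ y) N.≤ y

  mirrorSum : ∀ {a t p} → SumData a t p → SumData a t p
  mirrorSum S = record
    { K = K ; ⊤ = ⊤ ; ≼⊤ = ≼⊤ ; labels₁ = labels₂ ; labels₂ = labels₁
    ; exclusive-labels = λ l l′ → exclusive-labels l′ l
    ; ⊤-unlabelled₁ = ⊤-unlabelled₂ ; ⊤-unlabelled₂ = ⊤-unlabelled₁
    ; N = record { lattice = N.lattice ; indexing = record
      { index = N.index ; index-mono = N.index-mono ; ≺⇒≤ = N.≺⇒≤
      ; index-∧ = N.index-∧ ; index-∨ = N.index-∨ ; trivial = λ l → N.trivial (Sum.swap l) } }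
    ; P = record { lattice = P.lattice ; indexing = record
      { index = P.index ; index-mono = P.index-mono ; ≺⇒≤ = P.≺⇒≤
      ; index-∧ = P.index-∧ ; index-∨ = P.index-∨ ; trivial = λ l → P.trivial (Sum.swap l) } }
    ; topᴺ = topᴺ ; index-topᴺ = index-topᴺ ; ≤topᴺ = ≤topᴺ
    ; topᴾ = topᴾ ; index-topᴾ = index-topᴾ ; ≤topᴾ = ≤topᴾ
    ; _⊃_ = _⊃_ ; ⊃-intro = ⊃-intro ; ⊃-elim = ⊃-elim
    }
    where open SumData S

  module OrdinalSum {a p} (𝐍 𝐏 : LatticeOrder a p) where
    private
      module N = LatticeOrder 𝐍
      module P = LatticeOrder 𝐏

    D : Set a
    D = N.Carrier ⊎ P.Carrier

    infix 4 _≤_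
    data _≤_ : Rel D (a ⊔ p) where
      nn : ∀ {x y} → x N.≤ y → inj₁ x ≤ inj₁ y
      np : ∀ {x y} → inj₁ x ≤ inj₂ y
      pp : ∀ {x y} → x P.≤ y → inj₂ x ≤ inj₂ y

    ≤-refl : ∀ {x} → x ≤ x
    ≤-refl {inj₁ x} = nn N.≤-refl
    ≤-refl {inj₂ x} = pp P.≤-refl

    ≤-trans : ∀ {x y z} → x ≤ y → y ≤ z → x ≤ z
    ≤-trans (nn p) (nn q) = nn (N.≤-trans p q)
    ≤-trans (nn p) np = np
    ≤-trans np (pp q) = np
    ≤-trans (pp p) (pp q) = pp (P.≤-trans p q)

    infixr 7 _∧_
    infixr 6 _∨_
    _∧_ _∨_ : Op₂ D
    inj₁ x ∧ inj₁ y = inj₁ (x N.∧ y)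
    inj₁ x ∧ inj₂ y = inj₁ x
    inj₂ x ∧ inj₁ y = inj₁ y
    inj₂ x ∧ inj₂ y = inj₂ (x P.∧ y)
    inj₁ x ∨ inj₁ y = inj₁ (x N.∨ y)
    inj₁ x ∨ inj₂ y = inj₂ y
    inj₂ x ∨ inj₁ y = inj₂ x
    inj₂ x ∨ inj₂ y = inj₂ (x P.∨ y)

    x∧y≤x : ∀ x y → x ∧ y ≤ x
    x∧y≤x (inj₁ x) (inj₁ y) = nn N.x∧y≤x
    x∧y≤x (inj₁ x) (inj₂ y) = ≤-refl
    x∧y≤x (inj₂ x) (inj₁ y) = np
    x∧y≤x (inj₂ x) (inj₂ y) = pp P.x∧y≤x

    x∧y≤y : ∀ x y → x ∧ y ≤ y
    x∧y≤y (inj₁ x) (inj₁ y) = nn N.x∧y≤y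
    x∧y≤y (inj₁ x) (inj₂ y) = np
    x∧y≤y (inj₂ x) (inj₁ y) = ≤-refl
    x∧y≤y (inj₂ x) (inj₂ y) = pp P.x∧y≤y

    ∧-greatest : ∀ {x y z} → z ≤ x → z ≤ y → z ≤ x ∧ y
    ∧-greatest (nn p) (nn q) = nn (N.∧-greatest p q)
    ∧-greatest (nn p) np = nn p
    ∧-greatest np (nn q) = nn q
    ∧-greatest np np = np
    ∧-greatest (pp p) (pp q) = pp (P.∧-greatest p q)

    x≤x∨y : ∀ x y → x ≤ x ∨ y
    x≤x∨y (inj₁ x) (inj₁ y) = nn N.x≤x∨y
    x≤x∨y (inj₁ x) (inj₂ y) = np
    x≤x∨y (inj₂ x) (inj₁ y) = ≤-refl
    x≤x∨y (inj₂ x) (inj₂ y) = pp P.x≤x∨y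

    y≤x∨y : ∀ x y → y ≤ x ∨ y
    y≤x∨y (inj₁ x) (inj₁ y) = nn N.y≤x∨y
    y≤x∨y (inj₁ x) (inj₂ y) = ≤-refl
    y≤x∨y (inj₂ x) (inj₁ y) = np
    y≤x∨y (inj₂ x) (inj₂ y) = pp P.y≤x∨y

    ∨-least : ∀ {x y z} → x ≤ z → y ≤ z → x ∨ y ≤ z
    ∨-least (nn p) (nn q) = nn (N.∨-least p q)
    ∨-least np np = np
    ∨-least np (pp q) = pp q
    ∨-least (pp p) np = pp p
    ∨-least (pp p) (pp q) = pp (P.∨-least p q)

    lattice : LatticeOrder a (a ⊔ p)
    lattice = record
      { Carrier = D ; _≤_ = _≤_ ; _∧_ = _∧_ ; _∨_ = _∨_ ; ≤-refl = ≤-refl ; ≤-trans = ≤-trans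
      ; x∧y≤x = x∧y≤x _ _ ; x∧y≤y = x∧y≤y _ _ ; ∧-greatest = ∧-greatest
      ; x≤x∨y = x≤x∨y _ _ ; y≤x∨y = y≤x∨y _ _ ; ∨-least = ∨-least }

  module SumOrder {a t p} (S : SumData a t p) where
    open SumData S
    open OrdinalSum N.lattice P.lattice public

    ε : D
    ε = inj₁ (topᴺ ⊤)

    n≤ε : ∀ {x} → inj₁ x ≤ ε
    n≤ε = nn (≤topᴺ ≼⊤)

    -- The greatest element in the fibre of its argument. In the frame built below it coincides with
    -- `⋆ ⋆`, which turns `top-∧` into conjunctivity.
    top : Op₁ D
    top (inj₁ x) = inj₁ (topᴺ (N.index x))
    top (inj₂ y) = inj₂ (topᴾ (indexᴾ y) (proj₂ (P.index y)))

    top-∧ : ∀ x y → top x ∧ top y ≤ top (x ∧ y)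
    top-∧ (inj₁ x) (inj₁ y) = nn
      ([ (λ p → N.≤-trans N.x∧y≤x (≤topᴺ (≼-trans (proj₁ (index-topᴺ _)) p)))
       , (λ p → N.≤-trans N.x∧y≤y (≤topᴺ (≼-trans (proj₁ (index-topᴺ _)) p))) ]′ (N.index-∧ x y))
      where open Chain K using (≼-trans)
    top-∧ (inj₁ x) (inj₂ y) = ≤-refl
    top-∧ (inj₂ x) (inj₁ y) = ≤-refl
    top-∧ (inj₂ x) (inj₂ y) = pp
      ([ (λ p → P.≤-trans P.x∧y≤x (≤topᴾ (≼-trans p (proj₂ (index-topᴾ _ _)))))
       , (λ p → P.≤-trans P.x∧y≤y (≤topᴾ (≼-trans p (proj₂ (index-topᴾ _ _))))) ]′ (P.index-∧ x y))
      where open Chain K using (≼-trans)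

    infixr 6 _⇒_
    _⇒_ : Op₂ D
    inj₁ x ⇒ inj₁ y with em {P = x N.≤ y}
    ... | yes _ = ε
    ... | no _ = inj₁ (x ⊃ y)
    inj₁ x ⇒ inj₂ y = ε
    inj₂ x ⇒ inj₁ y = inj₁ y
    inj₂ x ⇒ inj₂ y = ε

    ⇒-≤ε : ∀ x y → x ⇒ y ≤ ε
    ⇒-≤ε (inj₁ x) (inj₁ y) with em {P = x N.≤ y}
    ... | yes _ = ≤-refl
    ... | no _ = n≤ε
    ⇒-≤ε (inj₁ x) (inj₂ y) = ≤-refl
    ⇒-≤ε (inj₂ x) (inj₁ y) = n≤ε
    ⇒-≤ε (inj₂ x) (inj₂ y) = ≤-refl

    ⇒-intro : ∀ x y {z} → z ≤ ε → x ∧ z ≤ y → z ≤ x ⇒ y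
    ⇒-intro (inj₁ x) (inj₁ y) (nn p) (nn q) with em {P = x N.≤ y}
    ... | yes _ = nn p
    ... | no ¬r = nn (⊃-intro ¬r q)
    ⇒-intro (inj₁ x) (inj₂ y) p q = p
    ⇒-intro (inj₂ x) (inj₁ y) (nn p) q = q
    ⇒-intro (inj₂ x) (inj₂ y) p q = p

    ⇒-elim : ∀ x y → x ∧ (x ⇒ y) ≤ y
    ⇒-elim (inj₁ x) (inj₁ y) with em {P = x N.≤ y}
    ... | yes r = nn (N.≤-trans N.x∧y≤x r)
    ... | no ¬r = nn ⊃-elim
    ⇒-elim (inj₁ x) (inj₂ y) = np
    ⇒-elim (inj₂ x) (inj₁ y) = ≤-refl
    ⇒-elim (inj₂ x) (inj₂ y) = np

  module SumSide {a t p} (S : SumData a t p) where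
    open SumData S
    open Chain K using (≼-refl; ≺⇒≼; ≺-≼-trans; ≼-≺-trans; _⊙_)
    open SumOrder S

    infix 4 _R_
    data _R_ : Rel D (a ⊔ t ⊔ p) where
      nn : ∀ {x y} → inj₁ x R inj₁ y
      np : ∀ {x y} → Q₁ (N.index x) (indexᴾ y) → inj₁ x R inj₂ y
      pn : ∀ {x y} → Q₂ (N.index y) (indexᴾ x) → inj₂ x R inj₁ y

    R-monoʳ : ∀ {x y y′} → y′ ≤ y → x R y → x R y′
    R-monoʳ (nn q) nn = nn
    R-monoʳ np (np r) = nn
    R-monoʳ (pp q) (np r) = np (Q-mono K labels₁ ≼-refl (P.index-mono q) r)
    R-monoʳ (nn q) (pn r) = pn (Q-mono K labels₂ (N.index-mono q) ≼-refl r)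

    R-topʳ : ∀ {x y} → x R y → x R top y
    R-topʳ nn = nn
    R-topʳ (np r) = np (Q-mono K labels₁ ≼-refl (proj₂ (index-topᴾ _ _)) r)
    R-topʳ (pn r) = pn (Q-mono K labels₂ (proj₁ (index-topᴺ _)) ≼-refl r)

    R-topˡ : ∀ {x y} → x R y → top x R y
    R-topˡ nn = nn
    R-topˡ (np r) = np (Q-mono K labels₁ (proj₁ (index-topᴺ _)) ≼-refl r)
    R-topˡ (pn r) = pn (Q-mono K labels₂ ≼-refl (proj₂ (index-topᴾ _ _)) r)

    separates : ∀ {x y z} → x R z → ¬ y R z → x ≤ y
    separates {y = inj₁ y} nn ¬r = ⊥-elim (¬r nn)
    separates {y = inj₁ y} (np r) ¬r = nn (N.≺⇒≤ λ q → ¬r (np (Q-mono K labels₁ q ≼-refl r)))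
    separates {y = inj₁ y} (pn r) ¬r = ⊥-elim (¬r nn)
    separates {y = inj₂ y} nn ¬r = np
    separates {y = inj₂ y} (np r) ¬r = np
    separates {y = inj₂ y} (pn r) ¬r = pp (P.≺⇒≤ λ q → ¬r (pn (Q-mono K labels₂ ≼-refl q r)))

    -- Only the cases in which the signs of x, y, z alternate need an argument. If the classes do
    -- not already order x and z, then `x R y` can hold only through a label, and the failure of
    -- `y R z` forces x and z into the same class. The label makes that fibre trivial.
    R-¬R⇒≤ : ∀ {x y z} → x R y → ¬ y R z → x ≤ z
    R-¬R⇒≤ {z = inj₁ z} nn ¬r = ⊥-elim (¬r nn)
    R-¬R⇒≤ {z = inj₁ z} (pn r) ¬r = ⊥-elim (¬r nn)
    R-¬R⇒≤ {z = inj₂ z} nn ¬r = np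
    R-¬R⇒≤ {z = inj₂ z} (np r) ¬r = np
    R-¬R⇒≤ {inj₁ x} {inj₂ y} {inj₁ z} (np r) ¬r with em {P = N.index z ≼ N.index x}
    ... | no ¬q = nn (N.≺⇒≤ ¬q)
    ... | yes q with r
    ...   | inj₁ r′ = ⊥-elim (¬r (pn (inj₁ (q ⊙ r′))))
    ...   | inj₂ (l , f) with em {P = N.index x ≼ N.index z}
    ...     | no ¬q′ = ⊥-elim (¬r (pn (inj₁ (f _ ¬q′))))
    ...     | yes q′ = nn (N.trivial (inj₁ l) (q′ , q))
    R-¬R⇒≤ {inj₂ x} {inj₁ y} {inj₂ z} (pn r) ¬r with em {P = indexᴾ x ≼ indexᴾ z}
    ... | no ¬q = pp (P.≺⇒≤ ¬q)
    ... | yes q with r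
    ...   | inj₁ r′ = ⊥-elim (¬r (np (inj₁ (r′ ⊙ q))))
    ...   | inj₂ (l , f) = pp (P.trivial (inj₂ (_ , l , ≼-≺-trans q z≺y , f)) (f _ z≺y , q))
      where z≺y = λ q′ → ¬r (np (inj₁ q′))

    -- For fixed x the classes of opposite sign that are related to x have an extremal one: that of
    -- x, unless a label moves it to the predecessor (x negative) or to a labelled successor (x
    -- positive). The top of the fibre over the extremal class is the residual. The class ⊤ is
    -- related to no positive element and takes ε instead.
    greatest-R : ∀ x → Σ[ w ∈ D ] x R w × (∀ y → x R y → y ≤ w)
    greatest-R (inj₁ x) with em {P = ⊤ ≼ N.index x}
    ... | yes q = ε , nn , λ
      { (inj₁ y) _ → n≤ε
      ; (inj₂ y) (np (inj₁ r)) → ⊥-elim (proj₂ (P.index y) (q ⊙ r))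
      ; (inj₂ y) (np (inj₂ (l , _))) → ⊥-elim (⊤-unlabelled₁ q l) }
    ... | no ¬q with em {P = Lab₁ (N.index x)}
    ...   | yes l = inj₂ (topᴾ (pred (N.index x)) λ q → ¬q (q ⊙ ≺⇒≼ (pred≺ l))) ,
                    np (inj₂ (l , λ z r → ≺⇒≼pred l r ⊙ proj₂ (index-topᴾ _ _))) , λ
      { (inj₁ y) _ → np
      ; (inj₂ y) (np (inj₁ r)) → pp (≤topᴾ (≺⇒≼ (pred≺ l) ⊙ r))
      ; (inj₂ y) (np (inj₂ (_ , f))) → pp (≤topᴾ (f _ (pred≺ l))) }
      where open Labels labels₁
    ...   | no ¬l = inj₂ (topᴾ (N.index x) ¬q) , np (inj₁ (proj₂ (index-topᴾ _ _))) , λ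
      { (inj₁ y) _ → np
      ; (inj₂ y) (np (inj₁ r)) → pp (≤topᴾ r)
      ; (inj₂ y) (np (inj₂ (l , _))) → ⊥-elim (¬l l) }
    greatest-R (inj₂ x) with em {P = ∃ (IsPred₂ (indexᴾ x))}
    ... | yes (s , l , x≺s , f) = inj₁ (topᴺ s) ,
        pn (Q-mono K labels₂ (proj₁ (index-topᴺ s)) ≼-refl (inj₂ (l , f))) , λ
      { (inj₁ y) (pn (inj₁ r)) → nn (≤topᴺ (r ⊙ ≺⇒≼ x≺s))
      ; (inj₁ y) (pn (inj₂ (l , g))) → nn (≤topᴺ (y≼s y g)) }
      where
      y≼s : ∀ y → (∀ z → z ≺ N.index y → z ≼ indexᴾ x) → N.index y ≼ s
      y≼s y g with em {P = N.index y ≼ s}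
      ... | yes q = q
      ... | no ¬q = ⊥-elim (x≺s (g s ¬q))
    ... | no ¬s = inj₁ (topᴺ (indexᴾ x)) , pn (inj₁ (proj₁ (index-topᴺ _))) , λ
      { (inj₁ y) (pn (inj₁ r)) → nn (≤topᴺ r)
      ; (inj₁ y) (pn (inj₂ (l , g))) → nn (≤topᴺ (y≼x y l g)) }
      where
      y≼x : ∀ y → Lab₂ (N.index y) → (∀ z → z ≺ N.index y → z ≼ indexᴾ x) → N.index y ≼ indexᴾ x
      y≼x y l g with em {P = N.index y ≼ indexᴾ x}
      ... | yes q = q
      ... | no ¬q = ⊥-elim (¬s (_ , l , ¬q , g))

    infix 9 _ʳ
    _ʳ : Op₁ D
    x ʳ = proj₁ (greatest-R x)

    R⇒≤ʳ : ∀ {x y} → x R y → y ≤ x ʳ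
    R⇒≤ʳ = proj₂ (proj₂ (greatest-R _)) _

    ≤ʳ⇒R : ∀ {x y} → y ≤ x ʳ → x R y
    ≤ʳ⇒R q = R-monoʳ q (proj₁ (proj₂ (greatest-R _)))

    Q⇒≺⊤ : ∀ {s} y → ⊤ ≼ s → ¬ Q₂ s (indexᴾ y)
    Q⇒≺⊤ y q (inj₁ r) = proj₂ (P.index y) (q ⊙ r)
    Q⇒≺⊤ y q (inj₂ (l , _)) = ⊤-unlabelled₂ q l

    ≤ε⇒Rε : ∀ {x} → x ≤ ε → x R ε
    ≤ε⇒Rε (nn _) = nn

    Rε⇒≤ε : ∀ {x} → x R ε → x ≤ ε
    Rε⇒≤ε nn = n≤ε
    Rε⇒≤ε {inj₂ x} (pn r) = ⊥-elim (Q⇒≺⊤ x (proj₂ (index-topᴺ ⊤)) r)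

  module SumFrame {a t p} (S : SumData a t p) where
    open SumData S
    open Chain K using (_⊙_)
    open SumOrder S
    private
      module R = SumSide S
      module L = SumSide (mirrorSum S)
    open R using (_R_; _ʳ; nn; np; pn)
    open L using () renaming (_ʳ to _ˡ)
    open LatticeOrder lattice using () renaming (_⊙_ to _■_)

    R⇒L : ∀ {x y} → x R y → y L.R x
    R⇒L nn = L.nn
    R⇒L (np r) = L.pn r
    R⇒L (pn r) = L.np r

    L⇒R : ∀ {x y} → x L.R y → y R x
    L⇒R L.nn = nn
    L⇒R (L.np r) = pn r
    L⇒R (L.pn r) = np r

    infix 9 _⋆
    _⋆ : Op₁ D
    x ⋆ = x ˡ ∧ x ʳ

    R⇒≤⋆ : ∀ {x y} → x R y → y R x → y ≤ x ⋆
    R⇒≤⋆ r r′ = ∧-greatest (L.R⇒≤ʳ (R⇒L r′)) (R.R⇒≤ʳ r)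

    ≤⋆⇒R : ∀ {x y} → y ≤ x ⋆ → x R y
    ≤⋆⇒R q = R.≤ʳ⇒R (q ■ x∧y≤y _ _)

    ≤⋆⇒R˘ : ∀ {x y} → y ≤ x ⋆ → y R x
    ≤⋆⇒R˘ q = L⇒R (L.≤ʳ⇒R (q ■ x∧y≤x _ _))

    -- Exclusivity of the labels: between elements of opposite sign, R in both orders compares their
    -- classes and nothing else, so `⋆` does not see the labels.
    Q₁∩Q₂⇒≼ : ∀ {s s′} → Q₁ s s′ → Q₂ s s′ → s ≼ s′
    Q₁∩Q₂⇒≼ (inj₁ q) _ = q
    Q₁∩Q₂⇒≼ _ (inj₁ q) = q
    Q₁∩Q₂⇒≼ (inj₂ (l , _)) (inj₂ (l′ , _)) = ⊥-elim (exclusive-labels l l′)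

    top≤⋆⋆ : ∀ {x} → top x ≤ x ⋆ ⋆
    top≤⋆⋆ = R⇒≤⋆ (R.R-topʳ (≤⋆⇒R˘ ≤-refl)) (R.R-topˡ (≤⋆⇒R ≤-refl))

    private
      -- The test element y is the top of the same class on the other side of ε. It is related to x
      -- in both orders, hence also to z, and `Q₁∩Q₂⇒≼` then bounds z. For class ⊤ no test is
      -- required, and a positive z is excluded from above a negative x by testing with ε.
      below-top : ∀ x z → (∀ y → x R y → y R x → y R z × z R y) → z ≤ top x
      below-top (inj₁ x) (inj₁ z) f with em {P = ⊤ ≼ N.index x}
      ... | yes q = nn (≤topᴺ (≼⊤ ⊙ q))
      ... | no ¬q with f (inj₂ (topᴾ (N.index x) ¬q)) (np (inj₁ x≼)) (pn (inj₁ x≼))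
        where x≼ = proj₂ (index-topᴾ (N.index x) ¬q)
      ...   | pn q , np q′ = nn (≤topᴺ (Q₁∩Q₂⇒≼ q′ q ⊙ proj₁ (index-topᴾ (N.index x) ¬q)))
      below-top (inj₁ x) (inj₂ z) f with f ε nn nn
      ... | _ , r with R.Rε⇒≤ε r
      ...   | ()
      below-top (inj₂ x) (inj₁ z) f = np
      below-top (inj₂ x) (inj₂ z) f
        with f (inj₁ (topᴺ (indexᴾ x))) (pn (inj₁ ≼x)) (np (inj₁ ≼x))
        where ≼x = proj₁ (index-topᴺ (indexᴾ x))
      ... | np q , pn q′ = pp (≤topᴾ (proj₂ (index-topᴺ (indexᴾ x)) ⊙ Q₁∩Q₂⇒≼ q q′))

    ⋆⋆≤top : ∀ {x} → x ⋆ ⋆ ≤ top x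
    ⋆⋆≤top {x} = below-top x (x ⋆ ⋆) λ y r r′ →
      L⇒R (L.R-monoʳ (R⇒≤⋆ r r′) (R⇒L (≤⋆⇒R ≤-refl))) ,
      R.R-monoʳ (R⇒≤⋆ r r′) (≤⋆⇒R˘ ≤-refl)

    conic : ∀ x → x ≤ ε ⊎ ε ≤ x
    conic (inj₁ x) = inj₁ n≤ε
    conic (inj₂ x) = inj₂ np

    sumFrame : Frame (a ⊔ t) (a ⊔ t ⊔ p)
    sumFrame = record
      { lattice = lattice ; ε = ε ; _R_ = _R_ ; _ʳ = _ʳ ; _ˡ = _ˡ ; _⋆ = _⋆ ; _⇒_ = _⇒_
      ; conic = conic
      ; R⇒≤ʳ = R.R⇒≤ʳ ; ≤ʳ⇒R = R.≤ʳ⇒R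
      ; R⇒≤ˡ = λ r → L.R⇒≤ʳ (R⇒L r) ; ≤ˡ⇒R = λ q → L⇒R (L.≤ʳ⇒R q)
      ; R⇒≤⋆ = R⇒≤⋆ ; ≤⋆⇒R = ≤⋆⇒R ; ≤⋆⇒R˘ = ≤⋆⇒R˘
      ; ≤ε⇒Rε = R.≤ε⇒Rε ; Rε⇒≤ε = R.Rε⇒≤ε
      ; ≤ε⇒εR = λ q → L⇒R (L.≤ε⇒Rε q) ; εR⇒≤ε = λ r → L.Rε⇒≤ε (R⇒L r)
      ; R-separates = R.separates
      ; R˘-separates = λ r ¬r → L.separates (R⇒L r) (¬r ∘ L⇒R)
      ; R-¬R⇒≤ = R.R-¬R⇒≤
      ; ¬R-R⇒≥ = λ ¬r r → L.R-¬R⇒≤ (R⇒L r) (¬r ∘ L⇒R)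
      -- R depends on the classes and signs alone, so it passes from `x ʳ` to its top; thus
      -- residuals are tops of fibres.
      ; ʳ-closed = λ {x} → ⋆⋆≤top ■ R.R⇒≤ʳ (R.R-topʳ {x} (R.≤ʳ⇒R ≤-refl))
      ; ˡ-closed = λ {x} → ⋆⋆≤top ■ L.R⇒≤ʳ (R⇒L (R.R-topˡ {y = x} (L⇒R (L.≤ʳ⇒R ≤-refl))))
      ; ⋆⋆-∧ = λ {x} {y} → LatticeOrder.∧-mono lattice ⋆⋆≤top ⋆⋆≤top ■ top-∧ x y ■ top≤⋆⋆
      ; ⇒-≤ε = λ {x} {y} → ⇒-≤ε x y ; ⇒-intro = λ {x} {y} → ⇒-intro x y ; ⇒-elim = λ {x} {y} → ⇒-elim x y
      }

  -- Amalgamation of chains of classes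

  module _ {c ℓ : Level} where

    record IsChainEmbedding (K K′ : Chain c ℓ) (f : Chain.Carrier K → Chain.Carrier K′) :
                            Set (c ⊔ ℓ) where
      private
        module K = Chain K
        module K′ = Chain K′
      field
        mono : ∀ {x y} → x K.≼ y → f x K′.≼ f y
        cancel : ∀ {x y} → f x K′.≼ f y → x K.≼ y

    record IsLabelEmbedding {K K′ : Chain c ℓ} (M : Labelling K ℓ) (M′ : Labelling K′ ℓ)
                            (f : Chain.Carrier K → Chain.Carrier K′) : Set (c ⊔ ℓ) where
      open Chain K′ using (_∼_)
      private
        module M = Labelling M
        module M′ = Labelling M′
      field
        Lab⇒ : ∀ {x} → M.Lab x → M′.Lab (f x)
        Lab⇐ : ∀ {x} → M′.Lab (f x) → M.Lab x
        pred-homo : ∀ x → f (M.pred x) ∼ M′.pred (f x)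
        succ-homo : ∀ x → f (M.succ x) ∼ M′.succ (f x)

    -- The interpolation fields say that a passage from one factor to the other and back meets A;
    -- with equal end points they give `meet`, the strong part for classes. `covers` is induction
    -- over the two factors and keeps the carrier abstract.
    record ChainAmalgam {A X Y : Chain c ℓ} (f : Chain.Carrier A → Chain.Carrier X)
                        (g : Chain.Carrier A → Chain.Carrier Y) : Set (suc (c ⊔ ℓ)) where
      private
        module X = Chain X
        module Y = Chain Y
      field
        T : Chain c (c ⊔ ℓ)
      open Chain T public
      field
        i : X.Carrier → Carrier
        j : Y.Carrier → Carrier
        i-mono : ∀ {x x′} → x X.≼ x′ → i x ≼ i x′
        i-cancel : ∀ {x x′} → i x ≼ i x′ → x X.≼ x′
        j-mono : ∀ {y y′} → y Y.≼ y′ → j y ≼ j y′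
        j-cancel : ∀ {y y′} → j y ≼ j y′ → y Y.≼ y′
        commutes : ∀ a → i (f a) ∼ j (g a)
        covers : ∀ (P : Pred Carrier (c ⊔ ℓ)) → (∀ x → P (i x)) → (∀ y → P (j y)) → ∀ t → P t
        i-interpolates : ∀ {x y x′} → i x ≼ j y → j y ≼ i x′ → ∃ λ a → i x ≼ i (f a) × i (f a) ≼ i x′
        j-interpolates : ∀ {y x y′} → j y ≼ i x → i x ≼ j y′ → ∃ λ a → j y ≼ j (g a) × j (g a) ≼ j y′

      meet : ∀ {x y} → i x ∼ j y → ∃ λ a → i x ∼ i (f a) × j y ∼ j (g a)
      meet (p , q) with i-interpolates p q
      ... | a , r , r′ = a , (r , r′) , ∼-trans (q , p) (∼-trans (r , r′) (commutes a))

    opposite-amalgam : ∀ {A X Y : Chain c ℓ} {f : Chain.Carrier A → Chain.Carrier X}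
                       {g : Chain.Carrier A → Chain.Carrier Y} →
                       ChainAmalgam {A} {X} {Y} f g → ChainAmalgam {A} {Y} {X} g f
    opposite-amalgam am = record
      { T = T ; i = j ; j = i ; i-mono = j-mono ; i-cancel = j-cancel
      ; j-mono = i-mono ; j-cancel = i-cancel ; commutes = λ a → ∼-sym (commutes a)
      ; covers = λ P p q → covers P q p
      ; i-interpolates = j-interpolates ; j-interpolates = i-interpolates }
      where open ChainAmalgam am

    module _ {A X Y : Chain c ℓ} {f : Chain.Carrier A → Chain.Carrier X}
             {g : Chain.Carrier A → Chain.Carrier Y}
             (f-emb : IsChainEmbedding A X f) (g-emb : IsChainEmbedding A Y g) where
      private
        module X = Chain X
        module Y = Chain Y
        module f = IsChainEmbedding f-emb
        module g = IsChainEmbedding g-emb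

        -- Within a gap of A, the elements of X precede those of Y.
        infix 4 _≼_
        data _≼_ : Rel (X.Carrier ⊎ Y.Carrier) (c ⊔ ℓ) where
          xx : ∀ {x x′} → x X.≼ x′ → inj₁ x ≼ inj₁ x′
          yy : ∀ {y y′} → y Y.≼ y′ → inj₂ y ≼ inj₂ y′
          yx : ∀ {x y} a → y Y.≼ g a → f a X.≼ x → inj₂ y ≼ inj₁ x
          xy : ∀ {x y} a → x X.≼ f a → g a Y.≼ y → inj₁ x ≼ inj₂ y
          gap : ∀ {x y} → ¬ (∃ λ a → y Y.≼ g a × f a X.≼ x) → inj₁ x ≼ inj₂ y

        ≼-trans : ∀ {s t u} → s ≼ t → t ≼ u → s ≼ u
        ≼-trans (xx p) (xx q) = xx (p X.⊙ q)
        ≼-trans (xx p) (xy a q r) = xy a (p X.⊙ q) r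
        ≼-trans (xx p) (gap n) = gap λ (a , q , r) → n (a , q , r X.⊙ p)
        ≼-trans (yy p) (yy q) = yy (p Y.⊙ q)
        ≼-trans (yy p) (yx a q r) = yx a (p Y.⊙ q) r
        ≼-trans (yx a p q) (xx r) = yx a p (q X.⊙ r)
        ≼-trans (yx a p q) (xy b r s) = yy (p Y.⊙ g.mono (f.cancel (q X.⊙ r)) Y.⊙ s)
        ≼-trans {inj₂ y} {_} {inj₂ y′} (yx a p q) (gap n) with Y.≼-total y y′
        ... | inj₁ r = yy r
        ... | inj₂ r = ⊥-elim (n (a , r Y.⊙ p , q))
        ≼-trans (xy a p q) (yy r) = xy a p (q Y.⊙ r)
        ≼-trans (xy a p q) (yx b r s) = xx (p X.⊙ f.mono (g.cancel (q Y.⊙ r)) X.⊙ s)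
        ≼-trans (gap n) (yy q) = gap λ (a , r , s) → n (a , q Y.⊙ r , s)
        ≼-trans {inj₁ x} {_} {inj₁ x′} (gap n) (yx a p q) with X.≼-total x x′
        ... | inj₁ r = xx r
        ... | inj₂ r = ⊥-elim (n (a , p , q X.⊙ r))

        ≼-total : ∀ s t → s ≼ t ⊎ t ≼ s
        ≼-total (inj₁ x) (inj₁ x′) = Sum.map xx xx (X.≼-total x x′)
        ≼-total (inj₂ y) (inj₂ y′) = Sum.map yy yy (Y.≼-total y y′)
        ≼-total (inj₁ x) (inj₂ y) with em {P = ∃ λ a → y Y.≼ g a × f a X.≼ x}
        ... | yes (a , p , q) = inj₂ (yx a p q)
        ... | no n = inj₁ (gap n)
        ≼-total (inj₂ y) (inj₁ x) with em {P = ∃ λ a → y Y.≼ g a × f a X.≼ x}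
        ... | yes (a , p , q) = inj₁ (yx a p q)
        ... | no n = inj₂ (gap n)

        fg : ∀ {a} → inj₁ (f a) ≼ inj₂ (g a)
        fg {a} = xy a X.≼-refl Y.≼-refl

        gf : ∀ {a} → inj₂ (g a) ≼ inj₁ (f a)
        gf {a} = yx a Y.≼-refl X.≼-refl

      abstract
        chainAmalgam : ChainAmalgam {A} {X} {Y} f g
        chainAmalgam = record
          { T = record
            { Carrier = X.Carrier ⊎ Y.Carrier ; _≼_ = _≼_
            ; ≼-refl = λ { {inj₁ _} → xx X.≼-refl ; {inj₂ _} → yy Y.≼-refl }
            ; ≼-trans = ≼-trans ; ≼-total = ≼-total }
          ; i = inj₁ ; j = inj₂
          ; i-mono = xx ; i-cancel = λ { (xx p) → p } ; j-mono = yy ; j-cancel = λ { (yy p) → p }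
          ; commutes = λ a → fg , gf
          ; covers = λ P p q → λ { (inj₁ x) → p x ; (inj₂ y) → q y }
          -- The only constructor of `_≼_` that leads from Y to X carries an element of A, and both
          -- interpolants are read off from it.
          ; i-interpolates = λ { p (yx a q r) → a , ≼-trans p (≼-trans (yy q) gf) , xx r }
          ; j-interpolates = λ { (yx a q r) p → a , yy q , ≼-trans gf (≼-trans (xx r) p) }
          }

    -- Labels on the amalgamated chain

    module LabelledSide {A X Y : Chain c ℓ} {f : Chain.Carrier A → Chain.Carrier X}
                        {g : Chain.Carrier A → Chain.Carrier Y}
                        (am : ChainAmalgam {A} {X} {Y} f g)
                        {MA : Labelling A ℓ} {MX : Labelling X ℓ} {MY : Labelling Y ℓ}
                        (f-lab : IsLabelEmbedding MA MX f) (g-lab : IsLabelEmbedding MA MY g) where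
      open ChainAmalgam am
      private
        module X = Chain X
        module Y = Chain Y
        module MA = Labelling MA
        module MX = Labelling MX
        module MY = Labelling MY
        module f = IsLabelEmbedding f-lab
        module g = IsLabelEmbedding g-lab

        i-cancel∼ : ∀ {x x′} → i x ∼ i x′ → x X.∼ x′
        i-cancel∼ (p , q) = i-cancel p , i-cancel q

        j-cancel∼ : ∀ {y y′} → j y ∼ j y′ → y Y.∼ y′
        j-cancel∼ (p , q) = j-cancel p , j-cancel q

      Lab-transfer : ∀ {x y} → i x ∼ j y → MY.Lab y → MX.Lab x
      Lab-transfer p l with meet p
      ... | a , q , r = MX.Lab-resp (X.∼-sym (i-cancel∼ q)) (f.Lab⇒ (g.Lab⇐ (MY.Lab-resp (j-cancel∼ r) l)))

      -- An element of A in the interval from the predecessor of x to x has the class of one of the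
      -- two ends. At the upper end it is the one sought; at the lower end its `succ`, computed in
      -- A, is.
      in-A : ∀ {x a} → MX.Lab x → i (MX.pred x) ≼ i (f a) → i (f a) ≼ i x → ∃ λ b → f b X.∼ x
      in-A {x} {a} l p q with em {P = x X.≼ f a}
      ... | yes r = a , i-cancel q , r
      ... | no r = MA.succ a , X.∼-trans (f.succ-homo a) (X.∼-trans succ-cong (MX.succ-pred l))
        where
        fa∼pred : f a X.∼ MX.pred x
        fa∼pred = MX.≺⇒≼pred l r , i-cancel p
        succ-cong : MX.succ (f a) X.∼ MX.succ (MX.pred x)
        succ-cong = MX.succ-mono fa∼pred , MX.succ-mono (X.∼-sym fa∼pred)

      private
        ≺⇒≼pred-in-A : ∀ {x a y} → MX.Lab x → f a X.∼ x → j y ≺ i x → j y ≼ i (MX.pred x)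
        ≺⇒≼pred-in-A {x} {a} {y} l p q =
          j-mono (MY.≺⇒≼pred (g.Lab⇒ (f.Lab⇐ (MX.Lab-resp (X.∼-sym p) l)))
                 (λ r → q (i-mono (proj₂ p) ⊙ proj₁ (commutes a) ⊙ j-mono r)))
          ⊙ j-mono (proj₂ (g.pred-homo a)) ⊙ proj₂ (commutes _)
          ⊙ i-mono (proj₁ (f.pred-homo a) X.⊙ MX.pred-mono p)

      -- If an element of Y lies between x and its predecessor, then by interpolation so does an
      -- element of A, and `in-A` brings x from A. Then Y contains the same labelled class with the
      -- same predecessor and leaves no room in between.
      i-≺⇒≼pred : ∀ {x} t → MX.Lab x → t ≺ i x → t ≼ i (MX.pred x)
      i-≺⇒≼pred {x} t l = covers (λ t → t ≺ i x → t ≼ i (MX.pred x))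
        (λ x′ q → i-mono (MX.≺⇒≼pred l (λ r → q (i-mono r)))) case-j t
        where
        case-j : ∀ y → j y ≺ i x → j y ≼ i (MX.pred x)
        case-j y q with ≼-total (j y) (i (MX.pred x))
        ... | inj₁ r = r
        ... | inj₂ r with i-interpolates r (≺⇒≼ q)
        ...   | a , s , s′ with in-A l s s′
        ...     | b , fb∼x = ≺⇒≼pred-in-A l fb∼x q

    record LabelAmalgam {A X Y : Chain c ℓ} {f : Chain.Carrier A → Chain.Carrier X}
                        {g : Chain.Carrier A → Chain.Carrier Y}
                        (am : ChainAmalgam {A} {X} {Y} f g)
                        (MX : Labelling X ℓ) (MY : Labelling Y ℓ) : Set (suc (c ⊔ ℓ)) where
      open ChainAmalgam am
      field
        labels : Labels T (c ⊔ ℓ)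
      open Labels labels public using (Lab; Q; IsPred)
      field
        Lab-i : ∀ {x} → Labelling.Lab MX x → Lab (i x)
        Lab-j : ∀ {y} → Labelling.Lab MY y → Lab (j y)
        Lab-covers : ∀ {t} → Lab t → (∃ λ x → i x ∼ t × Labelling.Lab MX x) ⊎
                                     (∃ λ y → j y ∼ t × Labelling.Lab MY y)

    opposite-labels : ∀ {A X Y : Chain c ℓ} {f : Chain.Carrier A → Chain.Carrier X}
                      {g : Chain.Carrier A → Chain.Carrier Y} {am : ChainAmalgam {A} {X} {Y} f g}
                      {MX : Labelling X ℓ} {MY : Labelling Y ℓ} →
                      LabelAmalgam am MX MY → LabelAmalgam (opposite-amalgam am) MY MX
    opposite-labels lam = record
      { labels = labels ; Lab-i = Lab-j ; Lab-j = Lab-i ; Lab-covers = λ l → Sum.swap (Lab-covers l) }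
      where open LabelAmalgam lam

    module _ {A X Y : Chain c ℓ} {f : Chain.Carrier A → Chain.Carrier X}
             {g : Chain.Carrier A → Chain.Carrier Y}
             (am : ChainAmalgam {A} {X} {Y} f g)
             {MA : Labelling A ℓ} {MX : Labelling X ℓ} {MY : Labelling Y ℓ}
             (f-lab : IsLabelEmbedding MA MX f) (g-lab : IsLabelEmbedding MA MY g) where
      open ChainAmalgam am
      private
        module MX = Labelling MX
        module MY = Labelling MY
        module SX = LabelledSide am f-lab g-lab
        module SY = LabelledSide (opposite-amalgam am) g-lab f-lab

        LabX LabY LabXY : Pred Carrier (c ⊔ ℓ)
        LabX t = ∃ λ x → i x ∼ t × MX.Lab x
        LabY t = ∃ λ y → j y ∼ t × MY.Lab y
        LabXY t = LabX t ⊎ LabY t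

        predecessor : ∀ t → LabXY t → ∃ λ p → p ≺ t × (∀ s → s ≺ t → s ≼ p)
        predecessor t (inj₁ (x , (p , q) , l)) = i (MX.pred x) ,
          (λ r → MX.pred≺ l (i-cancel (p ⊙ r))) , λ s r → SX.i-≺⇒≼pred s l (≺-≼-trans r q)
        predecessor t (inj₂ (y , (p , q) , l)) = j (MY.pred y) ,
          (λ r → MY.pred≺ l (j-cancel (p ⊙ r))) , λ s r → SY.i-≺⇒≼pred s l (≺-≼-trans r q)

        pred : Op₁ Carrier
        pred t with em {P = LabXY t}
        ... | yes l = proj₁ (predecessor t l)
        -- An arbitrary value: `pred` is constrained at labelled elements only.
        ... | no _ = t

        pred≺ : ∀ {t} → LabXY t → pred t ≺ t
        pred≺ {t} l with em {P = LabXY t}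
        ... | yes l′ = proj₁ (proj₂ (predecessor t l′))
        ... | no n = ⊥-elim (n l)

        ≺⇒≼pred : ∀ {t s} → LabXY t → s ≺ t → s ≼ pred t
        ≺⇒≼pred {t} l with em {P = LabXY t}
        ... | yes l′ = proj₂ (proj₂ (predecessor t l′)) _
        ... | no n = ⊥-elim (n l)

      abstract
        labelAmalgam : LabelAmalgam am MX MY
        labelAmalgam = record
          { labels = record
            { Lab = LabXY ; pred = pred
            ; Lab-resp = λ p → Sum.map (λ (x , q , l) → x , ∼-trans q p , l)
                                       (λ (y , q , l) → y , ∼-trans q p , l)
            ; pred≺ = pred≺ ; ≺⇒≼pred = ≺⇒≼pred }
          ; Lab-i = λ {x} l → inj₁ (x , (≼-refl , ≼-refl) , l)
          ; Lab-j = λ {y} l → inj₂ (y , (≼-refl , ≼-refl) , l)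
          ; Lab-covers = id
          }

    module LabelAmalgamSide {A X Y : Chain c ℓ} {f : Chain.Carrier A → Chain.Carrier X}
                            {g : Chain.Carrier A → Chain.Carrier Y}
                            {am : ChainAmalgam {A} {X} {Y} f g}
                            {MA : Labelling A ℓ} {MX : Labelling X ℓ} {MY : Labelling Y ℓ}
                            (f-lab : IsLabelEmbedding MA MX f) (g-lab : IsLabelEmbedding MA MY g)
                            (lam : LabelAmalgam am MX MY) where
      open ChainAmalgam am
      open LabelAmalgam lam
      private
        module MX = Labelling MX
        module MY = Labelling MY
        module SX = LabelledSide am f-lab g-lab
        module SY = LabelledSide (opposite-amalgam am) g-lab f-lab

      Lab-i⁻¹ : ∀ {x} → Lab (i x) → MX.Lab x
      Lab-i⁻¹ l with Lab-covers l
      ... | inj₁ (x , (p , q) , l′) = MX.Lab-resp (i-cancel p , i-cancel q) l′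
      ... | inj₂ (y , p , l′) = SX.Lab-transfer (∼-sym p) l′

      Q-i : ∀ {x x′} → MX.Q x x′ → Q (i x) (i x′)
      Q-i (inj₁ p) = inj₁ (i-mono p)
      Q-i (inj₂ (l , f)) = inj₂ (Lab-i l , λ t p → SX.i-≺⇒≼pred t l p ⊙ i-mono (f _ (MX.pred≺ l)))

      Q-i⁻¹ : ∀ {x x′} → Q (i x) (i x′) → MX.Q x x′
      Q-i⁻¹ (inj₁ p) = inj₁ (i-cancel p)
      Q-i⁻¹ (inj₂ (l , f)) = inj₂ (Lab-i⁻¹ l , λ z p → i-cancel (f _ λ q → p (i-cancel q)))

      -- The labelled successor t of `i x` belongs to X. If it comes from some y in Y, then `i x`
      -- lies between the predecessor of y and y, so an element of A does, and `in-A` places y in A.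
      IsPred-i : ∀ {x t} → IsPred (i x) t → ∃ λ x′ → i x′ ∼ t × MX.IsPred x x′
      IsPred-i {x} {t} (l , x≺t , f) with labelled
        where
        labelled : ∃ λ x′ → i x′ ∼ t × MX.Lab x′
        labelled with Lab-covers l
        ... | inj₁ r = r
        ... | inj₂ (y , (p , q) , l′) with
              j-interpolates (f _ (λ r → MY.pred≺ l′ (j-cancel (p ⊙ r)))) (≺⇒≼ x≺t ⊙ q)
        ...   | a , r , r′ with SY.in-A l′ r r′
        ...     | b , s , s′ = _ , i∼ , Lab-i⁻¹ (Labels.Lab-resp labels (∼-sym i∼) l)
          where i∼ = ∼-trans (commutes b) (∼-trans (j-mono s , j-mono s′) (p , q))
      ... | x′ , (p , q) , l′ = x′ , (p , q) , l′ , (λ r → x≺t (q ⊙ i-mono r)) ,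
              λ z r → i-cancel (f _ λ s → r (i-cancel (p ⊙ s)))

  -- Amalgamation of the fibres

  -- `ι-top` is the essential field: an element that is greatest up to its class remains so in the
  -- amalgam. The unit and the residuals into ε are such elements, and they are preserved for this
  -- reason.
  record IndexedEmbedding {t q r a o a′ o′} {K : Chain t q} {Trivial : Pred (Chain.Carrier K) r}
                          {X : LatticeOrder a o} (xi : Indexing K Trivial X)
                          (N : IndexedLattice K Trivial a′ o′) : Set (t ⊔ q ⊔ a ⊔ o ⊔ a′ ⊔ o′) where
    open Chain K using (_≼_; _∼_)
    private
      module X = LatticeOrder X
      module xi = Indexing xi
      module N = IndexedLattice N
    field
      ι : X.Carrier → N.Carrier
      mono : ∀ {x y} → x X.≤ y → ι x N.≤ ι y
      cancel : ∀ {x y} → ι x N.≤ ι y → x X.≤ y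
      index-ι : ∀ x → N.index (ι x) ∼ xi.index x
      ι-∧ : ∀ {x y n} → n N.≤ ι x → n N.≤ ι y → n N.≤ ι (x X.∧ y)
      ι-∨ : ∀ {x y n} → ι x N.≤ n → ι y N.≤ n → ι (x X.∨ y) N.≤ n
      ι-top : ∀ {x n} → (∀ y → xi.index y ≼ xi.index x → y X.≤ x) →
              N.index n ≼ xi.index x → n N.≤ ι x

  record LatticeEmbedding {a o a′ o′} (A : LatticeOrder a o) (X : LatticeOrder a′ o′) :
                          Set (a ⊔ o ⊔ a′ ⊔ o′) where
    private
      module A = LatticeOrder A
      module X = LatticeOrder X
    field
      map : A.Carrier → X.Carrier
      mono : ∀ {x y} → x A.≤ y → map x X.≤ map y
      cancel : ∀ {x y} → map x X.≤ map y → x A.≤ y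
      map-∧ : ∀ {x y} → map x X.∧ map y X.≤ map (x A.∧ y)
      map-∨ : ∀ {x y} → map (x A.∨ y) X.≤ map x X.∨ map y

  -- `meet` concerns a class occupied in both X and Y, and provides an element of A in that class
  -- above the two given ones. For frames this will be the greatest element of the fibre.
  record Span {t q r} (K : Chain t q) (Trivial : Pred (Chain.Carrier K) r) a o :
              Set (t ⊔ q ⊔ r ⊔ suc (a ⊔ o)) where
    open Chain K public using (_≼_; _≺_; _∼_; ≼-refl; ≺⇒≼; ≼-≺-trans; ≺-≼-trans; ∼-sym; ∼-trans; _⊙_)
    field
      A X Y : LatticeOrder a o
    module A = LatticeOrder A
    module X = LatticeOrder X
    module Y = LatticeOrder Y
    field
      xi : Indexing K Trivial X
      yi : Indexing K Trivial Y
      fx : LatticeEmbedding A X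
      gy : LatticeEmbedding A Y
    module xi = Indexing xi
    module yi = Indexing yi
    open LatticeEmbedding fx public using () renaming
      (map to f; mono to f-mono; cancel to f-cancel; map-∧ to f-∧; map-∨ to f-∨)
    open LatticeEmbedding gy public using () renaming
      (map to g; mono to g-mono; cancel to g-cancel; map-∧ to g-∧; map-∨ to g-∨)
    field
      Trivial-resp : ∀ {s t} → s ∼ t → Trivial s → Trivial t
      agree : ∀ a → xi.index (f a) ∼ yi.index (g a)
      meet : ∀ {x y} → xi.index x ∼ yi.index y → ∃ λ a → xi.index x ∼ xi.index (f a) × x X.≤ f a × y Y.≤ g a

  oppositeSpan : ∀ {t q r} {K : Chain t q} {Trivial : Pred (Chain.Carrier K) r} {a o} →
                 Span K Trivial a o → Span K Trivial a o
  oppositeSpan S = record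
    { A = A ; X = Y ; Y = X ; xi = yi ; yi = xi ; fx = gy ; gy = fx ; Trivial-resp = Trivial-resp
    ; agree = λ a → ∼-sym (agree a)
    ; meet = λ p → let (a , q , r , s) = meet (∼-sym p) in a , ∼-trans p (∼-trans q (agree a)) , s , r
    }
    where open Span S

  -- Amalgamation of lattices by pairs of ideals that agree on A.
  module Positive {t r a o} {K : Chain t (a ⊔ o)} {Trivial : Pred (Chain.Carrier K) r}
                  (S : Span K Trivial a o) where
    open Span S

    Z : Set a
    Z = X.Carrier ⊎ Y.Carrier

    data _,_⊢_ : Z → Z → Z → Set (a ⊔ o) where
      xx : ∀ {x₁ x₂ x} → x X.≤ x₁ X.∨ x₂ → inj₁ x₁ , inj₁ x₂ ⊢ inj₁ x
      yy : ∀ {y₁ y₂ y} → y Y.≤ y₁ Y.∨ y₂ → inj₂ y₁ , inj₂ y₂ ⊢ inj₂ y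
      xy : ∀ {x y} b → f b X.≤ x → y Y.≤ g b → inj₁ x , inj₁ x ⊢ inj₂ y
      yx : ∀ {x y} b → g b Y.≤ y → x X.≤ f b → inj₂ y , inj₂ y ⊢ inj₁ x

    L : Chain.Carrier K → Pred Z (a ⊔ o)
    L t (inj₁ x) = xi.index x ≼ t
    L t (inj₂ y) = yi.index y ≼ t

    L-mono : ∀ z {s t} → s ≼ t → L s z → L t z
    L-mono (inj₁ x) p l = l ⊙ p
    L-mono (inj₂ y) p l = l ⊙ p

    L-closed : ∀ {t z₁ z₂ z} → z₁ , z₂ ⊢ z → L t z₁ → L t z₂ → L t z
    L-closed (xx p) l m = xi.index-mono p ⊙ [ _⊙ l , _⊙ m ]′ (xi.index-∨ _ _)
    L-closed (yy p) l m = yi.index-mono p ⊙ [ _⊙ l , _⊙ m ]′ (yi.index-∨ _ _)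
    L-closed (xy b p q) l _ = yi.index-mono q ⊙ proj₂ (agree b) ⊙ xi.index-mono p ⊙ l
    L-closed (yx b p q) l _ = xi.index-mono q ⊙ proj₁ (agree b) ⊙ yi.index-mono p ⊙ l

    open Stack {o = o} K Trivial-resp _,_⊢_ L L-mono L-closed public

    -- The image of x as a pair of ideals. Its part in Y consists of what is below x through A,
    -- enlarged by `under` because elements of lower class must be included whether or not A
    -- mediates.
    data Below (x : X.Carrier) : Pred Z (a ⊔ o) where
      in-X : ∀ {x′} → x′ X.≤ x → Below x (inj₁ x′)
      via : ∀ {y} b → y Y.≤ g b → f b X.≤ x → Below x (inj₂ y)
      under : ∀ {y} → yi.index y ≺ xi.index x → Below x (inj₂ y)

    Below-closed : ∀ {x z₁ z₂ z} → z₁ , z₂ ⊢ z → Below x z₁ → Below x z₂ → Below x z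
    Below-closed (xx p) (in-X q) (in-X r) = in-X (p X.⊙ X.∨-least q r)
    Below-closed (xy b p q) (in-X r) _ = via b q (p X.⊙ r)
    Below-closed (yx b p q) (via c r s) _ = in-X (q X.⊙ f-mono (g-cancel (p Y.⊙ r)) X.⊙ s)
    Below-closed (yx b p q) (under r) _ =
      in-X (q X.⊙ xi.≺⇒≤ (≼-≺-trans (proj₁ (agree b) ⊙ yi.index-mono p) r))
    Below-closed (yy p) (via b q r) (via c s u) =
      via (b A.∨ c) (p Y.⊙ Y.∨-least (q Y.⊙ g-mono A.x≤x∨y) (s Y.⊙ g-mono A.y≤x∨y)) (f-∨ X.⊙ X.∨-least r u)
    Below-closed (yy {y₁} {y₂} p) (under q) (under r) =
      under ([ (λ s → ≼-≺-trans s q) , (λ s → ≼-≺-trans s r) ]′ (yi.index-∨ y₁ y₂) ∘ (_⊙ yi.index-mono p))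
    -- If the class of `y₁` is not below that of x, then it is above that of `y₂`; so `y₂ ≤ y₁` and
    -- the witness b bounds both.
    Below-closed {x} (yy {y₁} {y₂} p) (via b q r) (under s) with em {P = yi.index y₁ ≺ xi.index x}
    ... | yes q′ = Below-closed (yy p) (under q′) (under s)
    ... | no ¬q′ = via b (p Y.⊙ Y.∨-least q (yi.≺⇒≤ (λ u → ¬q′ (≼-≺-trans u s)) Y.⊙ q)) r
    Below-closed {x} (yy {y₁} {y₂} p) (under s) (via b q r) with em {P = yi.index y₂ ≺ xi.index x}
    ... | yes q′ = Below-closed (yy p) (under s) (under q′)
    ... | no ¬q′ = via b (p Y.⊙ Y.∨-least (yi.≺⇒≤ (λ u → ¬q′ (≼-≺-trans u s)) Y.⊙ q) q) r

    -- For y in the class of x, `meet` gives b in A of this class with `y ≤ g b`, and `f b ≤ x`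
    -- because x is greatest. The lemma serves both fullness over trivial classes and `ι-top`.
    Below-top : ∀ {x} → (∀ x′ → xi.index x′ ≼ xi.index x → x′ X.≤ x) →
                ∀ {z} → L (xi.index x) z → Below x z
    Below-top top {inj₁ x′} l = in-X (top x′ l)
    Below-top {x} top {inj₂ y} l with em {P = xi.index x ≼ yi.index y}
    ... | no ¬p = under ¬p
    ... | yes p with meet (p , l)
    ...   | b , (_ , q) , _ , r = via b r (top (f b) q)

    Trivial⇒top : ∀ {x} → Trivial (xi.index x) → ∀ x′ → xi.index x′ ≼ xi.index x → x′ X.≤ x
    Trivial⇒top {x} τ x′ p with em {P = xi.index x ≼ xi.index x′}
    ... | yes q = xi.trivial (Trivial-resp (q , p) τ) (p , q)
    ... | no ¬q = xi.≺⇒≤ ¬q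

    ι : X.Carrier → Element
    ι x = record
      { index = xi.index x ; member = Below x ; closed = Below-closed
      ; lower = λ { {z = inj₁ x′} p l → in-X (xi.≺⇒≤ (≼-≺-trans l p))
                  ; {z = inj₂ y} p l → under (≼-≺-trans l p) }
      ; upper = λ { (in-X p) → xi.index-mono p
                  ; (via b p q) → yi.index-mono p ⊙ proj₂ (agree b) ⊙ xi.index-mono q
                  ; (under p) → ≺⇒≼ p }
      ; full = λ τ → Below-top (Trivial⇒top τ)
      }

    Below-∧ : ∀ {x y z} → Below x z → Below y z → Below (x X.∧ y) z
    Below-∧ (in-X p) (in-X q) = in-X (X.∧-greatest p q)
    Below-∧ (via b p q) (via c r s) = via (b A.∧ c) (Y.∧-greatest p r Y.⊙ g-∧)
      (X.∧-greatest (f-mono A.x∧y≤x X.⊙ q) (f-mono A.x∧y≤y X.⊙ s))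
    Below-∧ {x} {y} (under p) (under q) =
      under ([ (λ s → ≺-≼-trans p s) , (λ s → ≺-≼-trans q s) ]′ (xi.index-∧ x y))
    Below-∧ {x} {y} (via {w} b p q) (under r) with em {P = yi.index w ≺ xi.index x}
    ... | yes s = Below-∧ (under s) (under r)
    ... | no ¬s = via b p (X.∧-greatest q (q X.⊙ xi.≺⇒≤ (λ u → ¬s (≺-≼-trans r u))))
    Below-∧ {x} {y} (under r) (via {w} b p q) with em {P = yi.index w ≺ xi.index y}
    ... | yes s = Below-∧ (under r) (under s)
    ... | no ¬s = via b p (X.∧-greatest (q X.⊙ xi.≺⇒≤ (λ u → ¬s (≺-≼-trans r u))) q)

    Below-∨ : ∀ {x y z n} → ι x ≤ n → ι y ≤ n → Below (x X.∨ y) z → member n z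
    Below-∨ {n = n} (_ , p) (_ , q) (in-X r) = closed n (xx r) (p (in-X X.≤-refl)) (q (in-X X.≤-refl))
    Below-∨ {n = n} p q (via b r s) = closed n (xy b X.≤-refl r) u u
      where u = Below-∨ p q (in-X s)
    Below-∨ {x} {y} (_ , p) (_ , q) (under r) =
      [ (λ s → p (under (≺-≼-trans r s))) , (λ s → q (under (≺-≼-trans r s))) ]′ (xi.index-∨ x y)

    embedding : IndexedEmbedding xi indexedLattice
    embedding = record
      { ι = ι
      ; mono = λ p → xi.index-mono p , λ
          { (in-X q) → in-X (q X.⊙ p) ; (via b q r) → via b q (r X.⊙ p)
          ; (under q) → under (≺-≼-trans q (xi.index-mono p)) }
      ; cancel = λ (_ , p) → Below⁻ (p (in-X X.≤-refl))
      ; index-ι = λ x → ≼-refl , ≼-refl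
      ; ι-∧ = λ {x} {y} (p , q) (p′ , q′) →
          [ p ⊙_ , p′ ⊙_ ]′ (xi.index-∧ x y) , λ u → Below-∧ (q u) (q′ u)
      ; ι-∨ = λ {x} {y} p@(p′ , _) q@(q′ , _) →
          [ _⊙ p′ , _⊙ q′ ]′ (xi.index-∨ x y) , Below-∨ p q
      ; ι-top = λ {x} {n} top p → p , λ {z} u → Below-top top (L-mono z p (upper n u))
      }
      where
      Below⁻ : ∀ {x x′} → Below x (inj₁ x′) → x′ X.≤ x
      Below⁻ (in-X p) = p

  record IndexedIso {t q r a o} {K : Chain t q} {Trivial : Pred (Chain.Carrier K) r}
                    (M N : IndexedLattice K Trivial a o) : Set (t ⊔ q ⊔ a ⊔ o) where
    open Chain K using (_∼_)
    private
      module M = IndexedLattice M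
      module N = IndexedLattice N
    field
      φ : M.Carrier → N.Carrier
      ψ : N.Carrier → M.Carrier
      φ-mono : ∀ {m m′} → m M.≤ m′ → φ m N.≤ φ m′
      ψ-mono : ∀ {n n′} → n N.≤ n′ → ψ n M.≤ ψ n′
      φψ≤ : ∀ {n} → φ (ψ n) N.≤ n
      ≤φψ : ∀ {n} → n N.≤ φ (ψ n)
      ψφ≤ : ∀ {m} → ψ (φ m) M.≤ m
      ≤ψφ : ∀ {m} → m M.≤ ψ (φ m)
      index-φ : ∀ {m} → N.index (φ m) ∼ M.index m
      index-ψ : ∀ {n} → M.index (ψ n) ∼ N.index n

  -- The embedding of Y is that of X for the opposite span. The two amalgams differ by exchanging
  -- the factors, and this carries the embedding over.
  transport : ∀ {t q r a o a′ o′} {K : Chain t q} {Trivial : Pred (Chain.Carrier K) r}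
              {X : LatticeOrder a o} {xi : Indexing K Trivial X} {M N : IndexedLattice K Trivial a′ o′} →
              IndexedIso M N → IndexedEmbedding xi M → IndexedEmbedding xi N
  transport {K = K} {M = M} {N = N} iso e = record
    { ι = φ ∘ ι
    ; mono = φ-mono ∘ mono
    ; cancel = λ p → cancel (≤ψφ M.⊙ ψ-mono p M.⊙ ψφ≤)
    ; index-ι = λ x → ∼-trans index-φ (index-ι x)
    ; ι-∧ = λ p q → ≤φψ N.⊙ φ-mono (ι-∧ (ψ-mono p M.⊙ ψφ≤) (ψ-mono q M.⊙ ψφ≤))
    ; ι-∨ = λ p q → φ-mono (ι-∨ (≤ψφ M.⊙ ψ-mono p) (≤ψφ M.⊙ ψ-mono q)) N.⊙ φψ≤
    ; ι-top = λ top p → ≤φψ N.⊙ φ-mono (ι-top top (≼-trans (proj₁ index-ψ) p))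
    }
    where
    module M = IndexedLattice M
    module N = IndexedLattice N
    open Chain K using (∼-trans; ≼-trans)
    open IndexedIso iso
    open IndexedEmbedding e

  record IndexedAmalgam {t q r a o} {K : Chain t q} {Trivial : Pred (Chain.Carrier K) r}
                        (S : Span K Trivial a o) {a′ o′} (N : IndexedLattice K Trivial a′ o′) :
                        Set (t ⊔ q ⊔ a ⊔ o ⊔ a′ ⊔ o′) where
    open Span S
    module N = IndexedLattice N
    field
      x-emb : IndexedEmbedding xi N
      y-emb : IndexedEmbedding yi N
    module x = IndexedEmbedding x-emb
    module y = IndexedEmbedding y-emb
    field
      commutes : ∀ b → x.ι (f b) N.≤ y.ι (g b) × y.ι (g b) N.≤ x.ι (f b)
      strong : ∀ {x y} → x.ι x N.≤ y.ι y → y.ι y N.≤ x.ι x → ∃ λ b → f b X.≤ x × x X.≤ f b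

  record PositiveAmalgam {t r a o} {K : Chain t (a ⊔ o)} {Trivial : Pred (Chain.Carrier K) r}
                         (S : Span K Trivial a o) : Set (suc (t ⊔ suc (a ⊔ o) ⊔ r)) where
    open Chain K using (_≼_; _∼_)
    field
      N : IndexedLattice K Trivial (t ⊔ suc (a ⊔ o) ⊔ r) (a ⊔ o)
    open IndexedLattice N
    field
      top : Chain.Carrier K → Carrier
      index-top : ∀ s → index (top s) ∼ s
      ≤top : ∀ {x s} → index x ≼ s → x ≤ top s
      amalgam : IndexedAmalgam S N

  module _ {t r a o} {K : Chain t (a ⊔ o)} {Trivial : Pred (Chain.Carrier K) r}
           (S : Span K Trivial a o) where
    open Span S
    private
      module O = Positive (oppositeSpan S)
      open Positive S hiding (Z)

      rule⇒ : ∀ {z₁ z₂ z} → z₁ , z₂ ⊢ z → O._,_⊢_ (Sum.swap z₁) (Sum.swap z₂) (Sum.swap z)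
      rule⇒ (xx p) = O.yy p
      rule⇒ (yy p) = O.xx p
      rule⇒ (xy b p q) = O.yx b p q
      rule⇒ (yx b p q) = O.xy b p q

      rule⇐ : ∀ {z₁ z₂ z} → O._,_⊢_ z₁ z₂ z → Sum.swap z₁ , Sum.swap z₂ ⊢ Sum.swap z
      rule⇐ (O.xx p) = yy p
      rule⇐ (O.yy p) = xx p
      rule⇐ (O.xy b p q) = yx b p q
      rule⇐ (O.yx b p q) = xy b p q

      L⇒ : ∀ {t} z → L t z → O.L t (Sum.swap z)
      L⇒ (inj₁ x) l = l
      L⇒ (inj₂ y) l = l

      L⇐ : ∀ {t} z → O.L t (Sum.swap z) → L t z
      L⇐ (inj₁ x) l = l
      L⇐ (inj₂ y) l = l

      L⇒′ : ∀ {t} z → O.L t z → L t (Sum.swap z)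
      L⇒′ (inj₁ x) l = l
      L⇒′ (inj₂ y) l = l

      L⇐′ : ∀ {t} z → L t (Sum.swap z) → O.L t z
      L⇐′ (inj₁ x) l = l
      L⇐′ (inj₂ y) l = l

      φ : O.Element → Element
      φ m = record
        { index = O.index m ; member = O.member m ∘ Sum.swap
        ; closed = λ s → O.closed m (rule⇒ s)
        ; lower = λ {_} {z} p l → O.lower m p (L⇒ z l)
        ; upper = λ {z} u → L⇐ z (O.upper m u)
        ; full = λ τ {z} l → O.full m τ (L⇒ z l) }

      ψ : Element → O.Element
      ψ n = record
        { index = index n ; member = member n ∘ Sum.swap
        ; closed = λ s → closed n (rule⇐ s)
        ; lower = λ {_} {z} p l → lower n p (L⇒′ z l)
        ; upper = λ {z} u → L⇐′ z (upper n u)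
        ; full = λ τ {z} l → full n τ (L⇒′ z l) }

      iso : IndexedIso O.indexedLattice indexedLattice
      iso = record
        { φ = φ ; ψ = ψ
        ; φ-mono = λ (p O., f) → p , f
        ; ψ-mono = λ (p , f) → p O., f
        ; φψ≤ = ≼-refl , λ { {inj₁ _} u → u ; {inj₂ _} u → u }
        ; ≤φψ = ≼-refl , λ { {inj₁ _} u → u ; {inj₂ _} u → u }
        ; ψφ≤ = ≼-refl O., λ { {inj₁ _} u → u ; {inj₂ _} u → u }
        ; ≤ψφ = ≼-refl O., λ { {inj₁ _} u → u ; {inj₂ _} u → u }
        ; index-φ = ≼-refl , ≼-refl
        ; index-ψ = ≼-refl , ≼-refl }

    abstract
      positiveAmalgam : PositiveAmalgam S
      positiveAmalgam = record
        { N = indexedLattice ; top = top ; index-top = λ s → ≼-refl , ≼-refl ; ≤top = ≤top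
        ; amalgam = record
          { x-emb = embedding
          ; y-emb = transport iso O.embedding
          ; commutes = λ b → (proj₁ (agree b) , to-O) , (proj₂ (agree b) , from-O _)
          ; strong = λ (p , u) (q , v) → strong p q (u (in-X X.≤-refl)) (v (O.in-X Y.≤-refl))
          }
        }
        where
        to-O : ∀ {b z} → Below (f b) z → O.Below (g b) (Sum.swap z)
        to-O (in-X p) = O.via _ p Y.≤-refl
        to-O (via c p q) = O.in-X (p Y.⊙ g-mono (f-cancel q))
        to-O (under p) = O.in-X (yi.≺⇒≤ (≺-≼-trans p (proj₁ (agree _))))

        from-O : ∀ {b} z → O.Below (g b) (Sum.swap z) → Below (f b) z
        from-O (inj₂ y) (O.in-X p) = via _ p X.≤-refl
        from-O (inj₁ x) (O.via c p q) = in-X (p X.⊙ f-mono (g-cancel q))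
        from-O (inj₁ x) (O.under p) = in-X (xi.≺⇒≤ (≺-≼-trans p (proj₂ (agree _))))

        -- The two memberships give `x ≤ f b`, `g b ≤ y ≤ g c` and `f c ≤ x`. Hence `b ≤ c`, and x
        -- equals `f b`. `under` is impossible since x and y have the same class.
        strong : ∀ {x y} → xi.index x ≼ yi.index y → yi.index y ≼ xi.index x →
                 O.Below y (inj₂ x) → Below x (inj₂ y) → ∃ λ b → f b X.≤ x × x X.≤ f b
        strong p q (O.via b r s) (via c u v) = b , (f-mono (g-cancel (s Y.⊙ u)) X.⊙ v) , r
        strong p q (O.under n) _ = ⊥-elim (n q)
        strong p q _ (under n) = ⊥-elim (n p)

  -- Amalgamation of the negative fibres

  record IsBrouwerian {a o} (𝐋 : LatticeOrder a o) : Set (a ⊔ o) where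
    open LatticeOrder 𝐋
    infixr 6 _⇒_
    field
      ⊤ : Carrier
      ≤⊤ : ∀ {x} → x ≤ ⊤
      _⇒_ : Op₂ Carrier
      ⇒-intro : ∀ {x y z} → x ∧ z ≤ y → z ≤ x ⇒ y
      ⇒-elim : ∀ {x y} → x ∧ (x ⇒ y) ≤ y

    ⇒-mp : ∀ {x y z} → z ≤ x → z ≤ x ⇒ y → z ≤ y
    ⇒-mp p q = ∧-greatest p q ⊙ ⇒-elim

    ∨-∧-least : ∀ {x y z w} → x ∧ w ≤ z → y ∧ w ≤ z → (x ∨ y) ∧ w ≤ z
    ∨-∧-least p q = ⇒-mp x∧y≤y (x∧y≤x ⊙ ∨-least (⇒-intro (∧-greatest x∧y≤y x∧y≤x ⊙ p))
                                              (⇒-intro (∧-greatest x∧y≤y x∧y≤x ⊙ q)))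

  record NegativeSpan {t q r} (K : Chain t q) (Trivial : Pred (Chain.Carrier K) r) a o :
                      Set (t ⊔ q ⊔ r ⊔ suc (a ⊔ o)) where
    field
      span : Span K Trivial a o
    open Span span public
    field
      bA : IsBrouwerian A
      bX : IsBrouwerian X
      bY : IsBrouwerian Y
    module bA = IsBrouwerian bA
    module bX = IsBrouwerian bX
    module bY = IsBrouwerian bY
    field
      f-⊤ : bX.⊤ X.≤ f bA.⊤
      g-⊤ : bY.⊤ Y.≤ g bA.⊤
      f-⇒ : ∀ {x y} → f x bX.⇒ f y X.≤ f (x bA.⇒ y)
      g-⇒ : ∀ {x y} → g x bY.⇒ g y Y.≤ g (x bA.⇒ y)
      ≼⊤ˣ : ∀ {s} → s ≼ xi.index bX.⊤
      ≼⊤ʸ : ∀ {s} → s ≼ yi.index bY.⊤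

  oppositeNegative : ∀ {t q r} {K : Chain t q} {Trivial : Pred (Chain.Carrier K) r} {a o} →
                     NegativeSpan K Trivial a o → NegativeSpan K Trivial a o
  oppositeNegative S = record
    { span = oppositeSpan span ; bA = bA ; bX = bY ; bY = bX ; f-⊤ = g-⊤ ; g-⊤ = f-⊤
    ; f-⇒ = g-⇒ ; g-⇒ = f-⇒ ; ≼⊤ˣ = ≼⊤ʸ ; ≼⊤ʸ = ≼⊤ˣ }
    where open NegativeSpan S

  -- The closed sets are the ideals of the distributive-lattice coproduct of X and Y
  -- over A, presented by pairs (x , y) standing for x ∧ y.
  module Negative {t r a o} {K : Chain t (a ⊔ o)} {Trivial : Pred (Chain.Carrier K) r}
                  (S : NegativeSpan K Trivial a o) where
    open NegativeSpan S

    Z : Set a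
    Z = X.Carrier × Y.Carrier

    -- The shift rules identify `f b` with `g b`: for `y ≤ g b` the formal meet of x and y does not
    -- change when x is replaced by `x ∧ f b`.
    data _,_⊢_ : Z → Z → Z → Set (a ⊔ o) where
      ∨ˡ : ∀ {x₁ x₂ x y₁ y₂ y} → x X.≤ x₁ X.∨ x₂ → y Y.≤ y₁ → y Y.≤ y₂ →
           (x₁ , y₁) , (x₂ , y₂) ⊢ (x , y)
      ∨ʳ : ∀ {x₁ x₂ x y₁ y₂ y} → x X.≤ x₁ → x X.≤ x₂ → y Y.≤ y₁ Y.∨ y₂ →
           (x₁ , y₁) , (x₂ , y₂) ⊢ (x , y)
      shiftʳ : ∀ {x₁ x y₁ y} b → x X.∧ f b X.≤ x₁ → y Y.≤ g b → y Y.≤ y₁ →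
               (x₁ , y₁) , (x₁ , y₁) ⊢ (x , y)
      shiftˡ : ∀ {x₁ x y₁ y} b → x X.≤ f b → x X.≤ x₁ → y Y.∧ g b Y.≤ y₁ →
               (x₁ , y₁) , (x₁ , y₁) ⊢ (x , y)

    -- The class of a formal meet is the smaller of the two classes.
    L : Chain.Carrier K → Pred Z (a ⊔ o)
    L t (x , y) = xi.index x ≼ t ⊎ yi.index y ≼ t

    L-mono : ∀ z {s t} → s ≼ t → L s z → L t z
    L-mono _ p = Sum.map (_⊙ p) (_⊙ p)

    L-closed : ∀ {t z₁ z₂ z} → z₁ , z₂ ⊢ z → L t z₁ → L t z₂ → L t z
    L-closed (∨ˡ p q r) (inj₂ l) _ = inj₂ (yi.index-mono q ⊙ l)
    L-closed (∨ˡ p q r) _ (inj₂ m) = inj₂ (yi.index-mono r ⊙ m)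
    L-closed (∨ˡ p q r) (inj₁ l) (inj₁ m) =
      inj₁ (xi.index-mono p ⊙ [ _⊙ l , _⊙ m ]′ (xi.index-∨ _ _))
    L-closed (∨ʳ p q r) (inj₁ l) _ = inj₁ (xi.index-mono p ⊙ l)
    L-closed (∨ʳ p q r) _ (inj₁ m) = inj₁ (xi.index-mono q ⊙ m)
    L-closed (∨ʳ p q r) (inj₂ l) (inj₂ m) =
      inj₂ (yi.index-mono r ⊙ [ _⊙ l , _⊙ m ]′ (yi.index-∨ _ _))
    L-closed (shiftʳ b p q r) (inj₁ l) _ = Sum.map (λ s → s ⊙ xi.index-mono p ⊙ l)
      (λ s → yi.index-mono q ⊙ proj₂ (agree b) ⊙ s ⊙ xi.index-mono p ⊙ l) (xi.index-∧ _ _)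
    L-closed (shiftʳ b p q r) (inj₂ l) _ = inj₂ (yi.index-mono r ⊙ l)
    L-closed (shiftˡ b p q r) (inj₁ l) _ = inj₁ (xi.index-mono q ⊙ l)
    L-closed (shiftˡ b p q r) (inj₂ l) _ = Sum.swap (Sum.map (λ s → s ⊙ yi.index-mono r ⊙ l)
      (λ s → xi.index-mono p ⊙ proj₁ (agree b) ⊙ s ⊙ yi.index-mono r ⊙ l) (yi.index-∧ _ _))

    open Stack {o = o} K Trivial-resp _,_⊢_ L L-mono L-closed public

    _⊓_ : Op₂ Z
    (x , y) ⊓ (x′ , y′) = (x X.∧ x′) , (y Y.∧ y′)

    private
      rotateˣ : ∀ {x w v} → (x X.∧ w) X.∧ v X.≤ (x X.∧ v) X.∧ w
      rotateˣ = X.∧-greatest (X.∧-mono X.x∧y≤x X.≤-refl) (X.x∧y≤x X.⊙ X.x∧y≤y)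

      rotateʸ : ∀ {y w v} → (y Y.∧ w) Y.∧ v Y.≤ (y Y.∧ v) Y.∧ w
      rotateʸ = Y.∧-greatest (Y.∧-mono Y.x∧y≤x Y.≤-refl) (Y.x∧y≤x Y.⊙ Y.x∧y≤y)

    -- Stability of the rules under meets is what makes the residual of one ideal by another an
    -- ideal. The join rules need distributivity, which comes from the implications.
    ⊓-⊢ : ∀ {z₁ z₂ z} w → z₁ , z₂ ⊢ z → (z₁ ⊓ w) , (z₂ ⊓ w) ⊢ (z ⊓ w)
    ⊓-⊢ w (∨ˡ p q r) = ∨ˡ (X.∧-mono p X.≤-refl X.⊙ bX.∨-∧-least X.x≤x∨y X.y≤x∨y)
      (Y.∧-mono q Y.≤-refl) (Y.∧-mono r Y.≤-refl)
    ⊓-⊢ w (∨ʳ p q r) = ∨ʳ (X.∧-mono p X.≤-refl) (X.∧-mono q X.≤-refl)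
      (Y.∧-mono r Y.≤-refl Y.⊙ bY.∨-∧-least Y.x≤x∨y Y.y≤x∨y)
    ⊓-⊢ w (shiftʳ b p q r) = shiftʳ b (rotateˣ X.⊙ X.∧-mono p X.≤-refl)
      (Y.x∧y≤x Y.⊙ q) (Y.∧-mono r Y.≤-refl)
    ⊓-⊢ w (shiftˡ b p q r) = shiftˡ b (X.x∧y≤x X.⊙ p) (X.∧-mono q X.≤-refl)
      (rotateʸ Y.⊙ Y.∧-mono r Y.≤-refl)

    open Implication _⊓_ ⊓-⊢
      (∨ˡ (X.x∧y≤x X.⊙ X.x≤x∨y) Y.x∧y≤x Y.x∧y≤x)
      (∨ˡ (X.x∧y≤y X.⊙ X.x≤x∨y) Y.x∧y≤y Y.x∧y≤y)
      (∨ˡ (X.∧-greatest X.≤-refl X.≤-refl X.⊙ X.x≤x∨y)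
          (Y.∧-greatest Y.≤-refl Y.≤-refl) (Y.∧-greatest Y.≤-refl Y.≤-refl)) public

    -- `via` expresses `x′ ∧ y ≤ x` over A by an interpolant b from A, as for coproducts of
    -- distributive lattices; `under` adds the pairs whose Y component has lower class than x.
    data Below (x : X.Carrier) : Pred Z (a ⊔ o) where
      via : ∀ {x′ y} b → y Y.≤ g b → x′ X.∧ f b X.≤ x → Below x (x′ , y)
      under : ∀ {x′ y} → yi.index y ≺ xi.index x → Below x (x′ , y)

    via-⊤ : ∀ {x x′ y} → x′ X.≤ x → Below x (x′ , y)
    via-⊤ p = via bA.⊤ (bY.≤⊤ Y.⊙ g-⊤) (X.x∧y≤x X.⊙ p)

    Below-closed : ∀ {x z₁ z₂ z} → z₁ , z₂ ⊢ z → Below x z₁ → Below x z₂ → Below x z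
    Below-closed (∨ˡ p q r) (under s) _ = under (≼-≺-trans (yi.index-mono q) s)
    Below-closed (∨ˡ p q r) _ (under s) = under (≼-≺-trans (yi.index-mono r) s)
    Below-closed (∨ˡ p q r) (via b s u) (via c s′ u′) =
      via (b A.∧ c) (Y.∧-greatest (q Y.⊙ s) (r Y.⊙ s′) Y.⊙ g-∧)
        (X.∧-mono p X.≤-refl X.⊙ bX.∨-∧-least (X.∧-mono X.≤-refl (f-mono A.x∧y≤x) X.⊙ u)
                                              (X.∧-mono X.≤-refl (f-mono A.x∧y≤y) X.⊙ u′))
    Below-closed (∨ʳ p q r) (via b s u) (via c s′ u′) =
      via (b A.∨ c) (r Y.⊙ Y.∨-least (s Y.⊙ g-mono A.x≤x∨y) (s′ Y.⊙ g-mono A.y≤x∨y))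
        (X.∧-greatest (X.x∧y≤y X.⊙ f-∨) X.x∧y≤x X.⊙ bX.∨-∧-least
          (X.∧-greatest (X.x∧y≤y X.⊙ p) X.x∧y≤x X.⊙ u)
          (X.∧-greatest (X.x∧y≤y X.⊙ q) X.x∧y≤x X.⊙ u′))
    Below-closed (∨ʳ {y₁ = y₁} {y₂} p q r) (under s) (under s′) =
      under ([ (λ u → ≼-≺-trans u s) , (λ u → ≼-≺-trans u s′) ]′ (yi.index-∨ y₁ y₂) ∘ (_⊙ yi.index-mono r))
    Below-closed {x} (∨ʳ {y₁ = y₁} p q r) (via b s u) (under v) with em {P = yi.index y₁ ≺ xi.index x}
    ... | yes w = Below-closed (∨ʳ p q r) (under w) (under v)
    ... | no ¬w = via b (r Y.⊙ Y.∨-least s (yi.≺⇒≤ (λ m → ¬w (≼-≺-trans m v)) Y.⊙ s))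
                        (X.∧-mono p X.≤-refl X.⊙ u)
    Below-closed {x} (∨ʳ {y₂ = y₂} p q r) (under v) (via b s u) with em {P = yi.index y₂ ≺ xi.index x}
    ... | yes w = Below-closed (∨ʳ p q r) (under v) (under w)
    ... | no ¬w = via b (r Y.⊙ Y.∨-least (yi.≺⇒≤ (λ m → ¬w (≼-≺-trans m v)) Y.⊙ s) s)
                        (X.∧-mono q X.≤-refl X.⊙ u)
    Below-closed (shiftʳ b p q r) (via c s u) _ =
      via (b A.∧ c) (Y.∧-greatest q (r Y.⊙ s) Y.⊙ g-∧)
        (X.∧-greatest (X.∧-mono X.≤-refl (f-mono A.x∧y≤x) X.⊙ p) (X.x∧y≤y X.⊙ f-mono A.x∧y≤y) X.⊙ u)
    Below-closed (shiftʳ b p q r) (under s) _ = under (≼-≺-trans (yi.index-mono r) s)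
    -- From `y ∧ g b ≤ g c` the interpolant for the shifted pair is `b ⇒ c`; this is where `g` has
    -- to preserve implications.
    Below-closed (shiftˡ b p q r) (via c s u) _ =
      via (b bA.⇒ c) (bY.⇒-intro (Y.∧-greatest Y.x∧y≤y Y.x∧y≤x Y.⊙ r Y.⊙ s) Y.⊙ g-⇒)
        (X.∧-greatest (X.x∧y≤x X.⊙ q) (X.∧-mono p X.≤-refl X.⊙ f-∧ X.⊙ f-mono bA.⇒-elim) X.⊙ u)
    Below-closed (shiftˡ {y = y} b p q r) (under s) _ with yi.index-∧ y (g b)
    ... | inj₁ u = under (≼-≺-trans (u ⊙ yi.index-mono r) s)
    ... | inj₂ u = via-⊤ (p X.⊙ xi.≺⇒≤ (≼-≺-trans (proj₁ (agree b) ⊙ u ⊙ yi.index-mono r) s))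

    Below-top : ∀ {x} → (∀ x′ → xi.index x′ ≼ xi.index x → x′ X.≤ x) →
                ∀ {z} → L (xi.index x) z → Below x z
    Below-top top (inj₁ l) = via-⊤ (top _ l)
    Below-top {x} top {_ , y} (inj₂ l) with em {P = xi.index x ≼ yi.index y}
    ... | no ¬p = under ¬p
    ... | yes p with meet (p , l)
    ...   | b , (_ , q) , _ , r = via b r (X.x∧y≤y X.⊙ top (f b) q)

    Trivial⇒top : ∀ {x} → Trivial (xi.index x) → ∀ x′ → xi.index x′ ≼ xi.index x → x′ X.≤ x
    Trivial⇒top {x} τ x′ p with em {P = xi.index x ≼ xi.index x′}
    ... | yes q = xi.trivial (Trivial-resp (q , p) τ) (p , q)
    ... | no ¬q = xi.≺⇒≤ ¬q

    ι : X.Carrier → Element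
    ι x = record
      { index = xi.index x ; member = Below x ; closed = Below-closed
      ; lower = λ { p (inj₁ l) → via-⊤ (xi.≺⇒≤ (≼-≺-trans l p)) ; p (inj₂ l) → under (≼-≺-trans l p) }
      ; upper = λ
          { (via b p q) → Sum.map (_⊙ xi.index-mono q)
              (λ s → yi.index-mono p ⊙ proj₂ (agree b) ⊙ s ⊙ xi.index-mono q) (xi.index-∧ _ _)
          ; (under p) → inj₂ (≺⇒≼ p) }
      ; full = λ τ → Below-top (Trivial⇒top τ)
      }

    Below-∧ : ∀ {x y z} → Below x z → Below y z → Below (x X.∧ y) z
    Below-∧ (via b p q) (via c r s) = via (b A.∧ c) (Y.∧-greatest p r Y.⊙ g-∧)
      (X.∧-greatest (X.∧-mono X.≤-refl (f-mono A.x∧y≤x) X.⊙ q) (X.∧-mono X.≤-refl (f-mono A.x∧y≤y) X.⊙ s))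
    Below-∧ {x} {y} (under p) (under q) =
      under ([ (λ s → ≺-≼-trans p s) , (λ s → ≺-≼-trans q s) ]′ (xi.index-∧ x y))
    Below-∧ {x} {y} (via {y = w} b p q) (under r) with em {P = yi.index w ≺ xi.index x}
    ... | yes s = Below-∧ (under s) (under r)
    ... | no ¬s = via b p (X.∧-greatest q (q X.⊙ xi.≺⇒≤ (λ u → ¬s (≺-≼-trans r u))))
    Below-∧ {x} {y} (under r) (via {y = w} b p q) with em {P = yi.index w ≺ xi.index y}
    ... | yes s = Below-∧ (under r) (under s)
    ... | no ¬s = via b p (X.∧-greatest (q X.⊙ xi.≺⇒≤ (λ u → ¬s (≺-≼-trans r u))) q)

    Below-∨ : ∀ {x y z n} → ι x ≤ n → ι y ≤ n → Below (x X.∨ y) z → member n z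
    Below-∨ {n = n} (_ , p) (_ , q) (via b r s) = closed n (shiftʳ b X.≤-refl r Y.≤-refl) u u
      where u = closed n (∨ˡ s Y.≤-refl Y.≤-refl) (p (via-⊤ X.≤-refl)) (q (via-⊤ X.≤-refl))
    Below-∨ {x} {y} (_ , p) (_ , q) (under r) =
      [ (λ s → p (under (≺-≼-trans r s))) , (λ s → q (under (≺-≼-trans r s))) ]′ (xi.index-∨ x y)

    embedding : IndexedEmbedding xi indexedLattice
    embedding = record
      { ι = ι
      ; mono = λ p → xi.index-mono p , λ
          { (via b q r) → via b q (r X.⊙ p) ; (under q) → under (≺-≼-trans q (xi.index-mono p)) }
      ; cancel = λ (_ , p) → at-⊤ (p (via-⊤ X.≤-refl))
      ; index-ι = λ x → ≼-refl , ≼-refl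
      ; ι-∧ = λ {x} {y} (p , q) (p′ , q′) →
          [ p ⊙_ , p′ ⊙_ ]′ (xi.index-∧ x y) , λ u → Below-∧ (q u) (q′ u)
      ; ι-∨ = λ {x} {y} p@(p′ , _) q@(q′ , _) →
          [ _⊙ p′ , _⊙ q′ ]′ (xi.index-∨ x y) , Below-∨ p q
      ; ι-top = λ {x} {n} top p → p , λ {z} u → Below-top top (L-mono z p (upper n u))
      }
      where
      at-⊤ : ∀ {x x′} → Below x (x′ , bY.⊤) → x′ X.≤ x
      at-⊤ (via b p q) = X.∧-greatest X.≤-refl
        (bX.≤⊤ X.⊙ f-⊤ X.⊙ f-mono (g-cancel (bY.≤⊤ Y.⊙ p))) X.⊙ q
      at-⊤ (under p) = ⊥-elim (p ≼⊤ʸ)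

    -- If `x ≤ y`, the implication is the greatest element and `ι-top` applies. Otherwise n has at
    -- most the class of y, as in `⊃-intro`, and an interpolant for `(x′ ∧ x , y′)` below y is one
    -- for `(x′ , y′)` below the implication.
    ι-⇒ : ∀ {x y n} → (∀ m → m ≤ n → m ≤ ι x → m ≤ ι y) → n ≤ ι (x bX.⇒ y)
    ι-⇒ {x} {y} {n} h with em {P = x X.≤ y}
    ... | yes p = IndexedEmbedding.ι-top embedding (λ _ _ → bX.≤⊤ X.⊙ ⊤≤) (≼⊤ˣ ⊙ xi.index-mono ⊤≤)
      where
      ⊤≤ : bX.⊤ X.≤ x bX.⇒ y
      ⊤≤ = bX.⇒-intro (X.x∧y≤x X.⊙ p)
    ... | no ¬p = n≼y ⊙ xi.index-mono (bX.⇒-intro X.x∧y≤y) , λ u →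
          residual (member⊆ n∧ιx≤ιy
            (closed n (∨ˡ (X.x∧y≤x X.⊙ X.x≤x∨y) Y.≤-refl Y.≤-refl) u u , via-⊤ X.x∧y≤y))
      where
      n∧ιx≤ιy : n ∧ ι x ≤ ι y
      n∧ιx≤ιy = h (n ∧ ι x) (proj₁ (min≼ (index n) (xi.index x)) , proj₁)
                            (proj₂ (min≼ (index n) (xi.index x)) , proj₂)
      n≼y : index n ≼ xi.index y
      n≼y with em {P = index n ≼ xi.index y} | em {P = xi.index x ≼ xi.index y}
      ... | yes q | _ = q
      ... | no q | yes r = ⊥-elim (¬p (IndexedEmbedding.cancel embedding
              (h (ι x) (≺⇒≤ {ι x} {n} (≼-≺-trans r q)) ≤-refl)))
      ... | no q | no r = ⊥-elim
              (min-sel (index n) (xi.index x) {λ m → ¬ m ≼ xi.index y} q r (index≼ n∧ιx≤ιy))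
      residual : ∀ {x′ y′} → Below y (x′ X.∧ x , y′) → Below (x bX.⇒ y) (x′ , y′)
      residual (via b q r) = via b q (bX.⇒-intro
        (X.∧-greatest (X.∧-greatest (X.x∧y≤y X.⊙ X.x∧y≤x) X.x∧y≤x) (X.x∧y≤y X.⊙ X.x∧y≤y) X.⊙ r))
      residual (under q) = under (≺-≼-trans q (xi.index-mono (bX.⇒-intro X.x∧y≤y)))

  record NegativeAmalgam {t r a o} {K : Chain t (a ⊔ o)} {Trivial : Pred (Chain.Carrier K) r}
                         (S : NegativeSpan K Trivial a o) : Set (suc (t ⊔ suc (a ⊔ o) ⊔ r)) where
    open Chain K using (_≼_; _∼_)
    open NegativeSpan S using (span; module bX; module bY)
    field
      N : IndexedLattice K Trivial (t ⊔ suc (a ⊔ o) ⊔ r) (a ⊔ o)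
    open IndexedLattice N
    field
      top : Chain.Carrier K → Carrier
      index-top : ∀ s → index (top s) ∼ s
      ≤top : ∀ {x s} → index x ≼ s → x ≤ top s
      _⊃_ : Op₂ Carrier
      ⊃-intro : ∀ {x y z} → ¬ x ≤ y → x ∧ z ≤ y → z ≤ x ⊃ y
      ⊃-elim : ∀ {x y} → x ∧ (x ⊃ y) ≤ y
      amalgam : IndexedAmalgam span N
    open IndexedAmalgam amalgam using (module x; module y)
    field
      x-⇒ : ∀ {x y n} → (∀ m → m ≤ n → m ≤ x.ι x → m ≤ x.ι y) → n ≤ x.ι (x bX.⇒ y)
      y-⇒ : ∀ {x y n} → (∀ m → m ≤ n → m ≤ y.ι x → m ≤ y.ι y) → n ≤ y.ι (x bY.⇒ y)

  module _ {t r a o} {K : Chain t (a ⊔ o)} {Trivial : Pred (Chain.Carrier K) r}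
           (S : NegativeSpan K Trivial a o) where
    open NegativeSpan S
    private
      module O = Negative (oppositeNegative S)
      open Negative S hiding (Z)

      rule⇒ : ∀ {z₁ z₂ z} → z₁ , z₂ ⊢ z → O._,_⊢_ (swap z₁) (swap z₂) (swap z)
      rule⇒ (∨ˡ p q r) = O.∨ʳ q r p
      rule⇒ (∨ʳ p q r) = O.∨ˡ r p q
      rule⇒ (shiftʳ b p q r) = O.shiftˡ b q r p
      rule⇒ (shiftˡ b p q r) = O.shiftʳ b r p q

      rule⇐ : ∀ {z₁ z₂ z} → O._,_⊢_ z₁ z₂ z → swap z₁ , swap z₂ ⊢ swap z
      rule⇐ (O.∨ˡ p q r) = ∨ʳ q r p
      rule⇐ (O.∨ʳ p q r) = ∨ˡ r p q
      rule⇐ (O.shiftʳ b p q r) = shiftˡ b q r p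
      rule⇐ (O.shiftˡ b p q r) = shiftʳ b r p q

      φ : O.Element → Element
      φ m = record
        { index = O.index m ; member = O.member m ∘ swap
        ; closed = λ s → O.closed m (rule⇒ s)
        ; lower = λ p l → O.lower m p (Sum.swap l)
        ; upper = λ u → Sum.swap (O.upper m u)
        ; full = λ τ l → O.full m τ (Sum.swap l) }

      ψ : Element → O.Element
      ψ n = record
        { index = index n ; member = member n ∘ swap
        ; closed = λ s → closed n (rule⇐ s)
        ; lower = λ p l → lower n p (Sum.swap l)
        ; upper = λ u → Sum.swap (upper n u)
        ; full = λ τ l → full n τ (Sum.swap l) }

      iso : IndexedIso O.indexedLattice indexedLattice
      iso = record
        { φ = φ ; ψ = ψ
        ; φ-mono = λ (p O., f) → p , f
        ; ψ-mono = λ (p , f) → p O., f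
        ; φψ≤ = ≼-refl , id ; ≤φψ = ≼-refl , id
        ; ψφ≤ = ≼-refl O., id ; ≤ψφ = ≼-refl O., id
        ; index-φ = ≼-refl , ≼-refl ; index-ψ = ≼-refl , ≼-refl }

    private
      amalgam : IndexedAmalgam span indexedLattice
      amalgam = record
        { x-emb = embedding
        ; y-emb = transport iso O.embedding
        ; commutes = λ b → (proj₁ (agree b) , to-O) , (proj₂ (agree b) , from-O)
        ; strong = λ (p , u) (q , v) → strong p q (u (via-⊤ X.≤-refl)) (v (O.via-⊤ Y.≤-refl))
        }
        where
        -- The interpolant c becomes `c ⇒ b`: from `x′ ∧ f c ≤ f b` follows `x′ ≤ f (c ⇒ b)`, and
        -- from `y ≤ g c` follows `y ∧ g (c ⇒ b) ≤ g b`.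
        to-O : ∀ {b z} → Below (f b) z → O.Below (g b) (swap z)
        to-O (via c p q) = O.via (c bA.⇒ _) (bX.⇒-intro (X.∧-greatest X.x∧y≤y X.x∧y≤x X.⊙ q) X.⊙ f-⇒)
          (Y.∧-greatest (Y.x∧y≤x Y.⊙ p) Y.x∧y≤y Y.⊙ g-∧ Y.⊙ g-mono bA.⇒-elim)
        to-O (under p) = O.via-⊤ (yi.≺⇒≤ (≺-≼-trans p (proj₁ (agree _))))

        from-O : ∀ {b z} → O.Below (g b) (swap z) → Below (f b) z
        from-O (O.via c p q) = via (c bA.⇒ _) (bY.⇒-intro (Y.∧-greatest Y.x∧y≤y Y.x∧y≤x Y.⊙ q) Y.⊙ g-⇒)
          (X.∧-greatest (X.x∧y≤x X.⊙ p) X.x∧y≤y X.⊙ f-∧ X.⊙ f-mono bA.⇒-elim)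
        from-O (O.under p) = via-⊤ (xi.≺⇒≤ (≺-≼-trans p (proj₂ (agree _))))

        strong : ∀ {x y} → xi.index x ≼ yi.index y → yi.index y ≼ xi.index x →
                 O.Below y (bY.⊤ , x) → Below x (bX.⊤ , y) → ∃ λ b → f b X.≤ x × x X.≤ f b
        strong p q (O.via b r s) (via c u v) = b , f-mono (g-cancel gb≤gc) X.⊙ fc≤x , r
          where
          gb≤gc = Y.∧-greatest (g-mono bA.≤⊤ Y.⊙ bY.≤⊤) Y.≤-refl Y.⊙ s Y.⊙ u
          fc≤x = X.∧-greatest (f-mono bA.≤⊤ X.⊙ bX.≤⊤) X.≤-refl X.⊙ v
        strong p q (O.under n) _ = ⊥-elim (n q)
        strong p q _ (under n) = ⊥-elim (n p)

      open IndexedAmalgam amalgam using (module N; module x; module y)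
      open IndexedIso iso using (φ-mono; ψ-mono; φψ≤; ≤φψ; ψφ≤; ≤ψφ)
      module M = IndexedLattice O.indexedLattice

      y-⇒ : ∀ {x y n} → (∀ m → m N.≤ n → m N.≤ y.ι x → m N.≤ y.ι y) → n N.≤ y.ι (x bY.⇒ y)
      y-⇒ {n = n} h = ≤φψ N.⊙ φ-mono (O.ι-⇒ {n = ψ n} λ m p q →
        ≤ψφ {m} M.⊙ ψ-mono (h (φ m) (φ-mono p N.⊙ φψ≤) (φ-mono q)) M.⊙ ψφ≤)

    abstract
      negativeAmalgam : NegativeAmalgam S
      negativeAmalgam = record
        { N = indexedLattice ; top = top ; index-top = λ s → ≼-refl , ≼-refl ; ≤top = ≤top
        ; _⊃_ = _⊃_
        ; ⊃-intro = λ {x} {y} {z} → ⊃-intro {x} {y} {z}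
        ; ⊃-elim = λ {x} {y} → ⊃-elim {x} {y}
        ; amalgam = amalgam
        ; x-⇒ = ι-⇒ ; y-⇒ = y-⇒
        }

  -- Amalgamation of frames

  module _ {a q} (F : Frame a q) where
    open Frame F
    private
      module T = FrameTheory F
      module M = FrameTheory (mirror F)

    -- The chains of F and of its mirror image agree up to the proof of totality.
    labellingˡ : Labelling T.chain q
    labellingˡ = record
      { labels = record
        { Lab = M.Labʳ ; pred = M.predʳ ; Lab-resp = Labelling.Lab-resp M.labelling
        ; pred≺ = M.pred-≺ ; ≺⇒≼pred = M.≺⇒≼predʳ }
      ; succ = M.succʳ
      ; pred-mono = λ {x} {y} → Labelling.pred-mono M.labelling {x} {y}
      ; succ-mono = λ {x} {y} → Labelling.succ-mono M.labelling {x} {y}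
      ; succ-pred = M.succ-predʳ }

    negative : LatticeOrder (a ⊔ q) q
    negative = record
      { Carrier = Σ[ x ∈ Carrier ] x ≤ ε
      ; _≤_ = λ x y → proj₁ x ≤ proj₁ y
      ; _∧_ = λ x y → proj₁ x ∧ proj₁ y , x∧y≤x ⊙ proj₂ x
      ; _∨_ = λ x y → proj₁ x ∨ proj₁ y , ∨-least (proj₂ x) (proj₂ y)
      ; ≤-refl = ≤-refl ; ≤-trans = ≤-trans
      ; x∧y≤x = x∧y≤x ; x∧y≤y = x∧y≤y ; ∧-greatest = ∧-greatest
      ; x≤x∨y = x≤x∨y ; y≤x∨y = y≤x∨y ; ∨-least = ∨-least }

    -- The complement of the negative part, so that ε is counted once. Closure under meets is the
    -- primeness of the negative part.
    positive : LatticeOrder (a ⊔ q) q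
    positive = record
      { Carrier = Σ[ x ∈ Carrier ] ¬ x ≤ ε
      ; _≤_ = λ x y → proj₁ x ≤ proj₁ y
      ; _∧_ = λ x y → proj₁ x ∧ proj₁ y , λ p → [ proj₂ x , proj₂ y ]′ (T.∧-≤ε-prime p)
      ; _∨_ = λ x y → proj₁ x ∨ proj₁ y , λ p → proj₂ x (x≤x∨y ⊙ p)
      ; ≤-refl = ≤-refl ; ≤-trans = ≤-trans
      ; x∧y≤x = x∧y≤x ; x∧y≤y = x∧y≤y ; ∧-greatest = ∧-greatest
      ; x≤x∨y = x≤x∨y ; y≤x∨y = y≤x∨y ; ∨-least = ∨-least }

    negative-isBrouwerian : IsBrouwerian negative
    negative-isBrouwerian = record
      { ⊤ = ε , ≤-refl ; ≤⊤ = λ {x} → proj₂ x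
      ; _⇒_ = λ x y → proj₁ x ⇒ proj₁ y , ⇒-≤ε
      ; ⇒-intro = λ {x} {y} {z} p → ⇒-intro (proj₂ z) p
      ; ⇒-elim = ⇒-elim }

  record LabelPart {a q t p} {K : Chain a q} {K′ : Chain t p} (M : Labelling K q)
                   (M′ : Labels K′ p) (i : Chain.Carrier K → Chain.Carrier K′) : Set (a ⊔ q ⊔ t ⊔ p) where
    open Chain K′ using (_∼_)
    field
      Lab⁻¹ : ∀ {x} → Labels.Lab M′ (i x) → Labelling.Lab M x
      Q⇒ : ∀ {x y} → Labelling.Q M x y → Labels.Q M′ (i x) (i y)
      Q⇐ : ∀ {x y} → Labels.Q M′ (i x) (i y) → Labelling.Q M x y
      IsPred⁻¹ : ∀ {x s} → Labels.IsPred M′ (i x) s → ∃ λ y → i y ∼ s × Labelling.IsPred M x y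

  record FramePart {a q t p} (F : Frame a q) (K : Chain t p) (labels₁ labels₂ : Labels K p)
                   (⊤ : Chain.Carrier K) : Set (a ⊔ q ⊔ t ⊔ p) where
    open Frame F using (Carrier; ε)
    open Chain K using (_≼_; _∼_)
    open Chain (FrameTheory.chain F) using () renaming (_≼_ to _≼ꟳ_)
    field
      i : Carrier → Chain.Carrier K
      i-mono : ∀ {x y} → x ≼ꟳ y → i x ≼ i y
      i-cancel : ∀ {x y} → i x ≼ i y → x ≼ꟳ y
      ⊤∼ε : ⊤ ∼ i ε
      part₁ : LabelPart (FrameTheory.labelling F) labels₁ i
      part₂ : LabelPart (labellingˡ F) labels₂ i

  mirrorPart : ∀ {a q t p} {F : Frame a q} {K : Chain t p} {labels₁ labels₂ : Labels K p} {⊤} →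
               FramePart F K labels₁ labels₂ ⊤ → FramePart (mirror F) K labels₂ labels₁ ⊤
  mirrorPart P = record
    { i = i ; i-mono = i-mono ; i-cancel = i-cancel ; ⊤∼ε = ⊤∼ε
    ; part₁ = record { Lab⁻¹ = L₂.Lab⁻¹ ; Q⇒ = L₂.Q⇒ ; Q⇐ = L₂.Q⇐ ; IsPred⁻¹ = L₂.IsPred⁻¹ }
    ; part₂ = record { Lab⁻¹ = L₁.Lab⁻¹ ; Q⇒ = L₁.Q⇒ ; Q⇐ = L₁.Q⇐ ; IsPred⁻¹ = L₁.IsPred⁻¹ } }
    where
    open FramePart P
    module L₁ = LabelPart part₁
    module L₂ = LabelPart part₂

  module FramePartSide {a q t p} {F : Frame a q} {K : Chain t p} {labels₁ labels₂ : Labels K p}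
                       {⊤ : Chain.Carrier K} (P : FramePart F K labels₁ labels₂ ⊤) where
    open Frame F
    open Chain K using (_≼_; _≺_; _∼_) renaming (_⊙_ to _■_)
    open FramePart P
    open Labels labels₁ using () renaming (Lab to Lab₁; Q to Q₁; IsPred to IsPred₁)
    open Labels labels₂ using () renaming (Lab to Lab₂; Q to Q₂; IsPred to IsPred₂)
    private
      module T = FrameTheory F
      module M = FrameTheory (mirror F)
      module L₁ = LabelPart part₁
      module L₂ = LabelPart part₂

    i-ʳ : ∀ {x s} → x ≤ ε → Q₁ (i x) s → i (x ʳ) ≼ s
    i-ʳ p (inj₁ q) = i-mono (T.ʳ≼ p) ■ q
    i-ʳ p (inj₂ (l , f)) = i-mono (T.ʳ≼pred p) ■ f _ (λ r → T.pred-≺ (L₁.Lab⁻¹ l) (i-cancel r))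

    -- A class s related to `i x` by its label alone is a labelled successor of `i x`. `IsPred⁻¹`
    -- then finds it in F itself, where `x R ν y` bounds it by the class of `x ʳ`.
    ≼i-ʳ : ∀ {x s} → ε ≤ x → Q₂ s (i x) → s ≼ i (x ʳ)
    ≼i-ʳ p (inj₁ q) = q ■ i-mono (T.≼ʳ p)
    ≼i-ʳ {x} {s} p (inj₂ (l , f)) with em {P = s ≼ i x}
    ... | yes q = q ■ i-mono (T.≼ʳ p)
    ... | no ¬q with L₂.IsPred⁻¹ (l , ¬q , f)
    ...   | y , (_ , r) , l′ , _ , g = r ■ i-mono (proj₂ T.ν-∼ ⊙ T.≤⇒≼ (T.ε≤⇒ʳ≤ε p) (R⇒≤ʳ νy-R))
      where
      νy-R : x R T.ν y
      νy-R = M.Q⇒R T.ν≤ε (inj₂ (Labelling.Lab-resp M.labelling (proj₂ T.ν-∼ , proj₁ T.ν-∼) l′ ,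
                                λ z r → g z (λ s → r (proj₁ T.ν-∼ ⊙ s))))

    NegTrivial : Chain.Carrier K → Set p
    NegTrivial s = Lab₁ s ⊎ Lab₂ s

    PosTrivial : Pred (Chain.Carrier (below K ⊤)) (t ⊔ p)
    PosTrivial s = ∃ (IsPred₁ (proj₁ s)) ⊎ ∃ (IsPred₂ (proj₁ s))

    negIndexing : Indexing K NegTrivial (negative F)
    negIndexing = record
      { index = λ x → i (proj₁ x)
      ; index-mono = λ {x} {y} p → i-mono (T.≤⇒≼ (proj₂ y) p)
      ; ≺⇒≤ = λ {x} p → T.≺⇒≤ (proj₂ x) (λ q → p (i-mono q))
      ; index-∧ = λ (x , p) (y , q) → Sum.map i-mono i-mono (T.index-∧ p q)
      ; index-∨ = λ (x , p) (y , q) → Sum.map i-mono i-mono (T.index-∨ p q)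
      ; trivial = λ
          { {x , p} {y , q} (inj₁ l) (r , s) → T.labelled-trivial p q (L₁.Lab⁻¹ l) (i-cancel r , i-cancel s)
          ; {x , p} {y , q} (inj₂ l) (r , s) → M.labelled-trivial p q (L₂.Lab⁻¹ l) (i-cancel r , i-cancel s) }
      }

    posIndexing : Indexing (below K ⊤) PosTrivial (positive F)
    posIndexing = record
      { index = λ (x , n) → i x , λ p → T.≰ε⇒≺ε n (i-cancel (proj₂ ⊤∼ε ■ p))
      ; index-mono = λ {x} {y} p → i-mono (T.≥⇒≼ (T.≰ε⇒ε≤ (proj₂ x)) p)
      ; ≺⇒≤ = λ {x} {y} p → T.≺⇒≥ (T.≰ε⇒ε≤ (proj₂ y)) (λ q → p (i-mono q))
      ; index-∧ = λ (x , p) (y , q) → Sum.map i-mono i-mono (T.index-∧⁺ (T.≰ε⇒ε≤ p) (T.≰ε⇒ε≤ q))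
      ; index-∨ = λ (x , p) (y , q) → Sum.map i-mono i-mono (T.index-∨⁺ (T.≰ε⇒ε≤ p) (T.≰ε⇒ε≤ q))
      ; trivial = λ {x} {y} → trivial {x} {y}
      }
      where
      trivial : ∀ {x y : LatticeOrder.Carrier (positive F)} →
                ∃ (IsPred₁ (i (proj₁ x))) ⊎ ∃ (IsPred₂ (i (proj₁ x))) →
                i (proj₁ y) ≼ i (proj₁ x) × i (proj₁ x) ≼ i (proj₁ y) → proj₁ x ≤ proj₁ y
      trivial {x , p} {y , q} (inj₁ (s , π)) (r , r′) with L₁.IsPred⁻¹ π
      ... | z , _ , l , x≺z , f = T.pred-trivial (T.≰ε⇒ε≤ p) (T.≰ε⇒ε≤ q) l (f _ (T.pred-≺ l))
              (f _ (T.pred-≺ l) ⊙ i-cancel r′ , i-cancel r ⊙ T.≺⇒≼predʳ l x≺z)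
      trivial {x , p} {y , q} (inj₂ (s , π)) (r , r′) with L₂.IsPred⁻¹ π
      ... | z , _ , l , x≺z , f = M.pred-trivial (T.≰ε⇒ε≤ p) (T.≰ε⇒ε≤ q) l (f _ (M.pred-≺ l))
              (f _ (M.pred-≺ l) ⊙ i-cancel r′ , i-cancel r ⊙ M.≺⇒≼predʳ l x≺z)

  -- Embeddings of frames into ordinal sums

  record IsFrameEmbedding {a q b o} (F : Frame a q) (G : Frame b o)
                          (h : Frame.Carrier F → Frame.Carrier G) : Set (a ⊔ q ⊔ b ⊔ o) where
    private
      module F = Frame F
      module G = Frame G
    field
      mono : ∀ {x y} → x F.≤ y → h x G.≤ h y
      cancel : ∀ {x y} → h x G.≤ h y → x F.≤ y
      h-∧ : ∀ x y → h x G.∧ h y G.≤ h (x F.∧ y)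
      h-∨ : ∀ x y → h (x F.∨ y) G.≤ h x G.∨ h y
      h-ε≤ : h F.ε G.≤ G.ε
      ε≤h : G.ε G.≤ h F.ε
      R⇒ : ∀ {x y} → x F.R y → h x G.R h y
      R⇐ : ∀ {x y} → h x G.R h y → x F.R y
      h-ʳ : ∀ x → h x G.ʳ G.≤ h (x F.ʳ)
      h-ˡ : ∀ x → h x G.ˡ G.≤ h (x F.ˡ)
      h-⇒ : ∀ x y → h x G.⇒ h y G.≤ h (x F.⇒ y)

    ≤ε⇒ : ∀ {x} → x F.≤ F.ε → h x G.≤ G.ε
    ≤ε⇒ p = mono p G.⊙ h-ε≤

    ≤ε⇐ : ∀ {x} → h x G.≤ G.ε → x F.≤ F.ε
    ≤ε⇐ p = cancel (p G.⊙ ε≤h)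

  record PartEmbedding {c ℓ t p a} (F : Frame c ℓ) (S : SumData a t p) : Set (c ⊔ ℓ ⊔ a ⊔ t ⊔ p) where
    open SumData S
    field
      part : FramePart F K labels₁ labels₂ ⊤
      neg : IndexedEmbedding (FramePartSide.negIndexing part) N
      pos : IndexedEmbedding (FramePartSide.posIndexing part) P
    module neg = IndexedEmbedding neg
    module pos = IndexedEmbedding pos
    field
      neg-⇒ : ∀ {x y n} → (∀ m → m N.≤ n → m N.≤ neg.ι x → m N.≤ neg.ι y) →
              n N.≤ neg.ι (IsBrouwerian._⇒_ (negative-isBrouwerian F) x y)

  module GluedEmbedding {c ℓ t p a} {F : Frame c ℓ} {S : SumData a t p} (E : PartEmbedding F S) where
    open SumData S
    open PartEmbedding E
    private
      module T = FrameTheory F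
      module M = FrameTheory (mirror F)
      module L₁ = LabelPart (FramePart.part₁ part)
      module L₂ = LabelPart (FramePart.part₂ part)
      module Sᴿ = FramePartSide part
      module Sᴸ = FramePartSide (mirrorPart part)
      module RS = SumSide S
      G = SumFrame.sumFrame S
    module F = Frame F
    module G = Frame G
    open F using (ε)
    open FramePart part
    open OrdinalSum N.lattice P.lattice using (nn; np; pp)
    open RS using (nn; np; pn)
    open SumOrder S using (n≤ε)
    open Chain K using (≼-refl) renaming (_⊙_ to _■_)

    by-sign : ∀ {x} → Dec (x F.≤ ε) → G.Carrier
    by-sign {x} (yes p) = inj₁ (neg.ι (x , p))
    by-sign {x} (no ¬p) = inj₂ (pos.ι (x , ¬p))

    h : F.Carrier → G.Carrier
    h x = by-sign (em {P = x F.≤ ε})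

    h⁻≤ : ∀ {x} (p : x F.≤ ε) → h x G.≤ inj₁ (neg.ι (x , p))
    h⁻≤ {x} p with em {P = x F.≤ ε}
    ... | yes _ = nn (neg.mono F.≤-refl)
    ... | no n = ⊥-elim (n p)

    ≤h⁻ : ∀ {x} (p : x F.≤ ε) → inj₁ (neg.ι (x , p)) G.≤ h x
    ≤h⁻ {x} p with em {P = x F.≤ ε}
    ... | yes _ = nn (neg.mono F.≤-refl)
    ... | no n = ⊥-elim (n p)

    h⁺≤ : ∀ {x} (p : ¬ x F.≤ ε) → h x G.≤ inj₂ (pos.ι (x , p))
    h⁺≤ {x} p with em {P = x F.≤ ε}
    ... | no _ = pp (pos.mono F.≤-refl)
    ... | yes n = ⊥-elim (p n)

    ≤h⁺ : ∀ {x} (p : ¬ x F.≤ ε) → inj₂ (pos.ι (x , p)) G.≤ h x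
    ≤h⁺ {x} p with em {P = x F.≤ ε}
    ... | no _ = pp (pos.mono F.≤-refl)
    ... | yes n = ⊥-elim (p n)

    mono : ∀ {x y} → x F.≤ y → h x G.≤ h y
    mono {x} {y} r with em {P = x F.≤ ε} | em {P = y F.≤ ε}
    ... | yes _ | yes _ = nn (neg.mono r)
    ... | yes _ | no _ = np
    ... | no p | yes q = ⊥-elim (p (r F.⊙ q))
    ... | no _ | no _ = pp (pos.mono r)

    cancel : ∀ {x y} → h x G.≤ h y → x F.≤ y
    cancel {x} {y} r with em {P = x F.≤ ε} | em {P = y F.≤ ε} | r
    ... | yes _ | yes _ | nn s = neg.cancel s
    ... | yes p | no q | _ = p F.⊙ T.≰ε⇒ε≤ q
    ... | no _ | yes _ | ()
    ... | no _ | no _ | pp s = pos.cancel s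

    h-∧ : ∀ x y → h x G.∧ h y G.≤ h (x F.∧ y)
    h-∧ x y with em {P = x F.≤ ε} | em {P = y F.≤ ε}
    ... | yes p | yes q = nn (neg.ι-∧ N.x∧y≤x N.x∧y≤y) G.⊙ ≤h⁻ _
    ... | yes p | no q = ≤h⁻ p G.⊙ mono (F.∧-greatest F.≤-refl (p F.⊙ T.≰ε⇒ε≤ q))
    ... | no p | yes q = ≤h⁻ q G.⊙ mono (F.∧-greatest (q F.⊙ T.≰ε⇒ε≤ p) F.≤-refl)
    ... | no p | no q = pp (pos.ι-∧ P.x∧y≤x P.x∧y≤y) G.⊙ ≤h⁺ _

    h-∨ : ∀ x y → h (x F.∨ y) G.≤ h x G.∨ h y
    h-∨ x y with em {P = x F.≤ ε} | em {P = y F.≤ ε}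
    ... | yes p | yes q = h⁻≤ (F.∨-least p q) G.⊙ nn (neg.ι-∨ N.x≤x∨y N.y≤x∨y)
    ... | yes p | no q = mono (F.∨-least (p F.⊙ T.≰ε⇒ε≤ q) F.≤-refl) G.⊙ h⁺≤ q
    ... | no p | yes q = mono (F.∨-least F.≤-refl (q F.⊙ T.≰ε⇒ε≤ p)) G.⊙ h⁺≤ p
    ... | no p | no q = h⁺≤ (λ r → p (F.x≤x∨y F.⊙ r)) G.⊙ pp (pos.ι-∨ P.x≤x∨y P.y≤x∨y)

    ε≤h : G.ε G.≤ h ε
    ε≤h = nn (neg.ι-top (λ y _ → proj₂ y) (proj₁ (index-topᴺ ⊤) ■ proj₁ ⊤∼ε)) G.⊙ ≤h⁻ F.≤-refl

    R⇒ : ∀ {x y} → x F.R y → h x G.R h y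
    R⇒ {x} {y} r with em {P = x F.≤ ε} | em {P = y F.≤ ε}
    ... | yes _ | yes _ = nn
    ... | yes p | no q = np (Q-mono K labels₁ (proj₁ (neg.index-ι _)) (proj₁ (pos.index-ι _))
                              (L₁.Q⇒ (T.R⇒Q p (T.≰ε⇒ε≤ q) r)))
    ... | no p | yes q = pn (Q-mono K labels₂ (proj₁ (neg.index-ι _)) (proj₁ (pos.index-ι _))
                              (L₂.Q⇒ (M.R⇒Q q (T.≰ε⇒ε≤ p) r)))
    ... | no p | no q = ⊥-elim (T.≰ε-¬R p q r)

    R⇐ : ∀ {x y} → h x G.R h y → x F.R y
    R⇐ {x} {y} r with em {P = x F.≤ ε} | em {P = y F.≤ ε} | r
    ... | yes p | yes q | _ = T.≤ε-R p q
    ... | yes p | no q | np s = T.Q⇒R p (L₁.Q⇐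
            (Q-mono K labels₁ (proj₂ (neg.index-ι _)) (proj₂ (pos.index-ι _)) s))
    ... | no p | yes q | pn s = M.Q⇒R q (L₂.Q⇐
            (Q-mono K labels₂ (proj₂ (neg.index-ι _)) (proj₂ (pos.index-ι _)) s))
    ... | no _ | no _ | ()

    -- A closed negative w is greatest up to its class, so `ι-top` keeps `h w` above the new
    -- elements too; a positive one is above every negative element anyway. Residuals are closed,
    -- hence preserved by this lemma and its positive counterpart.
    closed-≥⁻ : ∀ {w n} → w F.⋆ F.⋆ F.≤ w → N.index n ≼ i w → inj₁ n G.≤ h w
    closed-≥⁻ {w} c r with em {P = w F.≤ ε}
    ... | yes p = nn (neg.ι-top (λ (y , q) s → T.≼⇒≤⋆⋆ q (i-cancel s) F.⊙ c) r)
    ... | no _ = np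

    closed-≥⁺ : ∀ {w v} → w F.⋆ F.⋆ F.≤ w → ε F.≤ w → i w ≼ indexᴾ v → inj₂ v G.≤ h w
    closed-≥⁺ {w} {v} c p r with em {P = w F.≤ ε}
    ... | yes q = ⊥-elim (proj₂ (P.index v) (proj₁ ⊤∼ε ■ i-mono (T.≤⇒≼ q p) ■ r))
    ... | no n = pp (pos.ι-top (λ (y , q) s → T.≼⇒⋆⋆≥ p (i-cancel s) F.⊙ c) r)

    h-ʳ : ∀ x → h x G.ʳ G.≤ h (x F.ʳ)
    h-ʳ x = bound (h x G.ʳ) (G.≤ʳ⇒R G.≤-refl)
      where
      bound : ∀ y → h x G.R y → y G.≤ h (x F.ʳ)
      bound y r with em {P = x F.≤ ε} | y | r
      ... | yes p | inj₁ n | _ = n≤ε G.⊙ ε≤h G.⊙ mono (T.≤ε⇒ε≤ʳ p)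
      ... | yes p | inj₂ v | np s = closed-≥⁺ F.ʳ-closed (T.≤ε⇒ε≤ʳ p)
              (Sᴿ.i-ʳ p (Q-mono K labels₁ (proj₂ (neg.index-ι _)) ≼-refl s))
      ... | no p | inj₁ n | pn s = closed-≥⁻ F.ʳ-closed
              (Sᴿ.≼i-ʳ (T.≰ε⇒ε≤ p) (Q-mono K labels₂ ≼-refl (proj₂ (pos.index-ι _)) s))
      ... | no _ | inj₂ _ | ()

    h-ˡ : ∀ x → h x G.ˡ G.≤ h (x F.ˡ)
    h-ˡ x = bound (h x G.ˡ) (G.≤ˡ⇒R G.≤-refl)
      where
      bound : ∀ y → y G.R h x → y G.≤ h (x F.ˡ)
      bound y r with em {P = x F.≤ ε} | y | r
      ... | yes p | inj₁ n | _ = n≤ε G.⊙ ε≤h G.⊙ mono (M.≤ε⇒ε≤ʳ p)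
      ... | yes p | inj₂ v | pn s = closed-≥⁺ F.ˡ-closed (M.≤ε⇒ε≤ʳ p)
              (Sᴸ.i-ʳ p (Q-mono K labels₂ (proj₂ (neg.index-ι _)) ≼-refl s))
      ... | no p | inj₁ n | np s = closed-≥⁻ F.ˡ-closed
              (Sᴸ.≼i-ʳ (T.≰ε⇒ε≤ p) (Q-mono K labels₁ ≼-refl (proj₂ (pos.index-ι _)) s))
      ... | no _ | inj₂ _ | ()

    h-⇒ : ∀ x y → h x G.⇒ h y G.≤ h (x F.⇒ y)
    h-⇒ x y = bound (h x G.⇒ h y) (G.⇒-≤ε {h x} {h y}) (G.⇒-elim {h x} {h y})
      where
      -- Every z with the defining property of the implication is bounded, which spares matching on
      -- how the implication of the sum was computed.
      bound : ∀ z → z G.≤ G.ε → h x G.∧ z G.≤ h y → z G.≤ h (x F.⇒ y)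
      bound (inj₁ n) z≤ε@(nn _) r with em {P = x F.≤ ε} | em {P = y F.≤ ε} | r
      ... | yes p | yes q | nn s = nn (neg-⇒ λ m u v → N.∧-greatest v u N.⊙ s) G.⊙ ≤h⁻ _
      ... | _ | no q | _ = z≤ε G.⊙ ε≤h G.⊙ mono (F.⇒-intro F.≤-refl (F.x∧y≤y F.⊙ T.≰ε⇒ε≤ q))
      ... | no p | yes q | s = s G.⊙ ≤h⁻ q G.⊙ mono (F.⇒-intro q F.x∧y≤y)

    isFrameEmbedding : IsFrameEmbedding F G h
    isFrameEmbedding = record
      { mono = mono ; cancel = cancel ; h-∧ = h-∧ ; h-∨ = h-∨
      ; h-ε≤ = h⁻≤ F.≤-refl G.⊙ n≤ε ; ε≤h = ε≤h ; R⇒ = R⇒ ; R⇐ = R⇐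
      ; h-ʳ = h-ʳ ; h-ˡ = h-ˡ ; h-⇒ = h-⇒ }

  module GluedPair {c ℓ t p a} {FX FY : Frame c ℓ} {S : SumData a t p}
                   (EX : PartEmbedding FX S) (EY : PartEmbedding FY S) where
    open SumData S
    open PartEmbedding EX using () renaming (module neg to negX; module pos to posX)
    open PartEmbedding EY using () renaming (module neg to negY; module pos to posY)
    private
      module X = Frame FX
      module Y = Frame FY
      module D = Frame (SumFrame.sumFrame S)
    module GX = GluedEmbedding EX
    module GY = GluedEmbedding EY
    open OrdinalSum N.lattice P.lattice using (nn; pp)

    -- `Q` will be `a ≤ ε` in A. Deciding it once selects the same sign for the images of a in both
    -- frames.
    commutes : ∀ {q} {Q : Set q} {x y}
      (x⇒ : Q → x X.≤ X.ε) (x⇐ : x X.≤ X.ε → Q) (y⇒ : Q → y Y.≤ Y.ε) (y⇐ : y Y.≤ Y.ε → Q) →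
      (∀ p → negX.ι (x , x⇒ p) N.≤ negY.ι (y , y⇒ p) × negY.ι (y , y⇒ p) N.≤ negX.ι (x , x⇒ p)) →
      (∀ n → posX.ι (x , n ∘ x⇐) P.≤ posY.ι (y , n ∘ y⇐) × posY.ι (y , n ∘ y⇐) P.≤ posX.ι (x , n ∘ x⇐)) →
      GX.h x D.≤ GY.h y × GY.h y D.≤ GX.h x
    commutes {Q = Q} x⇒ x⇐ y⇒ y⇐ f g with em {P = Q}
    ... | yes p =
      (GX.h⁻≤ (x⇒ p) D.⊙ nn (proj₁ (f p)) D.⊙ GY.≤h⁻ (y⇒ p)) ,
      (GY.h⁻≤ (y⇒ p) D.⊙ nn (proj₂ (f p)) D.⊙ GX.≤h⁻ (x⇒ p))
    ... | no n =
      (GX.h⁺≤ (n ∘ x⇐) D.⊙ pp (proj₁ (g n)) D.⊙ GY.≤h⁺ (n ∘ y⇐)) ,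
      (GY.h⁺≤ (n ∘ y⇐) D.⊙ pp (proj₂ (g n)) D.⊙ GX.≤h⁺ (n ∘ x⇐))

    strong : ∀ {r} {R : Set r} {x y} →
      (∀ {p q} → negX.ι (x , p) N.≤ negY.ι (y , q) → negY.ι (y , q) N.≤ negX.ι (x , p) → R) →
      (∀ {p q} → posX.ι (x , p) P.≤ posY.ι (y , q) → posY.ι (y , q) P.≤ posX.ι (x , p) → R) →
      GX.h x D.≤ GY.h y → GY.h y D.≤ GX.h x → R
    strong {x = x} {y} f g p q with em {P = x X.≤ X.ε} | em {P = y Y.≤ Y.ε} | p | q
    ... | yes _ | yes _ | nn r | nn s = f r s
    ... | no _ | no _ | pp r | pp s = g r s
    ... | yes _ | no _ | _ | ()
    ... | no _ | yes _ | () | _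

  mirrorEmbedding : ∀ {a q b o} {F : Frame a q} {G : Frame b o} {h} →
                    IsFrameEmbedding F G h → IsFrameEmbedding (mirror F) (mirror G) h
  mirrorEmbedding e = record
    { mono = mono ; cancel = cancel ; h-∧ = h-∧ ; h-∨ = h-∨ ; h-ε≤ = h-ε≤ ; ε≤h = ε≤h
    ; R⇒ = R⇒ ; R⇐ = R⇐ ; h-ʳ = h-ˡ ; h-ˡ = h-ʳ ; h-⇒ = h-⇒ }
    where open IsFrameEmbedding e

  module FrameEmbeddingTheory {a q} {F G : Frame a q} {h} (e : IsFrameEmbedding F G h) where
    open IsFrameEmbedding e public
    private
      module F = Frame F
      module G = Frame G
      module TF = FrameTheory F
      module TG = FrameTheory G

    ʳ-h : ∀ {x} → h (x F.ʳ) G.≤ h x G.ʳ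
    ʳ-h = G.R⇒≤ʳ (R⇒ TF.xRxʳ)

    ˡ-h : ∀ {x} → h (x F.ˡ) G.≤ h x G.ˡ
    ˡ-h = G.R⇒≤ˡ (R⇒ (F.≤ˡ⇒R F.≤-refl))

    ⋆-h : ∀ {x} → h (x F.⋆) G.≤ h x G.⋆
    ⋆-h = G.R⇒≤⋆ (R⇒ (F.≤⋆⇒R F.≤-refl)) (R⇒ (F.≤⋆⇒R˘ F.≤-refl))

    h-⋆ : ∀ {x} → h x G.⋆ G.≤ h (x F.⋆)
    h-⋆ = G.∧-greatest (G.R⇒≤ˡ (G.≤⋆⇒R˘ G.≤-refl) G.⊙ h-ˡ _) (G.R⇒≤ʳ (G.≤⋆⇒R G.≤-refl) G.⊙ h-ʳ _)
          G.⊙ h-∧ _ _ G.⊙ mono (F.R⇒≤⋆ (F.≤ʳ⇒R F.x∧y≤y) (F.≤ˡ⇒R F.x∧y≤x))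

    ν-h : ∀ {x} → h (TF.ν x) G.≤ TG.ν (h x)
    ν-h = G.∧-greatest (mono F.x∧y≤x G.⊙ ⋆-h)
                       (mono F.x∧y≤y G.⊙ ⋆-h G.⊙ TG.⋆-anti h-⋆)

    h-ν : ∀ {x} → TG.ν (h x) G.≤ h (TF.ν x)
    h-ν = G.∧-mono h-⋆ (TG.⋆-anti ⋆-h G.⊙ h-⋆) G.⊙ h-∧ _ _

    open Chain TG.chain using () renaming (_∼_ to _∼ᴳ_)

    ≈⇒∼ : ∀ {x y} → x G.≤ y → y G.≤ x → x ∼ᴳ y
    ≈⇒∼ p q = G.∧-mono (TG.⋆-anti q) (TG.⋆-anti (TG.⋆-anti p)) ,
              G.∧-mono (TG.⋆-anti p) (TG.⋆-anti (TG.⋆-anti q))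

    chainEmbedding : IsChainEmbedding TF.chain TG.chain h
    chainEmbedding = record
      { mono = λ p → h-ν G.⊙ mono p G.⊙ ν-h
      ; cancel = λ p → cancel (ν-h G.⊙ p G.⊙ h-ν) }

    open IsChainEmbedding chainEmbedding public using () renaming (mono to chain-mono)

    labelEmbedding : IsLabelEmbedding TF.labelling TG.labelling h
    labelEmbedding = record
      { Lab⇒ = λ l p → l (cancel (ʳ-h G.⊙ TG.ʳ-anti h-ν G.⊙ p G.⊙ TG.⋆-anti ν-h G.⊙ h-⋆))
      ; Lab⇐ = λ l p → l (TG.ʳ-anti ν-h G.⊙ h-ʳ _ G.⊙ mono p G.⊙ ⋆-h G.⊙ TG.⋆-anti h-ν)
      ; pred-homo = λ x → ≈⇒∼
          (⋆-h G.⊙ TG.⋆-anti (TG.ʳ-anti ν-h G.⊙ h-ʳ _))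
          (TG.⋆-anti (ʳ-h G.⊙ TG.ʳ-anti h-ν) G.⊙ h-⋆)
      ; succ-homo = λ x → ≈⇒∼
          (ˡ-h G.⊙ TG.ˡ-anti (TG.⋆-anti ν-h G.⊙ h-⋆))
          (TG.ˡ-anti (⋆-h G.⊙ TG.⋆-anti h-ν) G.⊙ h-ˡ _)
      }

    negativeEmbedding : LatticeEmbedding (negative F) (negative G)
    negativeEmbedding = record
      { map = λ (x , p) → h x , ≤ε⇒ p ; mono = mono ; cancel = cancel
      ; map-∧ = h-∧ _ _ ; map-∨ = h-∨ _ _ }

    positiveEmbedding : LatticeEmbedding (positive F) (positive G)
    positiveEmbedding = record
      { map = λ (x , p) → h x , p ∘ ≤ε⇐ ; mono = mono ; cancel = cancel
      ; map-∧ = h-∧ _ _ ; map-∨ = h-∨ _ _ }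

    x≤h-ν : ∀ {x b} → x G.≤ G.ε → TG.ν x G.≤ TG.ν (h b) → x G.≤ h (TF.ν b)
    x≤h-ν p q = TG.≤ν⇒ p G.⊙ q G.⊙ h-ν

    x≤h-ν⋆ : ∀ {x b} → TG.ν (h b) G.≤ TG.ν x → x G.≤ h (TF.ν b F.⋆)
    x≤h-ν⋆ q = TG.⋆-swap G.x∧y≤x G.⊙ TG.⋆-anti (ν-h G.⊙ q) G.⊙ h-⋆

  labelEmbeddingˡ : ∀ {a q} {F G : Frame a q} {h} → IsFrameEmbedding F G h →
                    IsLabelEmbedding (labellingˡ F) (labellingˡ G) h
  labelEmbeddingˡ e = record { Lab⇒ = Lab⇒ ; Lab⇐ = Lab⇐ ; pred-homo = pred-homo ; succ-homo = succ-homo }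
    where open IsLabelEmbedding (FrameEmbeddingTheory.labelEmbedding (mirrorEmbedding e))

  labelPart : ∀ {c ℓ} {A X Y : Chain c ℓ} {f g} {am : ChainAmalgam {A = A} {X} {Y} f g}
              {MA : Labelling A ℓ} {MX : Labelling X ℓ} {MY : Labelling Y ℓ} →
              IsLabelEmbedding MA MX f → IsLabelEmbedding MA MY g → (lam : LabelAmalgam am MX MY) →
              LabelPart MX (LabelAmalgam.labels lam) (ChainAmalgam.i am)
  labelPart f-lab g-lab lam = record
    { Lab⁻¹ = Lab-i⁻¹ ; Q⇒ = Q-i ; Q⇐ = Q-i⁻¹ ; IsPred⁻¹ = IsPred-i }
    where open LabelAmalgamSide f-lab g-lab lam

  -- The amalgam of two frames

  module FrameAmalgam {c ℓ} {FA FX FY : Frame c ℓ} {f g}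
                      (f-emb : IsFrameEmbedding FA FX f) (g-emb : IsFrameEmbedding FA FY g) where
    private
      module A = Frame FA
      module X = Frame FX
      module Y = Frame FY
      module TA = FrameTheory FA
      module TX = FrameTheory FX
      module TY = FrameTheory FY
      module f = FrameEmbeddingTheory f-emb
      module g = FrameEmbeddingTheory g-emb

      am : ChainAmalgam {A = TA.chain} {TX.chain} {TY.chain} f g
      am = chainAmalgam f.chainEmbedding g.chainEmbedding

      open ChainAmalgam am

      lamʳ : LabelAmalgam am TX.labelling TY.labelling
      lamʳ = labelAmalgam am f.labelEmbedding g.labelEmbedding

      f-labˡ : IsLabelEmbedding (labellingˡ FA) (labellingˡ FX) f
      f-labˡ = labelEmbeddingˡ {F = FA} {FX} {f} f-emb

      g-labˡ : IsLabelEmbedding (labellingˡ FA) (labellingˡ FY) g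
      g-labˡ = labelEmbeddingˡ {F = FA} {FY} {g} g-emb

      lamˡ : LabelAmalgam am (labellingˡ FX) (labellingˡ FY)
      lamˡ = labelAmalgam am {MA = labellingˡ FA} {labellingˡ FX} {labellingˡ FY} f-labˡ g-labˡ

      module ʳ = LabelAmalgam lamʳ
      module ˡ = LabelAmalgam lamˡ

      ⊤ : Carrier
      ⊤ = i X.ε

      ⊤∼ : ⊤ ∼ j Y.ε
      ⊤∼ = ∼-trans (i-mono (proj₁ εX) , i-mono (proj₂ εX))
             (∼-trans (commutes A.ε) (j-mono (proj₁ εY) , j-mono (proj₂ εY)))
        where
        εX = f.≈⇒∼ f.ε≤h f.h-ε≤
        εY = g.≈⇒∼ g.h-ε≤ g.ε≤h

      ≼⊤ : ∀ {s} → s ≼ ⊤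
      ≼⊤ {s} = covers (_≼ ⊤) (λ x → i-mono TX.≼ε) (λ y → j-mono TY.≼ε ⊙ proj₂ ⊤∼) s

      partX : FramePart FX T ʳ.labels ˡ.labels ⊤
      partX = record
        { i = i ; i-mono = i-mono ; i-cancel = i-cancel ; ⊤∼ε = ≼-refl , ≼-refl
        ; part₁ = labelPart {am = am} f.labelEmbedding g.labelEmbedding lamʳ
        ; part₂ = labelPart {am = am} f-labˡ g-labˡ lamˡ }

      partY : FramePart FY T ʳ.labels ˡ.labels ⊤
      partY = record
        { i = j ; i-mono = j-mono ; i-cancel = j-cancel ; ⊤∼ε = ⊤∼
        ; part₁ = labelPart {am = opposite-amalgam am} g.labelEmbedding f.labelEmbedding (opposite-labels lamʳ)
        ; part₂ = labelPart {am = opposite-amalgam am} g-labˡ f-labˡ (opposite-labels lamˡ) }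

      module PX = FramePartSide partX
      module PY = FramePartSide partY

      negSpan : NegativeSpan T PX.NegTrivial (c ⊔ ℓ) ℓ
      negSpan = record
        { span = record
          { A = negative FA ; X = negative FX ; Y = negative FY
          ; xi = PX.negIndexing ; yi = PY.negIndexing
          ; fx = f.negativeEmbedding ; gy = g.negativeEmbedding
          ; Trivial-resp = λ p → Sum.map (Labels.Lab-resp ʳ.labels p) (Labels.Lab-resp ˡ.labels p)
          ; agree = λ (a , _) → commutes a
          ; meet = λ {x} {y} → negMeet {x} {y}
          }
        ; bA = negative-isBrouwerian FA ; bX = negative-isBrouwerian FX ; bY = negative-isBrouwerian FY
        ; f-⊤ = f.ε≤h ; g-⊤ = g.ε≤h ; f-⇒ = f.h-⇒ _ _ ; g-⇒ = g.h-⇒ _ _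
        ; ≼⊤ˣ = ≼⊤ ; ≼⊤ʸ = ≼⊤ ⊙ proj₁ ⊤∼
        }
        where
        negMeet : ∀ {x : LatticeOrder.Carrier (negative FX)} {y : LatticeOrder.Carrier (negative FY)} →
                  i (proj₁ x) ∼ j (proj₁ y) →
                  ∃ λ (b : LatticeOrder.Carrier (negative FA)) →
                    i (proj₁ x) ∼ i (f (proj₁ b)) × proj₁ x X.≤ f (proj₁ b) × proj₁ y Y.≤ g (proj₁ b)
        negMeet {x , p} {y , q} s with meet s
        -- `ν b` has the class of b and is the greatest negative element of it, so its images bound
        -- x and y.
        ... | b , r , r′ = (TA.ν b , TA.ν≤ε) , ∼-trans r (i-mono (f.chain-mono (proj₂ νb)) , i-mono (f.chain-mono (proj₁ νb))) ,
              f.x≤h-ν p (i-cancel (proj₁ r)) , g.x≤h-ν q (j-cancel (proj₁ r′))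
          where νb = TA.ν-∼ {b}

      posSpan : Span (below T ⊤) PX.PosTrivial (c ⊔ ℓ) ℓ
      posSpan = record
        { A = positive FA ; X = positive FX ; Y = positive FY
        ; xi = PX.posIndexing ; yi = PY.posIndexing
        ; fx = f.positiveEmbedding ; gy = g.positiveEmbedding
        ; Trivial-resp = λ p → Sum.map (λ (s , π) → s , IsPred-resp ʳ.labels (swap p) π)
                                       (λ (s , π) → s , IsPred-resp ˡ.labels (swap p) π)
        ; agree = λ (a , _) → ∼-sym (commutes a)
        ; meet = λ {x} {y} → posMeet {x} {y}
        }
        where
        IsPred-resp : (M : Labels T (c ⊔ ℓ)) → ∀ {s t u} → s ∼ t → Labels.IsPred M s u → Labels.IsPred M t u
        IsPred-resp M (p , q) (l , r , k) = l , ≼-≺-trans q r , λ z v → k z v ⊙ p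
        posMeet : ∀ {x : LatticeOrder.Carrier (positive FX)} {y : LatticeOrder.Carrier (positive FY)} →
                  j (proj₁ y) ≼ i (proj₁ x) × i (proj₁ x) ≼ j (proj₁ y) →
                  ∃ λ (b : LatticeOrder.Carrier (positive FA)) →
                    (i (f (proj₁ b)) ≼ i (proj₁ x) × i (proj₁ x) ≼ i (f (proj₁ b))) ×
                    proj₁ x X.≤ f (proj₁ b) × proj₁ y Y.≤ g (proj₁ b)
        posMeet {x , p} {y , q} (s , s′) with meet (s′ , s)
        -- The positive counterpart `ν b ⋆`. It is not below ε because its image lies above x, which
        -- is not.
        ... | b , r , r′ = (TA.ν b A.⋆ , λ n → p (x≤ X.⊙ f.≤ε⇒ n)) ,
              (i-mono (f.chain-mono (proj₁ νb)) ⊙ proj₂ r , proj₁ r ⊙ i-mono (f.chain-mono (proj₂ νb))) ,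
              x≤ , g.x≤h-ν⋆ (j-cancel (proj₂ r′))
          where
          νb = TA.ν⋆-∼ {b}
          x≤ = f.x≤h-ν⋆ (i-cancel (proj₂ r))

      -- The factor that supplies the first label also has the second one, by `Lab⁻¹`. So both
      -- labels meet in a single frame, where they exclude each other.
      exclusiveˣʸ : ∀ {s} → ʳ.Lab s → ¬ ˡ.Lab s
      exclusiveˣʸ l l′ =
        [ (λ (x , p , m) → exclusive FX m (LabelPart.Lab⁻¹ (FramePart.part₂ partX)
            (Labels.Lab-resp ˡ.labels (∼-sym p) l′)))
        , (λ (y , p , m) → exclusive FY m (LabelPart.Lab⁻¹ (FramePart.part₂ partY)
            (Labels.Lab-resp ˡ.labels (∼-sym p) l′))) ]′ (ʳ.Lab-covers l)

      unlabelledʳ : ∀ {s} → ⊤ ≼ s → ¬ ʳ.Lab s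
      unlabelledʳ p l =
        [ (λ (x , (_ , q) , m) → TX.ε-unlabelled (i-cancel (p ⊙ q)) m)
        , (λ (y , (_ , q) , m) → TY.ε-unlabelled (j-cancel (proj₂ ⊤∼ ⊙ p ⊙ q)) m) ]′ (ʳ.Lab-covers l)

      unlabelledˡ : ∀ {s} → ⊤ ≼ s → ¬ ˡ.Lab s
      unlabelledˡ p l =
        [ (λ (x , (_ , q) , m) → FrameTheory.ε-unlabelled (mirror FX) (i-cancel (p ⊙ q)) m)
        , (λ (y , (_ , q) , m) → FrameTheory.ε-unlabelled (mirror FY) (j-cancel (proj₂ ⊤∼ ⊙ p ⊙ q)) m)
        ]′ (ˡ.Lab-covers l)

      module neg = NegativeAmalgam (negativeAmalgam negSpan)
      module pos = PositiveAmalgam (positiveAmalgam posSpan)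

      S : SumData (suc (c ⊔ ℓ)) c (c ⊔ ℓ)
      S = record
        { K = T ; ⊤ = ⊤ ; ≼⊤ = ≼⊤ ; labels₁ = ʳ.labels ; labels₂ = ˡ.labels
        ; exclusive-labels = exclusiveˣʸ
        ; ⊤-unlabelled₁ = unlabelledʳ ; ⊤-unlabelled₂ = unlabelledˡ
        ; N = neg.N ; P = pos.N
        ; topᴺ = neg.top ; index-topᴺ = neg.index-top ; ≤topᴺ = neg.≤top
        ; topᴾ = λ s n → pos.top (s , n)
        ; index-topᴾ = λ s n → swap (pos.index-top (s , n)) ; ≤topᴾ = pos.≤top
        ; _⊃_ = neg._⊃_ ; ⊃-intro = neg.⊃-intro ; ⊃-elim = neg.⊃-elim
        }

      module neg′ = IndexedAmalgam neg.amalgam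
      module pos′ = IndexedAmalgam pos.amalgam

      embeddingX : PartEmbedding FX S
      embeddingX = record { part = partX ; neg = neg′.x-emb ; pos = pos′.x-emb ; neg-⇒ = neg.x-⇒ }

      embeddingY : PartEmbedding FY S
      embeddingY = record { part = partY ; neg = neg′.y-emb ; pos = pos′.y-emb ; neg-⇒ = neg.y-⇒ }

      module G = GluedPair embeddingX embeddingY

    amalgam : Frame (suc (c ⊔ ℓ)) (suc (c ⊔ ℓ))
    amalgam = SumFrame.sumFrame S

    module amalgam = Frame amalgam

    hX : X.Carrier → amalgam.Carrier
    hX = G.GX.h

    hY : Y.Carrier → amalgam.Carrier
    hY = G.GY.h

    hX-embedding : IsFrameEmbedding FX amalgam hX
    hX-embedding = G.GX.isFrameEmbedding

    hY-embedding : IsFrameEmbedding FY amalgam hY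
    hY-embedding = G.GY.isFrameEmbedding

    hX∘f≤hY∘g : ∀ a → hX (f a) amalgam.≤ hY (g a)
    hX∘f≤hY∘g a = proj₁ (G.commutes f.≤ε⇒ f.≤ε⇐ g.≤ε⇒ g.≤ε⇐
      (λ p → neg′.commutes (a , p)) (λ n → pos′.commutes (a , n)))

    hY∘g≤hX∘f : ∀ a → hY (g a) amalgam.≤ hX (f a)
    hY∘g≤hX∘f a = proj₂ (G.commutes f.≤ε⇒ f.≤ε⇐ g.≤ε⇒ g.≤ε⇐
      (λ p → neg′.commutes (a , p)) (λ n → pos′.commutes (a , n)))

    strong : ∀ {x y} → hX x amalgam.≤ hY y → hY y amalgam.≤ hX x → ∃ λ a → f a X.≤ x × x X.≤ f a
    strong = G.strong (λ r s → let ((a , _) , u , v) = neg′.strong r s in a , u , v)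
                      (λ r s → let ((a , _) , u , v) = pos′.strong r s in a , u , v)

  -- Frames as residuated lattices

  module Multiplication {a q} (F : Frame a q) where
    open Frame F
    private
      module T = FrameTheory F

    infixl 8 _∙_
    _∙_ : Op₂ Carrier
    x ∙ y with em {P = x R y}
    ... | yes _ = x ∧ y
    ... | no _ = x ∨ y

    ∧≤∙ : ∀ {x y} → x ∧ y ≤ x ∙ y
    ∧≤∙ {x} {y} with em {P = x R y}
    ... | yes _ = ≤-refl
    ... | no _ = x∧y≤x ⊙ x≤x∨y

    ∙≤∨ : ∀ {x y} → x ∙ y ≤ x ∨ y
    ∙≤∨ {x} {y} with em {P = x R y}
    ... | yes _ = x∧y≤x ⊙ x≤x∨y
    ... | no _ = ≤-refl

    R⇒∙≤∧ : ∀ {x y} → x R y → x ∙ y ≤ x ∧ y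
    R⇒∙≤∧ {x} {y} r with em {P = x R y}
    ... | yes _ = ≤-refl
    ... | no ¬r = ⊥-elim (¬r r)

    ¬R⇒∨≤∙ : ∀ {x y} → ¬ x R y → x ∨ y ≤ x ∙ y
    ¬R⇒∨≤∙ {x} {y} ¬r with em {P = x R y}
    ... | yes r = ⊥-elim (¬r r)
    ... | no _ = ≤-refl

    ∙-mono : ∀ {x y x′ y′} → x ≤ x′ → y ≤ y′ → x ∙ y ≤ x′ ∙ y′
    ∙-mono {x′ = x′} {y′} p q with em {P = x′ R y′}
    ... | yes r = R⇒∙≤∧ (T.R-mono p q r) ⊙ ∧-mono p q
    ... | no _ = ∙≤∨ ⊙ ∨-mono p q

    ∙≤ε⇒R : ∀ {x y} → x ∙ y ≤ ε → x R y
    ∙≤ε⇒R {x} {y} p with em {P = x R y}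
    ... | yes r = r
    ... | no _ = T.≤ε-R (x≤x∨y ⊙ p) (y≤x∨y ⊙ p)

    R⇒∙≤ε : ∀ {x y} → x R y → x ∙ y ≤ ε
    R⇒∙≤ε {x} {y} r with conic x
    ... | inj₁ p = R⇒∙≤∧ r ⊙ x∧y≤x ⊙ p
    ... | inj₂ p = R⇒∙≤∧ r ⊙ x∧y≤y ⊙ εR⇒≤ε (T.R-mono p ≤-refl r)

    R-∨ˡ : ∀ {x y z} → x R z → y R z → (x ∨ y) R z
    R-∨ˡ p q = ≤ˡ⇒R (∨-least (R⇒≤ˡ p) (R⇒≤ˡ q))

    -- The smaller of `y ⋆ ⋆` and `z ⋆ ⋆` is below `(y ∧ z) ⋆ ⋆`, and this is below `x ʳ` since
    -- `x ʳ` is closed.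
    R-∧-prime : ∀ {x y z} → x R (y ∧ z) → x R y ⊎ x R z
    R-∧-prime {x} {y} {z} r with T.⋆-conical (y ⋆) (z ⋆ ⋆)
    ... | inj₁ p = inj₂ (≤ʳ⇒R (T.x≤x⋆⋆ ⊙ ∧-greatest p ≤-refl ⊙ ⋆⋆-∧ ⊙ T.⋆-anti (T.⋆-anti (R⇒≤ʳ r)) ⊙ ʳ-closed))
    ... | inj₂ p = inj₁ (≤ʳ⇒R (T.x≤x⋆⋆ ⊙ ∧-greatest ≤-refl p ⊙ ⋆⋆-∧ ⊙ T.⋆-anti (T.⋆-anti (R⇒≤ʳ r)) ⊙ ʳ-closed))

    -- The products are expanded according to R. The critical case is `¬ x R y` with `y R z`: the
    -- frame axioms give `z ≤ x` and then, according to whether `x R z`, either `z ≤ y` or `y ≤ x`.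
    -- The converse inequality is this one in the mirror image.
    assoc≤ : ∀ x y z → (x ∙ y) ∙ z ≤ x ∙ (y ∙ z)
    assoc≤ x y z = by-cases em em em
      where
      y∨z≤ : ¬ y R z → ¬ x R y → (x ∨ (y ∨ z)) ≤ x ∙ (y ∙ z)
      y∨z≤ n m = ¬R⇒∨≤∙ (λ r → m (T.R-mono ≤-refl x≤x∨y r)) ⊙ ∙-mono ≤-refl (¬R⇒∨≤∙ n)
      by-cases : Dec (x R y) → Dec (y R z) → Dec (x R z) → (x ∙ y) ∙ z ≤ x ∙ (y ∙ z)
      by-cases (yes p) (yes q) _ =
        ∙-mono (R⇒∙≤∧ p) ≤-refl ⊙ R⇒∙≤∧ (T.R-mono x∧y≤y ≤-refl q)
        ⊙ ∧-greatest (x∧y≤x ⊙ x∧y≤x) (∧-mono x∧y≤y ≤-refl ⊙ ∧≤∙) ⊙ ∧≤∙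
      by-cases (no p) (no q) _ =
        ∙-mono ∙≤∨ ≤-refl ⊙ ∙≤∨ ⊙ ∨-least (∨-mono ≤-refl x≤x∨y) (y≤x∨y ⊙ y≤x∨y) ⊙ y∨z≤ q p
      by-cases (yes p) (no q) (yes r) =
        ∙-mono (R⇒∙≤∧ p) ≤-refl ⊙ R⇒∙≤∧ (T.R-mono x∧y≤x ≤-refl r)
        ⊙ ∧-mono x∧y≤x (y≤x∨y ⊙ ¬R⇒∨≤∙ q) ⊙ ∧≤∙
      by-cases (yes p) (no q) (no r) =
        ∙-mono (R⇒∙≤∧ p) ≤-refl ⊙ ∙≤∨ ⊙ ∨-mono x∧y≤x y≤x∨y
        ⊙ ¬R⇒∨≤∙ (λ s → r (T.R-mono ≤-refl y≤x∨y s)) ⊙ ∙-mono ≤-refl (¬R⇒∨≤∙ q)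
      by-cases (no p) (yes q) (yes r) =
        ∙-mono ∙≤∨ ≤-refl ⊙ R⇒∙≤∧ (R-∨ˡ r q) ⊙ x∧y≤y
        ⊙ ∧-greatest (¬R-R⇒≥ p q) (∧-greatest (R˘-separates r p) ≤-refl ⊙ ∧≤∙) ⊙ ∧≤∙
      by-cases (no p) (yes q) (no r) =
        ∙-mono ∙≤∨ ≤-refl ⊙ ∙≤∨
        ⊙ ∨-least (∨-least ≤-refl (R-separates q r)) (¬R-R⇒≥ p q)
        ⊙ x≤x∨y ⊙ ¬R⇒∨≤∙ (λ s → [ p , r ]′ (R-∧-prime s)) ⊙ ∙-mono ≤-refl ∧≤∙

    ε∙≤ : ∀ x → ε ∙ x ≤ x
    ε∙≤ x with em {P = ε R x} | conic x
    ... | yes _ | _ = x∧y≤y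
    ... | no _ | inj₂ p = ∨-least p ≤-refl
    ... | no n | inj₁ p = ⊥-elim (n (≤ε⇒εR p))

    ≤ε∙ : ∀ x → x ≤ ε ∙ x
    ≤ε∙ x with em {P = ε R x}
    ... | yes r = ∧-greatest (εR⇒≤ε r) ≤-refl
    ... | no _ = y≤x∨y

    -- If `x ≤ z`, the solutions y of `x ∙ y ≤ z` include both `x ʳ` and z, and their join turns out
    -- to be the greatest. Otherwise `x R y` must hold, since a join would be above x, so the
    -- product is `x ∧ y`. For `ε ≤ x` this meet is y itself; for x below ε the solution y must be
    -- below ε as well, and the implication applies.
    infixl 8 _\\_
    _\\_ : Op₂ Carrier
    x \\ z with em {P = x ≤ z} | em {P = ε ≤ x}
    ... | yes _ | _ = x ʳ ∨ z
    ... | no _ | yes _ = x ʳ ∧ z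
    ... | no _ | no _ = x ⇒ z

    \\-cases : ∀ {x z w} → (x ≤ z → x ʳ ∨ z ≤ w) → (ε ≤ x → x ʳ ∧ z ≤ w) →
               (x ≤ ε → x ⇒ z ≤ w) → x \\ z ≤ w
    \\-cases {x} {z} f g h with em {P = x ≤ z} | em {P = ε ≤ x}
    ... | yes p | _ = f p
    ... | no _ | yes p = g p
    ... | no _ | no p = h ([ id , (λ q → ⊥-elim (p q)) ]′ (conic x))

    \\⇒∙ : ∀ {x y z} → y ≤ x \\ z → x ∙ y ≤ z
    \\⇒∙ {x} {y} {z} p with em {P = x ≤ z} | em {P = ε ≤ x}
    ... | no _ | yes _ = R⇒∙≤∧ (≤ʳ⇒R (p ⊙ x∧y≤x)) ⊙ x∧y≤y ⊙ p ⊙ x∧y≤y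
    ... | no _ | no n = R⇒∙≤∧ (T.≤ε-R ([ id , (λ q → ⊥-elim (n q)) ]′ (conic x)) (p ⊙ ⇒-≤ε))
                        ⊙ ∧-mono ≤-refl p ⊙ ⇒-elim
    ... | yes q | _ with em {P = x R y} | em {P = x R z}
    ...   | yes _ | _ = x∧y≤x ⊙ q
    ...   | no n | yes r = ⊥-elim (n (≤ʳ⇒R (p ⊙ ∨-least ≤-refl (R⇒≤ʳ r))))
    -- As `x R z` fails, `x ʳ ≤ z`, so the join of the two is z.
    ...   | no _ | no m = ∨-least q (p ⊙ ∨-least (R˘-separates T.xRxʳ m) ≤-refl)

    ∙⇒\\ : ∀ {x y z} → x ∙ y ≤ z → y ≤ x \\ z
    ∙⇒\\ {x} {y} {z} p with em {P = x ≤ z} | em {P = ε ≤ x} | em {P = x R y}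
    ... | yes _ | _ | yes r = R⇒≤ʳ r ⊙ x≤x∨y
    ... | yes _ | _ | no n = y≤x∨y ⊙ p ⊙ y≤x∨y
    ... | no n | _ | no _ = ⊥-elim (n (x≤x∨y ⊙ p))
    ... | no n | yes q | yes r = ∧-greatest (R⇒≤ʳ r)
            (∧-greatest (εR⇒≤ε (T.R-mono q ≤-refl r) ⊙ q) ≤-refl ⊙ p)
    ... | no n | no m | yes r with conic x | conic y
    ...   | inj₂ q | _ = ⊥-elim (m q)
    ...   | inj₁ q | inj₁ s = ⇒-intro s p
    ...   | inj₁ q | inj₂ s = ⊥-elim (n (∧-greatest ≤-refl (q ⊙ s) ⊙ p))

  module FromFrame {a q} (F : Frame a q) where
    open Frame F
    open Multiplication F
    private
      module T = FrameTheory F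
      module M = FrameTheory (mirror F)
    module M∙ = Multiplication (mirror F)

    ∙⇒mirror : ∀ {x y} → x ∙ y ≤ y M∙.∙ x
    ∙⇒mirror {x} {y} with em {P = x R y}
    ... | yes _ = ∧-greatest x∧y≤y x∧y≤x
    ... | no _ = ∨-least y≤x∨y x≤x∨y

    mirror⇒∙ : ∀ {x y} → y M∙.∙ x ≤ x ∙ y
    mirror⇒∙ {x} {y} with em {P = x R y}
    ... | yes _ = ∧-greatest x∧y≤y x∧y≤x
    ... | no _ = ∨-least y≤x∨y x≤x∨y

    assoc≥ : ∀ x y z → x ∙ (y ∙ z) ≤ (x ∙ y) ∙ z
    assoc≥ x y z = ∙-mono ≤-refl ∙⇒mirror ⊙ ∙⇒mirror ⊙ M∙.assoc≤ z y x ⊙ mirror⇒∙ ⊙ ∙-mono mirror⇒∙ ≤-refl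

    infixl 8 _//_
    _//_ : Op₂ Carrier
    z // y = y M∙.\\ z

    infix 4 _≈_
    _≈_ : Rel Carrier q
    _≈_ = SymInterior _≤_

    private
      orderTheoreticLattice : OrderTheoretic.Lattice a q q
      orderTheoreticLattice = record
        { _≈_ = _≈_ ; _≤_ = _≤_ ; _∨_ = _∨_ ; _∧_ = _∧_
        ; isLattice = record
          { isPartialOrder = Symmetric.isPartialOrder ≤-refl ≤-trans
          ; supremum = λ x y → x≤x∨y , y≤x∨y , λ _ → ∨-least
          ; infimum = λ x y → x∧y≤x , x∧y≤y , λ _ → ∧-greatest } }

      ≤⇒≤∧ : ∀ {x y} → x ≤ y → x ≈ x ∧ y
      ≤⇒≤∧ p = ∧-greatest ≤-refl p , x∧y≤x

      ≤∧⇒≤ : ∀ {x y} → x ≈ x ∧ y → x ≤ y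
      ≤∧⇒≤ (p , _) = p ⊙ x∧y≤y


    residuatedLattice : ResiduatedLattice a q
    residuatedLattice = record
      { Carrier = Carrier ; _≈_ = _≈_ ; _∧_ = _∧_ ; _∨_ = _∨_ ; _∙_ = _∙_ ; _\\_ = _\\_ ; _//_ = _//_ ; ε = ε
      ; isLattice = OrderTheoreticLattice.isAlgLattice orderTheoreticLattice
      ; isMonoid = record
        { isSemigroup = record
          { isMagma = record
            { isEquivalence = Symmetric.isEquivalence ≤-refl ≤-trans
            ; ∙-cong = λ (p , p′) (q , q′) → ∙-mono p q , ∙-mono p′ q′ }
          ; assoc = λ x y z → assoc≤ x y z , assoc≥ x y z }
        ; identity = (λ x → ε∙≤ x , ≤ε∙ x) ,
                     (λ x → ∙⇒mirror ⊙ M∙.ε∙≤ x , M∙.≤ε∙ x ⊙ mirror⇒∙) }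
      ; \\-cong = λ (p , p′) (q , q′) → \\-mono p′ q , \\-mono p q′
      ; //-cong = λ (p , p′) (q , q′) → //-mono p q′ , //-mono p′ q
      ; \\-residual = λ x y z → mk⇔ (λ p → ≤⇒≤∧ (\\⇒∙ (≤∧⇒≤ p))) (λ p → ≤⇒≤∧ (∙⇒\\ (≤∧⇒≤ p)))
      ; //-residual = λ x y z → mk⇔ (λ p → ≤⇒≤∧ (M∙.∙⇒\\ (mirror⇒∙ ⊙ ≤∧⇒≤ p)))
                                    (λ p → ≤⇒≤∧ (∙⇒mirror ⊙ M∙.\\⇒∙ (≤∧⇒≤ p)))
      }
      where
      \\-mono : ∀ {x x′ z z′} → x′ ≤ x → z ≤ z′ → x \\ z ≤ x′ \\ z′
      \\-mono p q = ∙⇒\\ (∙-mono p ≤-refl ⊙ \\⇒∙ ≤-refl ⊙ q)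
      //-mono : ∀ {x x′ z z′} → z ≤ z′ → x′ ≤ x → z // x ≤ z′ // x′
      //-mono q p = M∙.∙⇒\\ (M∙.∙-mono p ≤-refl ⊙ M∙.\\⇒∙ ≤-refl ⊙ q)

    private
      module L = ResiduatedLattice residuatedLattice

      -- `x ∙ y ≤ ε` is equivalent to `x R y`, so the residuals into ε of the lattice and of the
      -- frame agree. The slack `y ≤ x` lets these comparisons be nested in iterated residuals.
      ʳ≤ : ∀ {x y} → y ≤ x → x L.ʳ ≤ y ʳ
      ʳ≤ p = R⇒≤ʳ (T.R-mono p ≤-refl (∙≤ε⇒R (\\⇒∙ ≤-refl)))

      ≤ʳ : ∀ {x y} → y ≤ x → x ʳ ≤ y L.ʳ
      ≤ʳ p = ∙⇒\\ (R⇒∙≤ε (T.R-mono p ≤-refl T.xRxʳ))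

      ˡ≤ : ∀ {x y} → y ≤ x → x L.ˡ ≤ y ˡ
      ˡ≤ p = R⇒≤ˡ (M.R-mono p ≤-refl (M∙.∙≤ε⇒R (M∙.\\⇒∙ ≤-refl)))

      ≤ˡ : ∀ {x y} → y ≤ x → x ˡ ≤ y L.ˡ
      ≤ˡ p = M∙.∙⇒\\ (M∙.R⇒∙≤ε (M.R-mono p ≤-refl M.xRxʳ))

      ⋆≤ : ∀ {x y} → y ≤ x → x L.⋆ ≤ y ⋆
      ⋆≤ p = R⇒≤⋆ (≤ʳ⇒R (x∧y≤y ⊙ ʳ≤ p)) (≤ˡ⇒R (x∧y≤x ⊙ ˡ≤ p))

      ≤⋆ : ∀ {x y} → y ≤ x → x ⋆ ≤ y L.⋆
      ≤⋆ p = ∧-greatest (M.⋆≤ʳ ⊙ ≤ˡ p) (T.⋆≤ʳ ⊙ ≤ʳ p)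

      γ≤ : ∀ {x} → L.γ x ≤ x ⋆ ⋆
      γ≤ = R⇒≤⋆ (≤ʳ⇒R (x∧y≤x ⊙ ʳ≤ (M.⋆≤ʳ ⊙ ≤ˡ ≤-refl))) (≤ˡ⇒R (x∧y≤y ⊙ ˡ≤ (T.⋆≤ʳ ⊙ ≤ʳ ≤-refl)))

      ≤γ : ∀ {x} → x ⋆ ⋆ ≤ L.γ x
      ≤γ = ∧-greatest
        (T.⋆-anti (T.⋆-anti (R⇒≤ʳ (≤ˡ⇒R ≤-refl))) ⊙ ʳ-closed ⊙ ≤ʳ (ˡ≤ ≤-refl))
        (T.⋆-anti (T.⋆-anti (R⇒≤ˡ (≤ʳ⇒R ≤-refl))) ⊙ ˡ-closed ⊙ ≤ˡ (ʳ≤ ≤-refl))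

      ≤⋆⋆ : ∀ {x} → x ≤ x L.⋆ L.⋆
      ≤⋆⋆ = T.x≤x⋆⋆ ⊙ ≤⋆ (⋆≤ ≤-refl)

    isRigidConjunctiveConicIdempotent : IsRigidConjunctiveConicIdempotent residuatedLattice
    isRigidConjunctiveConicIdempotent = record
      { idempotent = λ x → ∙≤∨ ⊙ ∨-least ≤-refl ≤-refl , ∧-greatest ≤-refl ≤-refl ⊙ ∧≤∙
      ; conic = λ x → Sum.map ≤⇒≤∧ ≤⇒≤∧ (conic x)
      ; rigid = (λ x → ≤⋆⋆ , ⋆≤ (≤⋆ (ʳ≤ ≤-refl)) ⊙ ʳ-closed ⊙ ≤ʳ ≤-refl) ,
                (λ x → ≤⋆⋆ , ⋆≤ (≤⋆ (ˡ≤ ≤-refl)) ⊙ ˡ-closed ⊙ ≤ˡ ≤-refl)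
      ; conjunctive = λ x y →
          γ≤ ⊙ ∧-greatest (T.⋆-anti (T.⋆-anti x∧y≤x) ⊙ ≤γ) (T.⋆-anti (T.⋆-anti x∧y≤y) ⊙ ≤γ) ,
          ∧-mono γ≤ γ≤ ⊙ ⋆⋆-∧ ⊙ ≤γ
      }

  -- Embeddings of residuated lattices and embeddings of frames

  module _ {c ℓ} {𝐀 𝐁 : ResiduatedLattice c ℓ} (𝐀∈ : IsRigidConjunctiveConicIdempotent 𝐀)
           (𝐁∈ : IsRigidConjunctiveConicIdempotent 𝐁) {f} (f-emb : IsEmbedding 𝐀 𝐁 f) where
    private
      module A = ResiduatedLattice 𝐀
      module B = ResiduatedLattice 𝐁
      module OB = OfResiduatedLattice 𝐁
      open IsEmbedding f-emb
      open LatticeMorphisms.IsLatticeMonomorphism isLatticeMonomorphism using (⟦⟧-cong; injective; ∧-homo; ∨-homo)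
      open MonoidMorphisms.IsMonoidHomomorphism isMonoidHomomorphism using (ε-homo) renaming (homo to ∙-homo)
      open IsLattice B.isLattice using (refl; sym; trans; ∧-cong)

      mono : ∀ {x y} → x A.≤ y → f x B.≤ f y
      mono p = trans (⟦⟧-cong p) (∧-homo _ _)

      cancel : ∀ {x y} → f x B.≤ f y → x A.≤ y
      cancel p = injective (trans p (sym (∧-homo _ _)))

    toFrameEmbedding : IsFrameEmbedding (toFrame 𝐀 𝐀∈) (toFrame 𝐁 𝐁∈) f
    toFrameEmbedding = record
      { mono = mono ; cancel = cancel
      ; h-∧ = λ x y → OB.≈⇒≤ (sym (∧-homo x y))
      ; h-∨ = λ x y → OB.≈⇒≤ (∨-homo x y)
      ; h-ε≤ = OB.≈⇒≤ ε-homo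
      ; ε≤h = OB.≈⇒≤ (sym ε-homo)
      ; R⇒ = λ r → OB.≈⇒≤ (sym (∙-homo _ _)) OB.⊙ mono r OB.⊙ OB.≈⇒≤ ε-homo
      ; R⇐ = λ r → cancel (OB.≈⇒≤ (∙-homo _ _) OB.⊙ r OB.⊙ OB.≈⇒≤ (sym ε-homo))
      ; h-ʳ = λ x → OB.≈⇒≤ (sym (trans (\\-homo x A.ε) (B.\\-cong refl ε-homo)))
      ; h-ˡ = λ x → OB.≈⇒≤ (sym (trans (//-homo A.ε x) (B.//-cong ε-homo refl)))
      ; h-⇒ = λ x y → OB.≈⇒≤ (sym (trans (∧-homo _ _) (∧-cong (trans (\\-homo _ _)
                (B.\\-cong (trans (∧-homo _ _) (∧-cong refl ε-homo)) refl)) ε-homo)))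
      }

  module _ {c ℓ d o} {𝐁 : ResiduatedLattice c ℓ} (𝐁∈ : IsRigidConjunctiveConicIdempotent 𝐁)
           (G : Frame d o) {h} (h-emb : IsFrameEmbedding (toFrame 𝐁 𝐁∈) G h) where
    private
      module B = ResiduatedLattice 𝐁
      module F = Frame (toFrame 𝐁 𝐁∈)
      module G = Frame G
      module GR = FromFrame G
      module GM = Multiplication G
      open OfResiduatedLattice 𝐁
      open Idempotent (IsRigidConjunctiveConicIdempotent.idempotent 𝐁∈)
      open IsFrameEmbedding h-emb
      open IsLattice B.isLattice using (sym)

      ∙-homo : ∀ x y → h (x B.∙ y) GR.≈ h x GM.∙ h y
      ∙-homo x y with em {P = x F.R y}
      ... | yes r =
        (G.∧-greatest (mono (∙≤ε⇒∙≤ˡ r)) (mono (∙≤ε⇒∙≤ʳ r)) G.⊙ GM.∧≤∙) ,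
        (GM.R⇒∙≤∧ (R⇒ r) G.⊙ h-∧ x y G.⊙ mono ∧≤∙)
      ... | no n =
        (mono ∙≤∨ G.⊙ h-∨ x y G.⊙ GM.¬R⇒∨≤∙ (n ∘ R⇐)) ,
        (GM.∙≤∨ G.⊙ G.∨-least (mono (ε≤∙⇒ˡ≤∙ ε≤xy)) (mono (ε≤∙⇒ʳ≤∙ ε≤xy)))
        where ε≤xy = FrameTheory.≰ε⇒ε≤ (toFrame 𝐁 𝐁∈) n

      open SymInterior

      \\-homo : ∀ x z → h (x B.\\ z) GR.≈ h x GM.\\ h z
      \\-homo x z =
        GM.∙⇒\\ (rhs≤lhs (∙-homo x (x B.\\ z)) G.⊙ mono (to (\\-residual _ _ _) ≤-refl)) ,
        GM.\\-cases
          (λ p → G.∨-least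
            (h-ʳ x G.⊙ mono (bound (∙≤ε⇒∙≤ˡ (to (\\-residual _ _ _) ≤-refl) ⊙ cancel p)))
            (mono (bound (∙≤∨ ⊙ ∨-least (cancel p) ≤-refl))))
          (λ _ → G.∧-mono (h-ʳ x) G.≤-refl G.⊙ h-∧ _ _ G.⊙
            mono (bound (∙≤ε⇒∙≤ʳ (to (\\-residual _ _ _) x∧y≤x) ⊙ x∧y≤y)))
          (λ p → h-⇒ x z G.⊙
            mono (bound (∧-greatest (∙ε≤ F.⇒-≤ε) (ε∙≤ (≤ε⇐ p)) ⊙ F.⇒-elim)))
        where
        open B using (\\-residual)
        bound : ∀ {y} → x B.∙ y B.≤ z → y B.≤ x B.\\ z
        bound = from (\\-residual _ _ _)

      //-homo : ∀ z x → h (z B.// x) GR.≈ h z GR.// h x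
      //-homo z x =
        GR.M∙.∙⇒\\ (GR.mirror⇒∙ G.⊙ rhs≤lhs (∙-homo (z B.// x) x) G.⊙ mono (from (//-residual _ _ _) ≤-refl)) ,
        GR.M∙.\\-cases
          (λ p → G.∨-least
            (h-ˡ x G.⊙ mono (bound (∙≤ε⇒∙≤ʳ (from (//-residual _ _ _) ≤-refl) ⊙ cancel p)))
            (mono (bound (∙≤∨ ⊙ ∨-least ≤-refl (cancel p)))))
          (λ _ → G.∧-mono (h-ˡ x) G.≤-refl G.⊙ h-∧ _ _ G.⊙
            mono (bound (∙≤ε⇒∙≤ˡ (from (//-residual _ _ _) x∧y≤x) ⊙ x∧y≤y)))
          (λ p → h-⇒ x z G.⊙
            mono (bound (∧-greatest (ε∙≤ F.⇒-≤ε) (∙ε≤ (≤ε⇐ p)) ⊙ F.⇒-elim)))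
        where
        open B using (//-residual)
        bound : ∀ {y} → y B.∙ x B.≤ z → y B.≤ z B.// x
        bound = to (//-residual _ _ _)

    fromFrameEmbedding : IsEmbedding 𝐁 GR.residuatedLattice h
    fromFrameEmbedding = record
      { isLatticeMonomorphism = record
        { isLatticeHomomorphism = record
          { isRelHomomorphism = record
            { cong = λ p → mono (≈⇒≤ p) , mono (≈⇒≤ (sym p)) }
          ; ∧-homo = λ x y → G.∧-greatest (mono x∧y≤x) (mono x∧y≤y) , h-∧ x y
          ; ∨-homo = λ x y → h-∨ x y , G.∨-least (mono x≤x∨y) (mono y≤x∨y) }
        ; injective = λ (p , q) → ≤-antisym (cancel p) (cancel q) }
      ; isMonoidHomomorphism = record
        { isMagmaHomomorphism = record
          { isRelHomomorphism = record
            { cong = λ p → mono (≈⇒≤ p) , mono (≈⇒≤ (sym p)) }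
          ; homo = ∙-homo }
        ; ε-homo = h-ε≤ , ε≤h }
      ; \\-homo = \\-homo
      ; //-homo = //-homo
      }

  -- The subalgebra generated by v, on terms, which brings the universe level of the
  -- carrier down to that of the generators; excluded middle resizes the equality.
  module Generated {d e c ℓ : Level} (𝐃 : ResiduatedLattice d e) {V : Set c}
                   (v : V → ResiduatedLattice.Carrier 𝐃) where
    private
      module D = ResiduatedLattice 𝐃

    infixr 7 _∧_
    infixr 6 _∨_
    infixl 8 _∙_ _\\_ _//_
    data Term : Set c where
      var : V → Term
      ε : Term
      _∧_ _∨_ _∙_ _\\_ _//_ : Term → Term → Term

    eval : Term → D.Carrier
    eval (var x) = v x
    eval ε = D.ε
    eval (s ∧ t) = eval s D.∧ eval t
    eval (s ∨ t) = eval s D.∨ eval t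
    eval (s ∙ t) = eval s D.∙ eval t
    eval (s \\ t) = eval s D.\\ eval t
    eval (s // t) = eval s D.// eval t

    infix 4 _≈_
    record _≈_ (s t : Term) : Set ℓ where
      constructor ⌊_⌋
      field holds : True (em {P = eval s D.≈ eval t})

    ⌈_⌉ : ∀ {s t} → s ≈ t → eval s D.≈ eval t
    ⌈ ⌊ p ⌋ ⌉ = toWitness p

    ⌊⌋ : ∀ {s t} → eval s D.≈ eval t → s ≈ t
    ⌊⌋ p = ⌊ fromWitness p ⌋

    eval-isLatticeMonomorphism : LatticeMorphisms.IsLatticeMonomorphism
      (record { _≈_ = _≈_ ; _∧_ = _∧_ ; _∨_ = _∨_ }) D.rawLattice eval
    eval-isLatticeMonomorphism = record
      { isLatticeHomomorphism = record
        { isRelHomomorphism = record { cong = ⌈_⌉ }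
        ; ∧-homo = λ _ _ → D≈.refl ; ∨-homo = λ _ _ → D≈.refl }
      ; injective = ⌊⌋ }
      where module D≈ = IsLattice D.isLattice

    eval-isMonoidMonomorphism : MonoidMorphisms.IsMonoidMonomorphism
      (record { _≈_ = _≈_ ; _∙_ = _∙_ ; ε = ε }) D.rawMonoid eval
    eval-isMonoidMonomorphism = record
      { isMonoidHomomorphism = record
        { isMagmaHomomorphism = record
          { isRelHomomorphism = record { cong = ⌈_⌉ }
          ; homo = λ _ _ → D≈.refl }
        ; ε-homo = D≈.refl }
      ; injective = ⌊⌋ }
      where module D≈ = IsLattice D.isLattice

    generated : ResiduatedLattice c ℓ
    generated = record
      { _≈_ = _≈_ ; _∧_ = _∧_ ; _∨_ = _∨_ ; _∙_ = _∙_ ; _\\_ = _\\_ ; _//_ = _//_ ; ε = ε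
      ; isLattice = LatticeMonomorphism.isLattice eval-isLatticeMonomorphism D.isLattice
      ; isMonoid = MonoidMonomorphism.isMonoid eval-isMonoidMonomorphism D.isMonoid
      ; \\-cong = λ p q → ⌊⌋ (D.\\-cong ⌈ p ⌉ ⌈ q ⌉)
      ; //-cong = λ p q → ⌊⌋ (D.//-cong ⌈ p ⌉ ⌈ q ⌉)
      ; \\-residual = λ x y z → let r = D.\\-residual (eval x) (eval y) (eval z) in
          mk⇔ (λ p → ⌊⌋ (to r ⌈ p ⌉)) (λ p → ⌊⌋ (from r ⌈ p ⌉))
      ; //-residual = λ x y z → let r = D.//-residual (eval x) (eval y) (eval z) in
          mk⇔ (λ p → ⌊⌋ (to r ⌈ p ⌉)) (λ p → ⌊⌋ (from r ⌈ p ⌉))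
      }

    generated∈ : IsRigidConjunctiveConicIdempotent 𝐃 → IsRigidConjunctiveConicIdempotent generated
    generated∈ 𝐃∈ = record
      { idempotent = λ x → ⌊⌋ (idempotent (eval x))
      ; conic = λ x → Sum.map ⌊⌋ ⌊⌋ (conic (eval x))
      ; rigid = (λ x → ⌊⌋ (proj₁ rigid (eval x))) , (λ x → ⌊⌋ (proj₂ rigid (eval x)))
      ; conjunctive = λ x y → ⌊⌋ (conjunctive (eval x) (eval y))
      }
      where open IsRigidConjunctiveConicIdempotent 𝐃∈

    var-embedding : ∀ {b r} {𝐁 : ResiduatedLattice b r} {k : ResiduatedLattice.Carrier 𝐁 → V} →
                    IsEmbedding 𝐁 𝐃 (v ∘ k) → IsEmbedding 𝐁 generated (var ∘ k)
    var-embedding e = record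
      { isLatticeMonomorphism = record
        { isLatticeHomomorphism = record
          { isRelHomomorphism = record { cong = λ p → ⌊⌋ (⟦⟧-cong p) }
          ; ∧-homo = λ x y → ⌊⌋ (∧-homo x y) ; ∨-homo = λ x y → ⌊⌋ (∨-homo x y) }
        ; injective = λ p → injective ⌈ p ⌉ }
      ; isMonoidHomomorphism = record
        { isMagmaHomomorphism = record
          { isRelHomomorphism = record { cong = λ p → ⌊⌋ (⟦⟧-cong p) }
          ; homo = λ x y → ⌊⌋ (homo x y) }
        ; ε-homo = ⌊⌋ ε-homo }
      ; \\-homo = λ x y → ⌊⌋ (\\-homo x y)
      ; //-homo = λ x y → ⌊⌋ (//-homo x y)
      }
      where
      open IsEmbedding e
      open LatticeMorphisms.IsLatticeMonomorphism isLatticeMonomorphism using (⟦⟧-cong; injective; ∧-homo; ∨-homo)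
      open MonoidMorphisms.IsMonoidHomomorphism isMonoidHomomorphism using (homo; ε-homo)

theorem5p8 : (∀ {a} → ExcludedMiddle a) → ∀ {c ℓ} → StrongAmalgamationProperty {c} {ℓ} IsRigidConjunctiveConicIdempotent
theorem5p8 em {c} {ℓ} 𝐀 𝐁 𝐂 𝐀∈ 𝐁∈ 𝐂∈ fB fC fB-emb fC-emb =
  generated , generated∈ (isRigidConjunctiveConicIdempotent amalgam) , var ∘ inj₁ , var ∘ inj₂ ,
  var-embedding (fromFrameEmbedding 𝐁∈ amalgam hX-embedding) ,
  var-embedding (fromFrameEmbedding 𝐂∈ amalgam hY-embedding) ,
  commutes , (λ (a , p) → (fB a , p) , (fC a , D.trans (D.sym (commutes a)) p)) , intersection
  where
  open Classical em
  open FrameAmalgam (toFrameEmbedding 𝐀∈ 𝐁∈ fB-emb) (toFrameEmbedding 𝐀∈ 𝐂∈ fC-emb)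
  open FromFrame using (residuatedLattice; isRigidConjunctiveConicIdempotent)
  open Generated {c = c} {ℓ} (residuatedLattice amalgam) [ hX , hY ]′
  module D = IsLattice (ResiduatedLattice.isLattice generated)

  commutes : ∀ a → var (inj₁ (fB a)) ≈ var (inj₂ (fC a))
  commutes a = ⌊⌋ (hX∘f≤hY∘g a , hY∘g≤hX∘f a)

  intersection : ∀ {y} → ∃ (λ b → var (inj₁ b) ≈ y) × ∃ (λ c → var (inj₂ c) ≈ y) →
                 ∃ λ a → var (inj₁ (fB a)) ≈ y
  intersection ((b , p) , (c , q)) =
    let (r , s) = ⌈ D.trans p (D.sym q) ⌉
        (a , u , v) = strong r s
    in a , D.trans (⌊⌋ (mono u , mono v)) p
    where open IsFrameEmbedding hX-embedding using (mono)
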